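{- For every integer $\ell\geq 1$ there is an integer $p$ such that every $2$-connected graph of pathwidth at least $p$ contains $\Gamma_{\ell}^{+}$ or $\nabla_\ell$ as a minor.
   Context: All graphs are finite and simple. For $\ell\ge 0$, $\Gamma_\ell$ denotes the complete binary tree of height $\ell$: the rooted tree in which every non-leaf vertex has exactly two children, with $2^\ell$ leaves and every root-to-leaf path having exactly $\ell$ edges. $\Gamma_\ell^+$ is the graph obtained from $\Gamma_\ell$ by adding one new vertex adjacent to all leaves of $\Gamma_\ell$. The graphs $\nabla_\ell$ ($\ell\ge1$), each with a designated root edge, are defined recursively: $\nabla_1$ is a triangle with one of its edges designated as root edge. Given $\nabla_\ell$, take two disjoint copies $H_1,H_2$ of $\nabla_\ell$ with root edges $e_1,e_2$, and a triangle with edges $e_1',e_2',e_3$; glue $H_i$ to the triangle by identifying $e_i$ with $e_i'$ (for $i=1,2$); the result is $\nabla_{\ell+1}$ with root edge $e_3$. The pathwidth of $G$ is the minimum $k$ such that there are sets $B_1,\dots,B_n\subseteq V(G)$ with $|B_i|\le k+1$, each vertex lying in a non-empty interval of consecutive $B_i$'s, and each edge contained in some $B_i$. -}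

module Defs where

open import Data.Nat using (ℕ; zero; suc; _≤_; _<_)
open import Data.Fin using (Fin)
import Data.Fin as F
open import Data.Fin.Subset using (Subset; _∈_; ∣_∣)
open import Data.Bool using (Bool; true; false)
open import Data.Maybe using (Maybe; just; nothing)
open import Data.List using (List; []; _∷_; length)
open import Data.Unit using (⊤; tt)
open import Data.Sum using (_⊎_; inj₁; inj₂)
open import Data.Product using (Σ; _×_; _,_; ∃; ∃-syntax)
open import Relation.Binary.PropositionalEquality using (_≡_; _≢_)

record Graph : Set where
  field
    size    : ℕ
    adj     : Fin size → Fin size → Bool
    adj-sym : ∀ x y → adj x y ≡ adj y x
    adj-irr : ∀ x → adj x x ≡ false

open Graph public

Edge : (G : Graph) → Fin (size G) → Fin (size G) → Set
Edge G x y = adj G x y ≡ true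

data WalkIn (G : Graph) (P : Fin (size G) → Set) : Fin (size G) → Fin (size G) → Set where
  stop : ∀ {x} → P x → WalkIn G P x x
  step : ∀ {x y z} → P x → Edge G x y → WalkIn G P y z → WalkIn G P x z

Connected : Graph → Set
Connected G = ∀ x y → WalkIn G (λ _ → ⊤) x y

ConnectedWithout : (G : Graph) → Fin (size G) → Set
ConnectedWithout G v = ∀ x y → x ≢ v → y ≢ v → WalkIn G (λ z → z ≢ v) x y

TwoConnected : Graph → Set
TwoConnected G = (2 < size G) × Connected G × (∀ v → ConnectedWithout G v)

record PathDecomposition (G : Graph) (k : ℕ) : Set where
  field
    len       : ℕ
    bag       : Fin len → Subset (size G)
    bag-size  : ∀ i → ∣ bag i ∣ ≤ suc k
    vertex-in : ∀ v → ∃[ i ] (v ∈ bag i)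
    interval  : ∀ v (i j l : Fin len) → i F.≤ j → j F.≤ l →
                v ∈ bag i → v ∈ bag l → v ∈ bag j
    edge-in   : ∀ x y → Edge G x y → ∃[ i ] (x ∈ bag i × y ∈ bag i)

PathwidthAtLeast : Graph → ℕ → Set
PathwidthAtLeast G p = ∀ k → PathDecomposition G k → p ≤ k

record PGraph : Set₁ where
  field
    V : Set
    E : V → V → Set

open PGraph public

-- H is a minor of G: a model assigning to each vertex of G at most one
-- vertex of H (so branch sets are disjoint), such that branch sets are
-- non-empty and connected, and every edge of H is realised by an edge
-- of G between the corresponding branch sets.
record MinorModel (H : PGraph) (G : Graph) : Set where
  field
    φ         : Fin (size G) → Maybe (V H)
    nonempty  : ∀ h → ∃[ x ] (φ x ≡ just h)
    connected : ∀ h x y → φ x ≡ just h → φ y ≡ just h →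
                WalkIn G (λ z → φ z ≡ just h) x y
    edges     : ∀ h h' → E H h h' →
                ∃[ x ] ∃[ y ] (φ x ≡ just h × φ y ≡ just h' × Edge G x y)

IsMinorOf : PGraph → Graph → Set
IsMinorOf H G = MinorModel H G

-- Γ_ℓ^+ : complete binary tree of height ℓ (vertices = binary words of
-- length ≤ ℓ, the root is [], the children of w are b ∷ w) plus an apex
-- (nothing) adjacent to all leaves (words of length ℓ).

TreeV : ℕ → Set
TreeV ℓ = Σ (List Bool) (λ w → length w ≤ ℓ)

data GammaPlusE (ℓ : ℕ) : Maybe (TreeV ℓ) → Maybe (TreeV ℓ) → Set where
  child : ∀ (b : Bool) (w : List Bool) (p : length w ≤ ℓ) (q : length (b ∷ w) ≤ ℓ) →
          GammaPlusE ℓ (just (w , p)) (just (b ∷ w , q))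
  apex  : ∀ (w : List Bool) (p : length w ≤ ℓ) → length w ≡ ℓ →
          GammaPlusE ℓ (just (w , p)) nothing

GammaPlus : ℕ → PGraph
GammaPlus ℓ = record
  { V = Maybe (TreeV ℓ)
  ; E = λ x y → GammaPlusE ℓ x y ⊎ GammaPlusE ℓ y x
  }

-- ∇_ℓ for ℓ = suc k.  Vertices: the two root-edge endpoints (Bool) plus
-- internal vertices NInt k.  NInt 0 = the third triangle vertex;
-- NInt (suc k) = the new triangle vertex c, then the internal vertices of
-- the two copies H₁, H₂ of ∇_(suc k).  The root edge (false,true) of
-- H₁ is glued to the triangle edge {a, c} (false ↦ a, true ↦ c), that of
-- H₂ to {b, c} (false ↦ b, true ↦ c), where a = inj₁ false and
-- b = inj₁ true form the new root edge.

NInt : ℕ → Set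
NInt zero    = ⊤
NInt (suc k) = ⊤ ⊎ (NInt k ⊎ NInt k)

NV : ℕ → Set
NV k = Bool ⊎ NInt k

topApex : (k : ℕ) → NV k
topApex zero    = inj₂ tt
topApex (suc k) = inj₂ (inj₁ tt)

ι₁ ι₂ : ∀ {k} → NV k → NV (suc k)
ι₁ (inj₁ false) = inj₁ false
ι₁ (inj₁ true)  = inj₂ (inj₁ tt)
ι₁ (inj₂ x)     = inj₂ (inj₂ (inj₁ x))
ι₂ (inj₁ false) = inj₁ true
ι₂ (inj₁ true)  = inj₂ (inj₁ tt)
ι₂ (inj₂ x)     = inj₂ (inj₂ (inj₂ x))

data NablaE : (k : ℕ) → NV k → NV k → Set where
  root  : ∀ {k} → NablaE k (inj₁ false) (inj₁ true)
  sideA : ∀ {k} → NablaE k (inj₁ false) (topApex k)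
  sideB : ∀ {k} → NablaE k (inj₁ true) (topApex k)
  left  : ∀ {k x y} → NablaE k x y → NablaE (suc k) (ι₁ x) (ι₁ y)
  right : ∀ {k x y} → NablaE k x y → NablaE (suc k) (ι₂ x) (ι₂ y)

Nabla : (ℓ : ℕ) → 1 ≤ ℓ → PGraph
Nabla (suc k) _ = record
  { V = NV k
  ; E = λ x y → NablaE k x y ⊎ NablaE k y x
  }

{-# OPTIONS --safe #-}
module Submission where

open import Defs
open import Data.Nat using (ℕ; zero; suc; _+_; _≤_; _<_; z≤n; s≤s; s≤s⁻¹; _≤?_; ⌊_/2⌋)
import Data.Nat.Properties as ℕₚ
open import Data.Fin using (Fin; zero; suc)
import Data.Fin as Fin
import Data.Fin.Properties as Finₚ
open import Data.Fin.Properties using (any?)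
import Data.Fin.Subset as Subset
open import Data.Fin.Subset.Properties using (anySubset?)
open import Data.Bool using (Bool; true; false; if_then_else_)
import Data.Bool.Properties as Boolₚ
open import Data.List using (List; []; _∷_; _++_; _ʳ++_; _∷ʳ_; length; reverse; [_])
import Data.List.Properties as Listₚ
open import Data.Maybe using (Maybe; just; nothing)
import Data.Maybe.Properties as Maybeₚ
open import Data.Vec using (lookup; tabulate)
open import Data.Vec.Properties using (lookup∘tabulate; lookup⇒[]=; []=⇒lookup)
open import Data.Product using (Σ; _×_; _,_; proj₁; proj₂; ∃; ∃-syntax)
open import Data.Sum using (_⊎_; inj₁; inj₂)
import Data.Sum as Sum
open import Data.Empty using (⊥; ⊥-elim)
open import Data.Unit using (tt)
open import Relation.Nullary using (¬_; Dec; yes; no; does)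
open import Relation.Nullary.Decidable using (_⊎-dec_; _×-dec_; ¬?; decidable-stable)
open import Relation.Binary.PropositionalEquality using (_≡_; _≢_; refl; sym; trans; cong; subst)
open import Algebra.Properties.CommutativeSemigroup ℕₚ.+-commutativeSemigroup using (interchange)
open import Function using (_∘_; id; case_of_)

-- (1) Large path-width gives a huge complete binary tree as a minor. Call a set good if it can be built vertex by vertex with all
-- inner boundaries of size at most k. Keep a good set A whose boundary has exactly one vertex in each branch set of a partial tree
-- model, maximal among good sets with boundary no larger; add a new vertex next to the boundary vertex of its parent, enlarge
-- to a maximal good set again, and carry the branch sets over by Menger's theorem. Menger's hypothesis holds because, by submodularity,
-- a violating set of smallest boundary would be good, against the maximality of A. The whole graph is not good, so A never is everything.
--
-- (2) In a spanning tree model every subtree D either contains a binary tree of height ℓ all of whose leaves see the connected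
-- complement of D, which gives Γ_ℓ⁺, or it contains a large subtree C not adjacent to the complement. By 2-connectivity D ∖ C splits
-- into two connected rails X and Y, which contain all neighbours of C outside C and both reach the complement of D. Iterating
-- this yields a deeply nested binary family of such pods.
--
-- (3) Let C be attached to the rest of the graph only through connected sets O and W, and let it contain two pods. Contracting O, W and
-- the four rails and deleting the inner cores leaves a 2-connected graph. In it the two pods are either in series between O and W, or
-- parallel, with at least one of the two connecting sides being a tripod that avoids its terminal. Series steps build ∇ and
-- parallel steps with the tripod on a fixed side build Γ_ℓ⁺, so enough levels of pods give one of the two.

-- A 2-connected graph need not have any 2-separation, so it cannot simply be decomposed in series
-- and in parallel. Pods make up for this: a core sees the rest of the graph only through two
-- connected rails, and these behave like two terminals once they are contracted.
--
-- The obstacle in the final recursion is orientation. A parallel step may have its tripod at `O` or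
-- at `W`, and only tripods at the same side combine into a larger Γ⁺; moreover, a series step
-- passes its second core on with the two ends exchanged. The induction therefore pursues three
-- targets at once, each with its own budget: a ∇, a Γ⁺ with its root towards `O` and its apex at
-- `W`, and the reverse. Each step lowers one budget by one for both of its cores, and a target that
-- is already complete in one core is merely prolonged to `O` and `W`. Hence as many levels of pods
-- suffice as there are units in the three budgets together. Every level needs two pods, because
-- both kinds of step join two pieces of equal size.

VSet : ℕ → Set
VSet n = Fin n → Bool

Rel : ℕ → Set
Rel n = Fin n → Fin n → Bool

infix 4 _∈_ _∉_ _∈?_ _⊆_
infixl 6 _∪_ _∖_ _∩_

-- Wrapping the equation in a record stops it from reducing, so that `x` and `S` can be inferred
-- from a membership proof. The set operations are abstract for the same reason.
record _∈_ {n} (x : Fin n) (S : VSet n) : Set where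
  constructor mem
  field unmem : S x ≡ true

open _∈_ public

_∉_ : ∀ {n} → Fin n → VSet n → Set
x ∉ S = ¬ (x ∈ S)

_∈?_ : ∀ {n} (x : Fin n) (S : VSet n) → Dec (x ∈ S)
x ∈? S with S x Boolₚ.≟ true
... | yes p = yes (mem p)
... | no ¬p = no λ q → ¬p (unmem q)

_⊆_ : ∀ {n} → VSet n → VSet n → Set
A ⊆ B = ∀ {x} → x ∈ A → x ∈ B

Disjoint : ∀ {n} → VSet n → VSet n → Set
Disjoint A B = ∀ {x} → x ∈ A → x ∈ B → ⊥

abstract
  ⟦_⟧ : ∀ {n} {P : Fin n → Set} → (∀ x → Dec (P x)) → VSet n
  ⟦ P? ⟧ x = does (P? x)

  mk⁺ : ∀ {n} {P : Fin n → Set} (P? : ∀ x → Dec (P x)) {x} → P x → x ∈ ⟦ P? ⟧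
  mk⁺ P? {x} p with P? x in eq
  ... | yes _ = mem (cong does eq)
  ... | no ¬p = ⊥-elim (¬p p)

  mk⁻ : ∀ {n} {P : Fin n → Set} (P? : ∀ x → Dec (P x)) {x} → x ∈ ⟦ P? ⟧ → P x
  mk⁻ P? {x} (mem q) with P? x
  ... | yes p = p
  mk⁻ P? {x} (mem ()) | no _

  _∪_ : ∀ {n} → VSet n → VSet n → VSet n
  A ∪ B = ⟦ (λ x → (x ∈? A) ⊎-dec (x ∈? B)) ⟧

  _∖_ : ∀ {n} → VSet n → VSet n → VSet n
  A ∖ B = ⟦ (λ x → (x ∈? A) ×-dec ¬? (x ∈? B)) ⟧

  _∩_ : ∀ {n} → VSet n → VSet n → VSet n
  A ∩ B = ⟦ (λ x → (x ∈? A) ×-dec (x ∈? B)) ⟧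

  ∁ : ∀ {n} → VSet n → VSet n
  ∁ A = ⟦ (λ x → ¬? (x ∈? A)) ⟧

  ∅ : ∀ {n} → VSet n
  ∅ = ⟦ (λ (_ : Fin _) → no (λ (e : ⊥) → e)) ⟧

  full : ∀ {n} → VSet n
  full = ⟦ (λ _ → yes tt) ⟧

  ⁅_⁆ : ∀ {n} → Fin n → VSet n
  ⁅ v ⁆ = ⟦ (λ x → x Finₚ.≟ v) ⟧

  fib : ∀ {n} → (Fin n → Maybe ℕ) → ℕ → VSet n
  fib φ m = ⟦ (λ x → Maybeₚ.≡-dec ℕₚ._≟_ (φ x) (just m)) ⟧

  ∪⁺ : ∀ {n} {A B : VSet n} {x} → x ∈ A ⊎ x ∈ B → x ∈ A ∪ B
  ∪⁺ {A = A} {B} = mk⁺ (λ x → (x ∈? A) ⊎-dec (x ∈? B))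

  ∪⁻ : ∀ {n} {A B : VSet n} {x} → x ∈ A ∪ B → x ∈ A ⊎ x ∈ B
  ∪⁻ {A = A} {B} = mk⁻ (λ x → (x ∈? A) ⊎-dec (x ∈? B))

  ∖⁺ : ∀ {n} {A B : VSet n} {x} → x ∈ A → x ∉ B → x ∈ A ∖ B
  ∖⁺ {A = A} {B} a b = mk⁺ (λ x → (x ∈? A) ×-dec ¬? (x ∈? B)) (a , b)

  ∖⁻ : ∀ {n} {A B : VSet n} {x} → x ∈ A ∖ B → x ∈ A × x ∉ B
  ∖⁻ {A = A} {B} = mk⁻ (λ x → (x ∈? A) ×-dec ¬? (x ∈? B))

  ∩⁺ : ∀ {n} {A B : VSet n} {x} → x ∈ A → x ∈ B → x ∈ A ∩ B
  ∩⁺ {A = A} {B} a b = mk⁺ (λ x → (x ∈? A) ×-dec (x ∈? B)) (a , b)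

  ∩⁻ : ∀ {n} {A B : VSet n} {x} → x ∈ A ∩ B → x ∈ A × x ∈ B
  ∩⁻ {A = A} {B} = mk⁻ (λ x → (x ∈? A) ×-dec (x ∈? B))

  ∁⁺ : ∀ {n} {A : VSet n} {x} → x ∉ A → x ∈ ∁ A
  ∁⁺ {A = A} = mk⁺ (λ x → ¬? (x ∈? A))

  ∁⁻ : ∀ {n} {A : VSet n} {x} → x ∈ ∁ A → x ∉ A
  ∁⁻ {A = A} = mk⁻ (λ x → ¬? (x ∈? A))

  ∅⁻ : ∀ {n} {x : Fin n} → x ∉ ∅
  ∅⁻ = mk⁻ (λ _ → no (λ (e : ⊥) → e))

  full⁺ : ∀ {n} {x : Fin n} → x ∈ full
  full⁺ = mk⁺ (λ _ → yes tt) tt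

  ⁅⁆⁺ : ∀ {n} {v : Fin n} → v ∈ ⁅ v ⁆
  ⁅⁆⁺ {v = v} = mk⁺ (λ x → x Finₚ.≟ v) refl

  ⁅⁆⁻ : ∀ {n} {x v : Fin n} → x ∈ ⁅ v ⁆ → x ≡ v
  ⁅⁆⁻ {v = v} = mk⁻ (λ x → x Finₚ.≟ v)

  fib⁺ : ∀ {n} {φ : Fin n → Maybe ℕ} {m x} → φ x ≡ just m → x ∈ fib φ m
  fib⁺ {φ = φ} {m} = mk⁺ (λ x → Maybeₚ.≡-dec ℕₚ._≟_ (φ x) (just m))

  fib⁻ : ∀ {n} {φ : Fin n → Maybe ℕ} {m x} → x ∈ fib φ m → φ x ≡ just m
  fib⁻ {φ = φ} {m} = mk⁻ (λ x → Maybeₚ.≡-dec ℕₚ._≟_ (φ x) (just m))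

∪ˡ : ∀ {n} {A B : VSet n} → A ⊆ A ∪ B
∪ˡ a = ∪⁺ (inj₁ a)

∪ʳ : ∀ {n} {A B : VSet n} → B ⊆ A ∪ B
∪ʳ b = ∪⁺ (inj₂ b)

∪-elim : ∀ {n} {A B C : VSet n} → A ⊆ C → B ⊆ C → A ∪ B ⊆ C
∪-elim f g x = Sum.[ f , g ] (∪⁻ x)

∪-disj : ∀ {n} {A B C : VSet n} → Disjoint A C → Disjoint B C → Disjoint (A ∪ B) C
∪-disj f g x c = Sum.[ (λ a → f a c) , (λ b → g b c) ] (∪⁻ x)

disj-sym : ∀ {n} {A B : VSet n} → Disjoint A B → Disjoint B A
disj-sym d b a = d a b

-- Cardinalities

sum : ∀ {n} → (Fin n → ℕ) → ℕ
sum {zero} f = 0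
sum {suc n} f = f zero + sum (f ∘ suc)

sum-mono : ∀ {n} {f g : Fin n → ℕ} → (∀ x → f x ≤ g x) → sum f ≤ sum g
sum-mono {zero} p = z≤n
sum-mono {suc n} p = ℕₚ.+-mono-≤ (p zero) (sum-mono (p ∘ suc))

sum-strict : ∀ {n} {f g : Fin n → ℕ} → (∀ x → f x ≤ g x) → ∀ s → f s < g s → sum f < sum g
sum-strict p zero q = ℕₚ.+-mono-<-≤ q (sum-mono (p ∘ suc))
sum-strict p (suc s) q = ℕₚ.+-mono-≤-< (p zero) (sum-strict (p ∘ suc) s q)

sum-+ : ∀ {n} (f g : Fin n → ℕ) → sum (λ x → f x + g x) ≡ sum f + sum g
sum-+ {zero} f g = refl
sum-+ {suc n} f g = trans (cong (f zero + g zero +_) (sum-+ (f ∘ suc) (g ∘ suc)))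
  (interchange (f zero) (g zero) (sum (f ∘ suc)) (sum (g ∘ suc)))

ind : ∀ {n} → VSet n → Fin n → ℕ
ind S x = if S x then 1 else 0

ind-∈ : ∀ {n} {S : VSet n} {x} → x ∈ S → ind S x ≡ 1
ind-∈ (mem p) rewrite p = refl

ind-∉ : ∀ {n} {S : VSet n} {x} → x ∉ S → ind S x ≡ 0
ind-∉ {S = S} {x} p with S x in eq
... | true = ⊥-elim (p (mem eq))
... | false = refl

ind≤1 : ∀ {n} (S : VSet n) x → ind S x ≤ 1
ind≤1 S x with S x
... | true = s≤s z≤n
... | false = z≤n

ind-mono : ∀ {n} {A B : VSet n} → A ⊆ B → ∀ x → ind A x ≤ ind B x
ind-mono {A = A} {B} p x with x ∈? A
... | yes a rewrite ind-∈ {S = A} a | ind-∈ {S = B} (p a) = ℕₚ.≤-refl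
... | no ¬a rewrite ind-∉ {S = A} ¬a = z≤n

abstract
  count : ∀ {n} → VSet n → ℕ
  count S = sum (ind S)

  count-zero : (S : VSet 0) → count S ≡ 0
  count-zero S = refl

  count-suc : ∀ {n} (S : VSet (suc n)) → count S ≡ ind S zero + count (S ∘ suc)
  count-suc S = refl

  count-mono : ∀ {n} {A B : VSet n} → A ⊆ B → count A ≤ count B
  count-mono p = sum-mono (ind-mono p)

  count-strict : ∀ {n} {A B : VSet n} → A ⊆ B → ∀ {y} → y ∈ B → y ∉ A → count A < count B
  count-strict {A = A} {B} p {y} b ¬a = sum-strict (ind-mono p) y q
    where q : ind A y < ind B y
          q rewrite ind-∉ {S = A} ¬a | ind-∈ {S = B} b = ℕₚ.≤-refl

  -- The inequality holds for indicators point by point: a point of one of `A`, `B` is counted on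
  -- the right, and a point of both is counted there twice. Submodularity of the boundary and the
  -- insertion bound are both instances.
  count₄ : ∀ {n} {A B C D : VSet n} →
    (∀ {x} → x ∈ A → x ∈ C ⊎ x ∈ D) → (∀ {x} → x ∈ B → x ∈ C ⊎ x ∈ D) →
    (∀ {x} → x ∈ A → x ∈ B → x ∈ C × x ∈ D) → count A + count B ≤ count C + count D
  count₄ {n} {A} {B} {C} {D} f g h =
    subst (_≤ count C + count D) (sum-+ (ind A) (ind B))
      (subst (sum (λ x → ind A x + ind B x) ≤_) (sum-+ (ind C) (ind D)) (sum-mono pt))
    where
    one : ∀ {x} → x ∈ C ⊎ x ∈ D → 1 ≤ ind C x + ind D x
    one {x} (inj₁ c) rewrite ind-∈ {S = C} c = s≤s z≤n
    one {x} (inj₂ d) rewrite ind-∈ {S = D} d = ℕₚ.m≤n+m 1 (ind C x)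
    pt : ∀ x → ind A x + ind B x ≤ ind C x + ind D x
    pt x with x ∈? A | x ∈? B
    ... | yes a | yes b rewrite ind-∈ {S = A} a | ind-∈ {S = B} b
                | ind-∈ {S = C} (proj₁ (h a b)) | ind-∈ {S = D} (proj₂ (h a b)) = ℕₚ.≤-refl
    ... | yes a | no ¬b rewrite ind-∈ {S = A} a | ind-∉ {S = B} ¬b = one (f a)
    ... | no ¬a | yes b rewrite ind-∉ {S = A} ¬a | ind-∈ {S = B} b = one (g b)
    ... | no ¬a | no ¬b rewrite ind-∉ {S = A} ¬a | ind-∉ {S = B} ¬b = z≤n

  count-∅ : ∀ {n} {A : VSet n} → (∀ {x} → x ∉ A) → count A ≡ 0
  count-∅ {zero} p = refl
  count-∅ {suc n} {A} p rewrite ind-∉ {S = A} {zero} p = count-∅ {n} {A ∘ suc} (λ { (mem q) → p (mem q) })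

  count-⁅⁆≤1 : ∀ {n} (v : Fin n) → count ⁅ v ⁆ ≤ 1
  count-⁅⁆≤1 {suc n} zero = ℕₚ.≤-trans (ℕₚ.+-mono-≤ (ind≤1 {suc n} ⁅ zero ⁆ zero) ℕₚ.≤-refl)
    (subst (λ k → 1 + k ≤ 1) (sym (count-∅ {n} {⁅ zero ⁆ ∘ suc} (λ { {x} (mem q) → case ⁅⁆⁻ {x = suc x} {v = zero} (mem q) of λ () }))) ℕₚ.≤-refl)
  count-⁅⁆≤1 {suc n} (suc v) rewrite ind-∉ {S = ⁅ suc v ⁆} {zero} (λ q → case ⁅⁆⁻ {x = zero} {v = suc v} q of λ ()) =
    ℕₚ.≤-trans (count-mono {A = ⁅ suc v ⁆ ∘ suc} {⁅ v ⁆} (λ { {x} (mem q) → subst (_∈ ⁅ v ⁆) (sym (Finₚ.suc-injective (⁅⁆⁻ {x = suc x} {v = suc v} (mem q)))) ⁅⁆⁺ })) (count-⁅⁆≤1 v)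

count-eq : ∀ {n} {A B : VSet n} → A ⊆ B → count B ≤ count A → B ⊆ A
count-eq {A = A} p le {y} b with y ∈? A
... | yes a = a
... | no ¬a = ⊥-elim (ℕₚ.<⇒≱ (count-strict p b ¬a) le)

count-insert : ∀ {n} {A B : VSet n} {v} → (∀ {x} → x ∈ A → x ∈ B ⊎ x ≡ v) → count A ≤ suc (count B)
count-insert {A = A} {B} {v} f = ℕₚ.≤-trans (ℕₚ.m≤m+n (count A) (count {_} ∅))
  (ℕₚ.≤-trans (count₄ {A = A} {∅} {B} {⁅ v ⁆} (λ a → Sum.map₂ (λ { refl → ⁅⁆⁺ }) (f a)) (λ e → ⊥-elim (∅⁻ e)) (λ _ e → ⊥-elim (∅⁻ e)))
    (subst (count B + count ⁅ v ⁆ ≤_) (ℕₚ.+-comm (count B) 1) (ℕₚ.+-monoʳ-≤ (count B) (count-⁅⁆≤1 v))))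

count-swap : ∀ {n} {A B : VSet n} {s u} → s ∈ B → (∀ {x} → x ∈ A → (x ∈ B × x ≢ s) ⊎ x ≡ u) → count A ≤ count B
count-swap {A = A} {B} {s} {u} sB f = ℕₚ.≤-trans
  (count-insert {A = A} {B ∖ ⁅ s ⁆} {u} (λ a → Sum.map₁ (λ { (b , ne) → ∖⁺ b (λ q → ne (⁅⁆⁻ q)) }) (f a)))
  (count-strict (λ q → proj₁ (∖⁻ q)) sB (λ q → proj₂ (∖⁻ q) ⁅⁆⁺))

count≥2 : ∀ {n} {A : VSet n} {x y} → x ∈ A → y ∈ A → x ≢ y → 2 ≤ count A
count≥2 {A = A} {x} {y} a b ne = ℕₚ.≤-trans (s≤s (ℕₚ.≤-trans (s≤s z≤n) one)) two
  where
  one : suc (count {_} ∅) ≤ count ⁅ x ⁆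
  one = count-strict (λ e → ⊥-elim (∅⁻ e)) (⁅⁆⁺ {v = x}) ∅⁻
  two : suc (count ⁅ x ⁆) ≤ count A
  two = count-strict (λ q → subst (_∈ A) (sym (⁅⁆⁻ q)) a) b (λ q → ne (sym (⁅⁆⁻ q)))

-- Walks and connected sets

data Walk {n} (E : Rel n) (P : Fin n → Set) : Fin n → Fin n → Set where
  wstop : ∀ {x} → P x → Walk E P x x
  wstep : ∀ {x y z} → P x → E x y ≡ true → Walk E P y z → Walk E P x z

wmap : ∀ {n} {E : Rel n} {P Q : Fin n → Set} → (∀ {z} → P z → Q z) → ∀ {x y} → Walk E P x y → Walk E Q x y
wmap f (wstop p) = wstop (f p)
wmap f (wstep p e w) = wstep (f p) e (wmap f w)

infixr 5 _++ʷ_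
_++ʷ_ : ∀ {n} {E : Rel n} {P : Fin n → Set} {x y z} → Walk E P x y → Walk E P y z → Walk E P x z
wstop _ ++ʷ v = v
wstep p e w ++ʷ v = wstep p e (w ++ʷ v)

wfirst : ∀ {n} {E : Rel n} {P : Fin n → Set} {x y} → Walk E P x y → P x
wfirst (wstop p) = p
wfirst (wstep p _ _) = p

wlast : ∀ {n} {E : Rel n} {P : Fin n → Set} {x y} → Walk E P x y → P y
wlast (wstop p) = p
wlast (wstep _ _ w) = wlast w

-- Follow the walk to its first edge out of `X`. Since both ends of that edge satisfy `P`, a walk
-- within a set, or around a forbidden vertex, yields an edge with the same restriction.
crossing : ∀ {n} {E : Rel n} {P : Fin n → Set} (X : VSet n) {x y} → Walk E P x y → x ∈ X → y ∉ X →
  ∃[ b ] ∃[ c ] (b ∈ X × c ∉ X × P b × P c × E b c ≡ true)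
crossing X (wstop p) a ¬a = ⊥-elim (¬a a)
crossing X (wstep {y = y} p e w) a ¬a with y ∈? X
... | yes b = crossing X w b ¬a
... | no ¬b = _ , _ , a , ¬b , p , wfirst w , e

-- The empty set counts as connected, so non-emptiness is always recorded separately, by a point or
-- by a touching edge.
Conn : ∀ {n} → Rel n → VSet n → Set
Conn E S = ∀ {x y} → x ∈ S → y ∈ S → Walk E (_∈ S) x y

Touch : ∀ {n} → Rel n → VSet n → VSet n → Set
Touch E A B = ∃[ a ] ∃[ b ] (a ∈ A × b ∈ B × E a b ≡ true)

touch? : ∀ {n} (E : Rel n) (A B : VSet n) → Dec (Touch E A B)
touch? E A B = any? λ a → any? λ b → (a ∈? A) ×-dec (b ∈? B) ×-dec (E a b Boolₚ.≟ true)

touch-mono : ∀ {n} {E : Rel n} {A B A' B' : VSet n} → A ⊆ A' → B ⊆ B' → Touch E A B → Touch E A' B'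
touch-mono f g (a , b , p , q , e) = a , b , f p , g q , e

conn-ext : ∀ {n} {E : Rel n} {A B : VSet n} → A ⊆ B → B ⊆ A → Conn E A → Conn E B
conn-ext f g c x y = wmap f (c (g x) (g y))

conn-single : ∀ {n} {E : Rel n} {v : Fin n} → Conn E ⁅ v ⁆
conn-single p q with ⁅⁆⁻ p | ⁅⁆⁻ q
... | refl | refl = wstop p

-- Partial labellings and their fibres

Labelling : ℕ → Set
Labelling n = Fin n → Maybe ℕ

Extends : ∀ {n} → Labelling n → Labelling n → Set
Extends φ φ' = ∀ {x m} → φ x ≡ just m → φ' x ≡ just m

ConnFibres : ∀ {n} → Rel n → Labelling n → Set
ConnFibres E φ = ∀ {x y m} → φ x ≡ just m → φ y ≡ just m → Walk E (λ z → φ z ≡ just m) x y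

abstract
  upd : ∀ {n} → Labelling n → Fin n → ℕ → Labelling n
  upd φ u m x with x Finₚ.≟ u
  ... | yes _ = just m
  ... | no _ = φ x

  upd-same : ∀ {n} (φ : Labelling n) u m → upd φ u m u ≡ just m
  upd-same φ u m with u Finₚ.≟ u
  ... | yes _ = refl
  ... | no ne = ⊥-elim (ne refl)

  upd-other : ∀ {n} (φ : Labelling n) u m {x} → x ≢ u → upd φ u m x ≡ φ x
  upd-other φ u m {x} ne with x Finₚ.≟ u
  ... | yes e = ⊥-elim (ne e)
  ... | no _ = refl

  upd-inv : ∀ {n} (φ : Labelling n) u m {x l} → upd φ u m x ≡ just l → (x ≡ u × l ≡ m) ⊎ (x ≢ u × φ x ≡ just l)
  upd-inv φ u m {x} p with x Finₚ.≟ u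
  upd-inv φ u m {x} refl | yes e = inj₁ (e , refl)
  ... | no ne = inj₂ (ne , p)

just-inj : ∀ {a b : ℕ} → just a ≡ just b → a ≡ b
just-inj refl = refl

nothing≢just : ∀ {a : ℕ} → nothing ≡ just a → ⊥
nothing≢just ()

upd-ext : ∀ {n} (φ : Labelling n) {u} m → φ u ≡ nothing → Extends φ (upd φ u m)
upd-ext φ {u} m nu {x} p = trans (upd-other φ u m (λ { refl → nothing≢just (trans (sym nu) p) })) p

module Sym {n} (E : Rel n) (E-sym : ∀ {x y} → E x y ≡ true → E y x ≡ true) where

  wrev : ∀ {P : Fin n → Set} {x y} → Walk E P x y → Walk E P y x
  wrev (wstop p) = wstop p
  wrev (wstep p e w) = wrev w ++ʷ wstep (wfirst w) (E-sym e) (wstop p)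

  touch-sym : ∀ {A B : VSet n} → Touch E A B → Touch E B A
  touch-sym (a , b , p , q , e) = b , a , q , p , E-sym e

  conn-∪ : ∀ {A B : VSet n} → Conn E A → Conn E B → Touch E A B → Conn E (A ∪ B)
  conn-∪ {A} {B} cA cB (a , b , aA , bB , e) x y = go (∪⁻ x) (∪⁻ y)
    where
    wA : ∀ {x y} → Walk E (_∈ A) x y → Walk E (_∈ A ∪ B) x y
    wA = wmap ∪ˡ
    wB : ∀ {x y} → Walk E (_∈ B) x y → Walk E (_∈ A ∪ B) x y
    wB = wmap ∪ʳ
    go : ∀ {x y} → x ∈ A ⊎ x ∈ B → y ∈ A ⊎ y ∈ B → Walk E (_∈ A ∪ B) x y
    go (inj₁ p) (inj₁ q) = wA (cA p q)
    go (inj₁ p) (inj₂ q) = wA (cA p aA) ++ʷ wstep (∪ˡ aA) e (wB (cB bB q))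
    go (inj₂ p) (inj₁ q) = wB (cB p bB) ++ʷ wstep (∪ʳ bB) (E-sym e) (wA (cA aA q))
    go (inj₂ p) (inj₂ q) = wB (cB p q)

  conn-share : ∀ {A B : VSet n} {z} → Conn E A → Conn E B → z ∈ A → z ∈ B → Conn E (A ∪ B)
  conn-share {A} {B} {z} cA cB zA zB x y = go (∪⁻ x) (∪⁻ y)
    where
    wA : ∀ {x y} → Walk E (_∈ A) x y → Walk E (_∈ A ∪ B) x y
    wA = wmap ∪ˡ
    wB : ∀ {x y} → Walk E (_∈ B) x y → Walk E (_∈ A ∪ B) x y
    wB = wmap ∪ʳ
    go : ∀ {x y} → x ∈ A ⊎ x ∈ B → y ∈ A ⊎ y ∈ B → Walk E (_∈ A ∪ B) x y
    go (inj₁ p) (inj₁ q) = wA (cA p q)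
    go (inj₁ p) (inj₂ q) = wA (cA p zA) ++ʷ wB (cB zB q)
    go (inj₂ p) (inj₁ q) = wB (cB p zB) ++ʷ wA (cA zA q)
    go (inj₂ p) (inj₂ q) = wB (cB p q)

  record Component (S : VSet n) (x : Fin n) : Set where
    field
      set    : VSet n
      start  : x ∈ set
      inside : set ⊆ S
      conn   : Conn E set
      closed : ∀ {a b} → a ∈ set → b ∈ S → E a b ≡ true → b ∈ set

  opaque
    component : ∀ (S : VSet n) {x} → x ∈ S → Component S x
    component S {x} xS = grow (count (S ∖ ⁅ x ⁆)) ⁅ x ⁆ ⁅⁆⁺ (λ q → subst (_∈ S) (sym (⁅⁆⁻ q)) xS) conn-single ℕₚ.≤-refl
      where
      grow : ∀ k (C : VSet n) → x ∈ C → C ⊆ S → Conn E C → count (S ∖ C) ≤ k → Component S x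
      grow k C xC C⊆S cC le with touch? E C (S ∖ C)
      grow k C xC C⊆S cC le | no ¬t = record
        { set = C ; start = xC ; inside = C⊆S ; conn = cC
        ; closed = λ {a} {b} a∈ b∈ e → decidable-stable (b ∈? C) (λ b∉ → ¬t (a , b , a∈ , ∖⁺ b∈ b∉ , e)) }
      grow zero C xC C⊆S cC le | yes (a , b , a∈ , b∈ , e) =
        ⊥-elim (ℕₚ.<⇒≱ (count-strict {A = ∅} (λ q → ⊥-elim (∅⁻ q)) b∈ ∅⁻) (ℕₚ.≤-trans le z≤n))
      grow (suc k) C xC C⊆S cC le | yes (a , b , a∈ , b∈ , e) =
        grow k (C ∪ ⁅ b ⁆) (∪ˡ xC) (∪-elim C⊆S (λ q → subst (_∈ S) (sym (⁅⁆⁻ q)) (proj₁ (∖⁻ b∈))))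
          (conn-∪ cC conn-single (a , b , a∈ , ⁅⁆⁺ , e))
          (s≤s⁻¹ (ℕₚ.≤-trans (count-strict (λ q → ∖⁺ (proj₁ (∖⁻ q)) (λ r → proj₂ (∖⁻ q) (∪ˡ r))) b∈ (λ q → proj₂ (∖⁻ q) (∪ʳ ⁅⁆⁺))) le))

  con-upd : ∀ {φ : Labelling n} {u s m} → ConnFibres E φ → φ u ≡ nothing → φ s ≡ just m → E s u ≡ true → ConnFibres E (upd φ u m)
  con-upd {φ} {u} {s} {m} con nu sm e {x} {y} {l} p q = go (upd-inv φ u m p) (upd-inv φ u m q)
    where
    old : ∀ {x y} → Walk E (λ z → φ z ≡ just l) x y → Walk E (λ z → upd φ u m z ≡ just l) x y
    old = wmap (upd-ext φ m nu)
    go : (x ≡ u × l ≡ m) ⊎ (x ≢ u × φ x ≡ just l) → (y ≡ u × l ≡ m) ⊎ (y ≢ u × φ y ≡ just l) → Walk E (λ z → upd φ u m z ≡ just l) x y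
    go (inj₁ (refl , refl)) (inj₁ (refl , _)) = wstop p
    go (inj₁ (refl , refl)) (inj₂ (_ , b)) = wstep p (E-sym e) (old (con sm b))
    go (inj₂ (_ , a)) (inj₁ (refl , refl)) = old (con a sm) ++ʷ wstep (upd-ext φ m nu sm) e (wstop q)
    go (inj₂ (_ , a)) (inj₂ (_ , b)) = old (con a b)

  record Absorbed (U : VSet n) (φ : Labelling n) : Set where
    field
      lab   : Labelling n
      ext   : Extends φ lab
      total : ∀ {x} → x ∈ U → ∃[ m ] lab x ≡ just m
      inside : ∀ {x m} → lab x ≡ just m → x ∈ U
      used  : ∀ {x m} → lab x ≡ just m → ∃[ y ] φ y ≡ just m
      conn  : ConnFibres E lab

  opaque
    -- While some vertex of `U` is unlabelled, connectivity gives an edge between an unlabelled and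
    -- a labelled vertex. Copying the label along that edge keeps all fibres connected; the vertex
    -- `r` starts the process.
    absorb : ∀ (U : VSet n) (φ : Labelling n) → Conn E U → (∀ {x m} → φ x ≡ just m → x ∈ U) → ConnFibres E φ →
      ∀ {r l} → φ r ≡ just l → Absorbed U φ
    absorb U φ₀ cU in₀ con₀ {r} {l} r₀ = go (count (un φ₀)) φ₀ id in₀ (λ p → _ , p) con₀ ℕₚ.≤-refl
      where
      labelled? : ∀ (φ : Labelling n) x → Dec (∃[ m ] φ x ≡ just m)
      labelled? φ x with φ x
      ... | just m = yes (m , refl)
      ... | nothing = no λ ()
      no-lab : ∀ (φ : Labelling n) {x} → ¬ (∃[ m ] φ x ≡ just m) → φ x ≡ nothing
      no-lab φ {x} p with φ x
      ... | just m = ⊥-elim (p (m , refl))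
      ... | nothing = refl
      un? : ∀ (φ : Labelling n) x → Dec (x ∈ U × ¬ (∃[ m ] φ x ≡ just m))
      un? φ x = (x ∈? U) ×-dec ¬? (labelled? φ x)
      un : Labelling n → VSet n
      un φ = ⟦ un? φ ⟧
      go : ∀ k (φ : Labelling n) → Extends φ₀ φ → (∀ {x m} → φ x ≡ just m → x ∈ U) →
           (∀ {x m} → φ x ≡ just m → ∃[ y ] φ₀ y ≡ just m) → ConnFibres E φ → count (un φ) ≤ k → Absorbed U φ₀
      go k φ ex inn us con le with any? (un? φ)
      ... | no none = record
        { lab = φ ; ext = ex ; inside = inn ; used = us ; conn = con
        ; total = λ {x} xU → decidable-stable (labelled? φ x) (λ nl → none (x , xU , nl)) }
      ... | yes (x , xU , nx) with crossing (un φ) (cU xU (in₀ r₀)) (mk⁺ (un? φ) (xU , nx)) (λ q → proj₂ (mk⁻ (un? φ) q) (l , ex r₀))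
      ... | u , s , u∈ , s∉ , uU , sU , e with labelled? φ s
      ... | no ns = ⊥-elim (s∉ (mk⁺ (un? φ) (sU , ns)))
      ... | yes (m , sm) = next k le
        where
        nu : φ u ≡ nothing
        nu = no-lab φ (proj₂ (mk⁻ (un? φ) u∈))
        lt : count (un (upd φ u m)) < count (un φ)
        lt = count-strict
          (λ q → mk⁺ (un? φ) (proj₁ (mk⁻ (un? (upd φ u m)) q) , λ { (l' , p) → proj₂ (mk⁻ (un? (upd φ u m)) q) (l' , upd-ext φ m nu p) }))
          u∈ (λ q → proj₂ (mk⁻ (un? (upd φ u m)) q) (m , upd-same φ u m))
        inn' : ∀ {x l} → upd φ u m x ≡ just l → x ∈ U
        inn' p with upd-inv φ u m p
        ... | inj₁ (refl , _) = uU
        ... | inj₂ (_ , q) = inn q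
        us' : ∀ {x l} → upd φ u m x ≡ just l → ∃[ y ] φ₀ y ≡ just l
        us' p with upd-inv φ u m p
        ... | inj₁ (_ , refl) = us sm
        ... | inj₂ (_ , q) = us q
        next : ∀ k → count (un φ) ≤ k → Absorbed U φ₀
        next zero le = ⊥-elim (ℕₚ.<⇒≱ lt (ℕₚ.≤-trans le z≤n))
        next (suc k) le = go k (upd φ u m) (λ p → upd-ext φ m nu (ex p)) inn' us' (con-upd con nu sm (E-sym e)) (s≤s⁻¹ (ℕₚ.≤-trans lt le))

_⊆?_ : ∀ {n} (A B : VSet n) → Dec (A ⊆ B)
A ⊆? B with any? (λ x → (x ∈? A) ×-dec ¬? (x ∈? B))
... | yes (x , a , ¬b) = no λ s → ¬b (s a)
... | no none = yes λ {x} a → decidable-stable (x ∈? B) (λ ¬b → none (x , a , ¬b))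

-- The search runs over Boolean vectors. A function is not definitionally the lookup of its own
-- table, so `Q` has to respect mutual inclusion.
anySet? : ∀ {n} {Q : VSet n → Set} → (∀ X → Dec (Q X)) → (∀ {X Y} → X ⊆ Y → Y ⊆ X → Q X → Q Y) → Dec (∃ Q)
anySet? {Q = Q} Q? resp with anySubset? (λ v → Q? (lookup v))
... | yes (v , q) = yes (lookup v , q)
... | no none = no λ { (X , q) → none (tabulate X ,
        resp (λ { {x} (mem p) → mem (trans (lookup∘tabulate X x) p) }) (λ { {x} (mem p) → mem (trans (sym (lookup∘tabulate X x)) p) }) q) }

-- The inner vertex boundary

opaque
  ∂? : ∀ {n} (E : Rel n) (X : VSet n) x → Dec (x ∈ X × ∃[ y ] (E x y ≡ true × y ∉ X))
  ∂? E X x = (x ∈? X) ×-dec any? (λ y → (E x y Boolₚ.≟ true) ×-dec ¬? (y ∈? X))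

  ∂ : ∀ {n} → Rel n → VSet n → VSet n
  ∂ E X = ⟦ ∂? E X ⟧

  ∂⁺ : ∀ {n} {E : Rel n} {X x y} → x ∈ X → E x y ≡ true → y ∉ X → x ∈ ∂ E X
  ∂⁺ {E = E} {X} xX e ny = mk⁺ (∂? E X) (xX , _ , e , ny)

  ∂⁻ : ∀ {n} {E : Rel n} {X x} → x ∈ ∂ E X → x ∈ X × ∃[ y ] (E x y ≡ true × y ∉ X)
  ∂⁻ {E = E} {X} = mk⁻ (∂? E X)

∂-resp : ∀ {n} {E : Rel n} {X Y} → X ⊆ Y → Y ⊆ X → ∂ E X ⊆ ∂ E Y
∂-resp f g q with ∂⁻ q
... | x , y , e , ny = ∂⁺ (f x) e (ny ∘ g)

∂-sub : ∀ {n} {E : Rel n} {X} → ∂ E X ⊆ X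
∂-sub q = proj₁ (∂⁻ q)

-- Menger's theorem by deletion of arcs

opaque
  -- Only the arc from `s` to `u` goes, not its reverse. The relation `E` in which boundaries are
  -- taken thus becomes directed during the induction, while fibres are connected in a fixed
  -- symmetric relation `F` containing it.
  del : ∀ {n} → Rel n → Fin n → Fin n → Rel n
  del E s u x y with x Finₚ.≟ s | y Finₚ.≟ u
  ... | yes _ | yes _ = false
  ... | _ | _ = E x y

  del⁻ : ∀ {n} {E : Rel n} {s u x y} → del E s u x y ≡ true → E x y ≡ true × ¬ (x ≡ s × y ≡ u)
  del⁻ {s = s} {u} {x} {y} p with x Finₚ.≟ s | y Finₚ.≟ u
  del⁻ () | yes _ | yes _
  ... | yes _ | no b = p , λ q → b (proj₂ q)
  ... | no a | yes _ = p , λ q → a (proj₁ q)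
  ... | no a | no b = p , λ q → a (proj₁ q)

  del⁺ : ∀ {n} {E : Rel n} {s u x y} → E x y ≡ true → ¬ (x ≡ s × y ≡ u) → del E s u x y ≡ true
  del⁺ {s = s} {u} {x} {y} p ne with x Finₚ.≟ s | y Finₚ.≟ u
  ... | yes a | yes b = ⊥-elim (ne (a , b))
  ... | yes _ | no b = p
  ... | no a | yes _ = p
  ... | no a | no b = p

edges : ∀ {n} → Rel n → ℕ
edges E = sum (λ x → count (E x))

edges-del : ∀ {n} {E : Rel n} {s u} → E s u ≡ true → edges (del E s u) < edges E
edges-del {E = E} {s} {u} e = sum-strict
  (λ x → count-mono {A = del E s u x} {E x} (λ { (mem p) → mem (proj₁ (del⁻ p)) })) s
  (count-strict {A = del E s u s} {E s} (λ { (mem p) → mem (proj₁ (del⁻ p)) }) (mem e) (λ { (mem p) → proj₂ (del⁻ {E = E} {s} {u} p) (refl , refl) }))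

record BoundaryLabelling {n} (F E : Rel n) (A : VSet n) (φ : Labelling n) : Set where
  field
    inside : ∀ {x m} → φ x ≡ just m → x ∈ A
    conn   : ConnFibres F φ
    rep    : ∀ {x m} → φ x ≡ just m → ∃[ y ] (y ∈ ∂ E A × φ y ≡ just m)

-- Together with `rep` of `BoundaryLabelling`, this makes the boundary a transversal: each label in
-- use occurs on exactly one boundary vertex.
record Tight {n} (E : Rel n) (A : VSet n) (φ : Labelling n) : Set where
  field
    labelled : ∀ {x} → x ∈ ∂ E A → ∃[ m ] φ x ≡ just m
    inj      : ∀ {x y m} → x ∈ ∂ E A → y ∈ ∂ E A → φ x ≡ just m → φ y ≡ just m → x ≡ y

module Menger {n} (F : Rel n) (F-sym : ∀ {x y} → F x y ≡ true → F y x ≡ true) where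
  open Sym F F-sym

  -- This takes the place of disjoint paths from the boundary of the smaller set to that of `P`: the
  -- new fibres are the old ones with the paths attached. If `P` has a larger boundary than `k`,
  -- there are boundary vertices that no path reaches, so tightness is conditional.
  record Transfer (E : Rel n) (P : VSet n) (k : ℕ) (φ : Labelling n) : Set where
    field
      lab   : Labelling n
      ext   : Extends φ lab
      used  : ∀ {x m} → lab x ≡ just m → ∃[ y ] φ y ≡ just m
      valid : BoundaryLabelling F E P lab
      tight : count (∂ E P) ≤ k → Tight E P lab

  open BoundaryLabelling
  open Tight
  open Transfer

  -- All of P is reached by adding the single vertex u, which replaces s in the boundary.
  one-vertex : ∀ {E A P k φ s u m} → (∀ {x y} → E x y ≡ true → F x y ≡ true) → A ⊆ P →
    count (∂ E A) ≤ k → k ≤ count (∂ E P) → s ∈ ∂ E A → u ∈ P → u ∉ A → E s u ≡ true →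
    (∀ {x} → x ∈ P → x ∈ A ⊎ x ≡ u) → (∀ {y} → E s y ≡ true → y ∈ A ⊎ y ≡ u) →
    BoundaryLabelling F E A φ → Tight E A φ → φ s ≡ just m → Transfer E P k φ
  one-vertex {E} {A} {P} {k} {φ} {s} {u} {m} E⊆F A⊆P le ge s∂ uP uA su P⊆ s-only val tgt sm = record
    { lab = φ' ; ext = ex
    ; used = λ p → case upd-inv φ u m p of λ { (inj₁ (_ , refl)) → s , sm ; (inj₂ (_ , q)) → _ , q }
    ; valid = record { inside = ins ; conn = con-upd (conn val) nu sm (E⊆F su) ; rep = rp }
    ; tight = λ _ → record { labelled = lb ; inj = ij } }
    where
    φ' : Labelling n
    φ' = upd φ u m
    nu : φ u ≡ nothing
    nu with φ u in eq
    ... | nothing = refl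
    ... | just l = ⊥-elim (uA (inside val eq))
    ex : Extends φ φ'
    ex = upd-ext φ m nu
    ins : ∀ {x l} → φ' x ≡ just l → x ∈ P
    ins p with upd-inv φ u m p
    ... | inj₁ (refl , _) = uP
    ... | inj₂ (_ , q) = A⊆P (inside val q)
    cases : ∀ {x} → x ∈ ∂ E P → (x ∈ ∂ E A × x ≢ s) ⊎ x ≡ u
    cases {x} q with ∂⁻ q
    ... | xP , y , e , ny with P⊆ xP
    ... | inj₂ eq = inj₂ eq
    ... | inj₁ xA = inj₁ (∂⁺ xA e (ny ∘ A⊆P) , λ { refl → case s-only e of λ { (inj₁ yA) → ny (A⊆P yA) ; (inj₂ refl) → ny uP } })
    R : VSet n
    R = (∂ E A ∖ ⁅ s ⁆) ∪ ⁅ u ⁆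
    ∂P⊆R : ∂ E P ⊆ R
    ∂P⊆R q with cases q
    ... | inj₁ (a , ne) = ∪ˡ (∖⁺ a (λ r → ne (⁅⁆⁻ r)))
    ... | inj₂ refl = ∪ʳ ⁅⁆⁺
    R⊆∂P : R ⊆ ∂ E P
    R⊆∂P = count-eq ∂P⊆R (ℕₚ.≤-trans (count-swap {u = u} s∂ (λ q → case ∪⁻ q of λ
      { (inj₁ a) → inj₁ (proj₁ (∖⁻ a) , λ { refl → proj₂ (∖⁻ a) ⁅⁆⁺ }) ; (inj₂ b) → inj₂ (⁅⁆⁻ b) })) (ℕₚ.≤-trans le ge))
    rp : ∀ {x l} → φ' x ≡ just l → ∃[ y ] (y ∈ ∂ E P × φ' y ≡ just l)
    rpA : ∀ {x l} → φ x ≡ just l → ∃[ y ] (y ∈ ∂ E P × φ' y ≡ just l)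
    rpA {x} {l} p with rep val p
    ... | y , y∂ , yl with y Finₚ.≟ s
    ... | no ne = y , R⊆∂P (∪ˡ (∖⁺ y∂ (λ r → ne (⁅⁆⁻ r)))) , ex yl
    ... | yes refl = u , R⊆∂P (∪ʳ ⁅⁆⁺) , trans (upd-same φ u m) (trans (sym sm) yl)
    rp p with upd-inv φ u m p
    ... | inj₁ (refl , refl) = rpA sm
    ... | inj₂ (_ , q) = rpA q
    lb : ∀ {x} → x ∈ ∂ E P → ∃[ l ] φ' x ≡ just l
    lb q with cases q
    ... | inj₁ (a , _) = proj₁ (labelled tgt a) , ex (proj₂ (labelled tgt a))
    ... | inj₂ refl = m , upd-same φ u m
    not-both : ∀ {y l} → y ∈ ∂ E A × y ≢ s → φ' u ≡ just l → φ' y ≡ just l → ⊥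
    not-both {y} (a , ne) p q with upd-inv φ u m q
    ... | inj₁ (refl , _) = uA (∂-sub a)
    ... | inj₂ (_ , r) = ne (inj tgt a s∂ r (trans sm (trans (sym (upd-same φ u m)) p)))
    ij : ∀ {x y l} → x ∈ ∂ E P → y ∈ ∂ E P → φ' x ≡ just l → φ' y ≡ just l → x ≡ y
    ij {x} {y} a b p q with cases a | cases b
    ... | inj₂ refl | inj₂ refl = refl
    ... | inj₂ refl | inj₁ c = ⊥-elim (not-both c p q)
    ... | inj₁ c | inj₂ refl = ⊥-elim (not-both c q p)
    ... | inj₁ c | inj₁ d with upd-inv φ u m p | upd-inv φ u m q
    ... | inj₁ (refl , _) | _ = ⊥-elim (uA (∂-sub (proj₁ c)))
    ... | _ | inj₁ (refl , _) = ⊥-elim (uA (∂-sub (proj₁ d)))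
    ... | inj₂ (_ , p') | inj₂ (_ , q') = inj tgt (proj₁ c) (proj₁ d) p' q'

  BetweenLeq : Rel n → VSet n → VSet n → ℕ → VSet n → Set
  BetweenLeq E A P k X = A ⊆ X × X ⊆ P × count (∂ E X) ≤ k

  betweenLeq-resp : ∀ {E A P k X Y} → X ⊆ Y → Y ⊆ X → BetweenLeq E A P k X → BetweenLeq E A P k Y
  betweenLeq-resp f g (a , b , c) = (λ z → f (a z)) , (λ z → b (g z)) , ℕₚ.≤-trans (count-mono (∂-resp g f)) c

  betweenLeq? : ∀ E A P k X → Dec (BetweenLeq E A P k X)
  betweenLeq? E A P k X = (A ⊆? X) ×-dec (X ⊆? P) ×-dec (count (∂ E X) ≤? k)

  opaque
    -- Induction on the size of `P ∖ A` plus the number of arcs. A set strictly between `A` and `P`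
    -- with boundary at most `k` divides the problem into two. Otherwise an arc from `A` into
    -- `P ∖ A` is deleted. Should this create a violating set, that set is `A` itself and `P` is `A`
    -- with the head of the arc added, which is the case of `one-vertex`.
    menger : ∀ fuel k (E : Rel n) {A P φ} → (∀ {x y} → E x y ≡ true → F x y ≡ true) → A ⊆ P → count (∂ E A) ≤ k →
      (∀ X → A ⊆ X → X ⊆ P → k ≤ count (∂ E X)) → count (P ∖ A) + edges E < fuel →
      BoundaryLabelling F E A φ → Tight E A φ → Transfer E P k φ
    menger zero k E E⊆F A⊆P le hyp () val tgt
    menger (suc fuel) k E {A} {P} {φ} E⊆F A⊆P le hyp lt val tgt
      with anySet? (λ X → betweenLeq? E A P k X ×-dec any? (λ x → x ∈? (X ∖ A)) ×-dec any? (λ x → x ∈? (P ∖ X)))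
             (λ { f g (b , (x , p) , (y , q)) → betweenLeq-resp f g b , (x , ∖⁺ (f (proj₁ (∖⁻ p))) (proj₂ (∖⁻ p)))
                                               , (y , ∖⁺ (proj₁ (∖⁻ q)) (λ r → proj₂ (∖⁻ q) (g r))) })
    ... | yes (X , (A⊆X , X⊆P , cX) , (x , x∈) , (y , y∈)) = record
        { lab = lab t₂ ; ext = λ p → ext t₂ (ext t₁ p) ; used = λ p → used t₁ (proj₂ (used t₂ p)) ; valid = valid t₂ ; tight = tight t₂ }
      where
      t₁ : Transfer E X k φ
      t₁ = menger fuel k E E⊆F A⊆X le (λ Y a b → hyp Y a (λ z → X⊆P (b z)))
        (ℕₚ.<-≤-trans (ℕₚ.+-monoˡ-< (edges E) (count-strict {A = X ∖ A} {P ∖ A}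
          (λ z → ∖⁺ (X⊆P (proj₁ (∖⁻ z))) (proj₂ (∖⁻ z)))
          (∖⁺ (proj₁ (∖⁻ y∈)) (λ a → proj₂ (∖⁻ y∈) (A⊆X a))) (λ z → proj₂ (∖⁻ y∈) (proj₁ (∖⁻ z))))) (s≤s⁻¹ lt)) val tgt
      t₂ : Transfer E P k (lab t₁)
      t₂ = menger fuel k E E⊆F X⊆P cX (λ Y a b → hyp Y (λ z → a (A⊆X z)) b)
        (ℕₚ.<-≤-trans (ℕₚ.+-monoˡ-< (edges E) (count-strict {A = P ∖ X} {P ∖ A}
          (λ z → ∖⁺ (proj₁ (∖⁻ z)) (λ a → proj₂ (∖⁻ z) (A⊆X a)))
          (∖⁺ (X⊆P (proj₁ (∖⁻ x∈))) (proj₂ (∖⁻ x∈))) (λ z → proj₂ (∖⁻ z) (proj₁ (∖⁻ x∈))))) (s≤s⁻¹ lt)) (valid t₁) (tight t₁ cX)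
    ... | no noX with any? (λ s → any? (λ u → (s ∈? A) ×-dec (u ∈? (P ∖ A)) ×-dec (E s u Boolₚ.≟ true)))
    ... | no none = record
        { lab = φ ; ext = id ; used = λ p → _ , p
        ; valid = record { inside = λ p → A⊆P (inside val p) ; conn = conn val
                         ; rep = λ p → case rep val p of λ { (y , a , q) → y , ∂A⊆∂P a , q } }
        ; tight = λ cP → record
            { labelled = λ q → labelled tgt (∂P⊆∂A cP q)
            ; inj = λ a b → inj tgt (∂P⊆∂A cP a) (∂P⊆∂A cP b) } }
      where
      ∂A⊆∂P : ∂ E A ⊆ ∂ E P
      ∂A⊆∂P q with ∂⁻ q
      ... | xA , y , e , ny = ∂⁺ (A⊆P xA) e (λ yP → none (_ , y , xA , ∖⁺ yP ny , e))
      ∂P⊆∂A : count (∂ E P) ≤ k → ∂ E P ⊆ ∂ E A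
      ∂P⊆∂A cP = count-eq ∂A⊆∂P (ℕₚ.≤-trans cP (hyp A id A⊆P))
    ... | yes (s , u , sA , u∈ , e) with anySet? (λ X → (A ⊆? X) ×-dec (X ⊆? P) ×-dec (suc (count (∂ (del E s u) X)) ≤? k))
             (λ { f g (a , b , c) → (λ z → f (a z)) , (λ z → b (g z)) , ℕₚ.≤-trans (s≤s (count-mono (∂-resp g f))) c })
    ... | no noV = record
        { lab = lab t ; ext = ext t ; used = used t
        ; valid = record { inside = inside (valid t) ; conn = conn (valid t)
                         ; rep = λ p → case rep (valid t) p of λ { (y , a , q) → y , ∂' a , q } }
        ; tight = λ cP → let eqP = count-eq ∂' (ℕₚ.≤-trans cP (hyp' P A⊆P id)) ; tt' = tight t (ℕₚ.≤-trans (count-mono ∂') cP) in record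
            { labelled = λ q → labelled tt' (eqP q) ; inj = λ a b → inj tt' (eqP a) (eqP b) } }
      where
      E' : Rel n
      E' = del E s u
      ∂' : ∀ {X} → ∂ E' X ⊆ ∂ E X
      ∂' q with ∂⁻ q
      ... | x , y , e' , ny = ∂⁺ x (proj₁ (del⁻ e')) ny
      hyp' : ∀ X → A ⊆ X → X ⊆ P → k ≤ count (∂ E' X)
      hyp' X a b = ℕₚ.≮⇒≥ (λ q → noV (X , a , b , q))
      eqA : ∂ E A ⊆ ∂ E' A
      eqA = count-eq ∂' (ℕₚ.≤-trans le (hyp' A id A⊆P))
      t : Transfer E' P k φ
      t = menger fuel k E' (λ p → E⊆F (proj₁ (del⁻ p))) A⊆P (ℕₚ.≤-trans (count-mono ∂') le) hyp'
        (ℕₚ.<-≤-trans (ℕₚ.+-monoʳ-< (count (P ∖ A)) (edges-del {E = E} e)) (s≤s⁻¹ lt))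
        (record { inside = inside val ; conn = conn val ; rep = λ p → case rep val p of λ { (y , a , q) → y , eqA a , q } })
        (record { labelled = λ q → labelled tgt (∂' q) ; inj = λ a b → inj tgt (∂' a) (∂' b) })
    ... | yes (X , A⊆X , X⊆P , cX) = one-vertex E⊆F A⊆P le (hyp P A⊆P id) s∂ (proj₁ (∖⁻ u∈)) (proj₂ (∖⁻ u∈)) e P⊆ s-only val tgt (proj₂ (labelled tgt s∂))
      where
      E' : Rel n
      E' = del E s u
      ∂'⁺ : ∀ {Y x} → x ∈ ∂ E Y → (x ≡ s → ∃[ y ] (E s y ≡ true × y ∉ Y × y ≢ u)) → x ∈ ∂ E' Y
      ∂'⁺ {Y} {x} q f with x Finₚ.≟ s
      ... | yes refl = case f refl of λ { (y , e' , ny , ne) → ∂⁺ (∂-sub q) (del⁺ e' (λ z → ne (proj₂ z))) ny }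
      ... | no ne = case ∂⁻ q of λ { (xY , y , e' , ny) → ∂⁺ xY (del⁺ e' (λ z → ne (proj₁ z))) ny }
      s∂ : s ∈ ∂ E A
      s∂ = ∂⁺ sA e (proj₂ (∖⁻ u∈))
      cX' : count (∂ E X) ≤ k
      cX' = ℕₚ.≤-trans (count-insert {v = s} ins) cX
        where ins : ∀ {x} → x ∈ ∂ E X → x ∈ ∂ E' X ⊎ x ≡ s
              ins {x} q with x Finₚ.≟ s
              ... | yes eq = inj₂ eq
              ... | no ne = inj₁ (∂'⁺ q (λ eq → ⊥-elim (ne eq)))
      strict-ends : ∀ Y → BetweenLeq E A P k Y → (∃[ x ] x ∈ (Y ∖ A)) → P ⊆ Y
      strict-ends Y b m {p} pP = decidable-stable (p ∈? Y) (λ np → noX (Y , b , m , (p , ∖⁺ pP np)))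
      -- If `X` contained `u`, the deleted arc would not leave `X`, and the boundary of `X` would
      -- still have `k` vertices.
      uX : u ∉ X
      uX uX = ℕₚ.<⇒≱ cX (ℕₚ.≤-trans (hyp X A⊆X X⊆P) (count-mono (λ q → ∂'⁺ q (λ { refl → case ∂⁻ q of λ { (_ , y , e' , ny) → y , e' , ny , (λ { refl → ny uX }) } }))))
      X⊆A : X ⊆ A
      X⊆A {x} xX = decidable-stable (x ∈? A) (λ nx → uX (strict-ends X (A⊆X , X⊆P , cX') (x , ∖⁺ xX nx) (proj₁ (∖⁻ u∈))))
      -- Now `X` is `A`, and its boundary dropped below `k` with the arc. So `s` has left the
      -- boundary, and the arc was its only way out of `A`.
      s-only : ∀ {y} → E s y ≡ true → y ∈ A ⊎ y ≡ u
      s-only {y} e' with y ∈? A | y Finₚ.≟ u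
      ... | yes a | _ = inj₁ a
      ... | no _ | yes eq = inj₂ eq
      ... | no na | no ne = ⊥-elim (ℕₚ.<⇒≱ cX (ℕₚ.≤-trans (hyp X A⊆X X⊆P) (count-mono (λ q → ∂'⁺ q (λ { refl → y , e' , (λ z → na (X⊆A z)) , ne })))))
      -- Adding `u` exchanges `s` for `u` in the boundary. No set with boundary at most `k` lies
      -- strictly between `A` and `P`, hence `A₂` is all of `P`.
      A₂ : VSet n
      A₂ = A ∪ ⁅ u ⁆
      c₂ : count (∂ E A₂) ≤ k
      c₂ = ℕₚ.≤-trans (count-swap {u = u} s∂ f) le
        where f : ∀ {x} → x ∈ ∂ E A₂ → (x ∈ ∂ E A × x ≢ s) ⊎ x ≡ u
              f q with ∂⁻ q
              ... | x₂ , y , e' , ny with ∪⁻ x₂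
              ... | inj₂ z = inj₂ (⁅⁆⁻ z)
              ... | inj₁ z = inj₁ (∂⁺ z e' (λ w → ny (∪ˡ w)) , λ { refl → case s-only e' of λ { (inj₁ w) → ny (∪ˡ w) ; (inj₂ refl) → ny (∪ʳ ⁅⁆⁺) } })
      P⊆ : ∀ {x} → x ∈ P → x ∈ A ⊎ x ≡ u
      P⊆ xP = Sum.map₂ ⁅⁆⁻ (∪⁻ (strict-ends A₂ (∪ˡ , ∪-elim A⊆P (λ q → subst (_∈ P) (sym (⁅⁆⁻ q)) (proj₁ (∖⁻ u∈))) , c₂) (u , ∖⁺ (∪ʳ ⁅⁆⁺) (proj₂ (∖⁻ u∈))) xP))

-- Splitting connected sets in a 2-connected graph

record TwoConn {n} (E : Rel n) (U : VSet n) : Set where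
  field
    supp : ∀ {x y} → E x y ≡ true → y ∈ U
    link : ∀ v {x y} → x ∈ U → y ∈ U → x ≢ v → y ≢ v → Walk E (_≢ v) x y

labelOf? : ∀ {n k} (S : Fin k → VSet n) x → Dec (∃[ i ] x ∈ S i)
labelOf? S x = any? (λ i → x ∈? S i)

opaque
  labelOf : ∀ {n k} → (Fin k → VSet n) → Labelling n
  labelOf S x with labelOf? S x
  ... | yes (i , _) = just (Fin.toℕ i)
  ... | no _ = nothing

  labelOf⁻ : ∀ {n k} {S : Fin k → VSet n} {x m} → labelOf S x ≡ just m → ∃[ i ] (x ∈ S i × Fin.toℕ i ≡ m)
  labelOf⁻ {S = S} {x} p with labelOf? S x
  labelOf⁻ refl | yes (i , q) = i , q , refl

  labelOf⁺ : ∀ {n k} {S : Fin k → VSet n} → (∀ {i j x} → x ∈ S i → x ∈ S j → i ≡ j) → ∀ {x i} → x ∈ S i → labelOf S x ≡ just (Fin.toℕ i)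
  labelOf⁺ {S = S} disj {x} {i} q with labelOf? S x
  ... | yes (j , p) = cong (just ∘ Fin.toℕ) (disj p q)
  ... | no none = ⊥-elim (none (i , q))

module _ {n k} {E : Rel n} {S : Fin k → VSet n} (disj : ∀ {i j x} → x ∈ S i → x ∈ S j → i ≡ j) where

  labelOf-conn : (∀ i → Conn E (S i)) → ConnFibres E (labelOf S)
  labelOf-conn c p q with labelOf⁻ {S = S} p | labelOf⁻ {S = S} q
  ... | i , xi , refl | j , yj , eq with Finₚ.toℕ-injective eq
  ... | refl = wmap (labelOf⁺ disj) (c i xi yj)

two-disjoint : ∀ {n} {S : Fin 2 → VSet n} → Disjoint (S zero) (S (suc zero)) → ∀ {i j x} → x ∈ S i → x ∈ S j → i ≡ j
two-disjoint d {zero} {zero} p q = refl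
two-disjoint d {zero} {suc zero} p q = ⊥-elim (d p q)
two-disjoint d {suc zero} {zero} p q = ⊥-elim (d q p)
two-disjoint d {suc zero} {suc zero} p q = refl

record Parts {n} (E : Rel n) (U : VSet n) {k} (S : Fin k → VSet n) : Set where
  field
    part  : Fin k → VSet n
    ext   : ∀ i → S i ⊆ part i
    inside : ∀ i → part i ⊆ U
    cover : ∀ {x} → x ∈ U → ∃[ i ] x ∈ part i
    disj  : ∀ {i j x} → x ∈ part i → x ∈ part j → i ≡ j
    conn  : ∀ i → Conn E (part i)

module SymParts {n} (E : Rel n) (E-sym : ∀ {x y} → E x y ≡ true → E y x ≡ true) where
  open Sym E E-sym
  open Menger E E-sym

  opaque
    absorbSets : ∀ {U k} {S : Fin k → VSet n} → Conn E U → (∀ {i j x} → x ∈ S i → x ∈ S j → i ≡ j) →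
      (∀ i → S i ⊆ U) → (∀ i → Conn E (S i)) → ∀ {r i} → r ∈ S i → Parts E U S
    absorbSets {U} {k} {S} cU disj ins con rS = record
      { part = λ i → fib lab (Fin.toℕ i)
      ; ext = λ i q → fib⁺ (ext (labelOf⁺ disj {i = i} q))
      ; inside = λ i q → inside (fib⁻ q)
      ; cover = cov
      ; disj = λ p q → Finₚ.toℕ-injective (just-inj (trans (sym (fib⁻ p)) (fib⁻ q)))
      ; conn = λ i p q → wmap fib⁺ (conn (fib⁻ p) (fib⁻ q)) }
      where
      labelled-in : ∀ {x m} → labelOf S x ≡ just m → x ∈ U
      labelled-in p = case labelOf⁻ {S = S} p of λ { (i , q , _) → ins i q }
      open Absorbed (absorb U (labelOf S) cU labelled-in (labelOf-conn disj con) (labelOf⁺ disj rS))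
      cov : ∀ {x} → x ∈ U → Σ (Fin k) (λ i → x ∈ fib lab (Fin.toℕ i))
      cov xU with total xU
      ... | m , p with used p
      ... | y , q with labelOf⁻ {S = S} q
      ... | i , _ , refl = i , fib⁺ p

  record Split (U Q : VSet n) (x y : Fin n) : Set where
    field
      X Y   : VSet n
      X⊆    : X ⊆ Q
      Y⊆    : Y ⊆ Q
      cover : ∀ {z} → z ∈ Q → z ∈ X ⊎ z ∈ Y
      disj  : Disjoint X Y
      cX    : Conn E X
      cY    : Conn E Y
      x∈    : x ∈ X
      y∈    : y ∈ Y
      tX    : Touch E X (U ∖ Q)
      tY    : Touch E Y (U ∖ Q)

  opaque
    -- Menger's theorem with `k = 2`, from the two points to `Q`. A set between them with only one
    -- boundary vertex would let that vertex separate `x` or `y` from `z`. The two fibres reach the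
    -- boundary of `Q`, and then absorb the rest of `Q`.
    split : ∀ {U Q x y z} → TwoConn E U → Q ⊆ U → Conn E Q → z ∈ U → z ∉ Q → x ∈ Q → y ∈ Q → x ≢ y → Split U Q x y
    split {U} {Q} {x} {y} {z} tc Q⊆U cQ zU zQ xQ yQ x≢y = record
      { X = part zero ; Y = part (suc zero)
      ; X⊆ = inside zero ; Y⊆ = inside (suc zero)
      ; cover = λ q → case cover q of λ { (zero , p) → inj₁ p ; (suc zero , p) → inj₂ p }
      ; disj = λ p q → case disj p q of λ ()
      ; cX = conn zero ; cY = conn (suc zero)
      ; x∈ = ext zero x∈₁ ; y∈ = ext (suc zero) y∈₁
      ; tX = touch-mono (ext zero) id (tch zero x∈₁) ; tY = touch-mono (ext (suc zero)) id (tch (suc zero) y∈₁) }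
      where
      S : Fin 2 → VSet n
      S zero = ⁅ x ⁆
      S (suc zero) = ⁅ y ⁆
      S-disj : ∀ {i j z} → z ∈ S i → z ∈ S j → i ≡ j
      S-disj = two-disjoint {S = S} (λ p q → x≢y (trans (sym (⁅⁆⁻ p)) (⁅⁆⁻ q)))
      S-conn : ∀ i → Conn E (S i)
      S-conn zero = conn-single
      S-conn (suc zero) = conn-single
      S-eq : ∀ {i a b} → a ∈ S i → b ∈ S i → a ≡ b
      S-eq {zero} p q = trans (⁅⁆⁻ p) (sym (⁅⁆⁻ q))
      S-eq {suc zero} p q = trans (⁅⁆⁻ p) (sym (⁅⁆⁻ q))
      A : VSet n
      A = ⁅ x ⁆ ∪ ⁅ y ⁆
      S⊆A : ∀ {i} → S i ⊆ A
      S⊆A {zero} = ∪ˡ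
      S⊆A {suc zero} = ∪ʳ
      A⊆S : ∀ {a} → a ∈ A → ∃[ i ] a ∈ S i
      A⊆S p with ∪⁻ p
      ... | inj₁ q = zero , q
      ... | inj₂ q = suc zero , q
      A⊆Q : A ⊆ Q
      A⊆Q = ∪-elim (λ q → subst (_∈ Q) (sym (⁅⁆⁻ q)) xQ) (λ q → subst (_∈ Q) (sym (⁅⁆⁻ q)) yQ)
      cA : count A ≤ 2
      cA = ℕₚ.≤-trans (count-insert {B = ⁅ x ⁆} {v = y} (λ q → Sum.map₂ ⁅⁆⁻ (∪⁻ q))) (s≤s (count-⁅⁆≤1 x))
      hyp : ∀ X → A ⊆ X → X ⊆ Q → 2 ≤ count (∂ E X)
      -- This walk only has to find some boundary vertex `b`; it avoids `y` because `link` has to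
      -- avoid something. A second walk, from whichever of `x` and `y` is not `b`, then avoids `b`.
      hyp X A⊆X X⊆Q with crossing X (link tc y (Q⊆U xQ) zU x≢y (λ { refl → zQ yQ })) (A⊆X (∪ˡ ⁅⁆⁺)) (λ q → zQ (X⊆Q q))
        where open TwoConn
      ... | b , c , bX , cX , _ , _ , e = second
        where
        from : ∀ {a} → a ∈ A → a ≢ b → 2 ≤ count (∂ E X)
        from aA ne with crossing X (TwoConn.link tc b (Q⊆U (A⊆Q aA)) zU ne (λ { refl → zQ (X⊆Q bX) })) (A⊆X aA) (λ q → zQ (X⊆Q q))
        ... | b' , c' , b'X , c'X , ne' , _ , e' = count≥2 (∂⁺ bX e cX) (∂⁺ b'X e' c'X) (λ eq → ne' (sym eq))
        second : 2 ≤ count (∂ E X)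
        second with x Finₚ.≟ b
        ... | no ne = from (∪ˡ ⁅⁆⁺) ne
        ... | yes refl = from (∪ʳ ⁅⁆⁺) (λ eq → x≢y (sym eq))
      A⊆∂ : A ⊆ ∂ E A
      A⊆∂ = count-eq ∂-sub (ℕₚ.≤-trans cA (hyp A id A⊆Q))
      t : Transfer E Q 2 (labelOf S)
      t = menger _ 2 E id A⊆Q (ℕₚ.≤-trans (count-mono ∂-sub) cA) hyp ℕₚ.≤-refl
        (record { inside = λ p → case labelOf⁻ {S = S} p of λ { (i , q , _) → S⊆A {i} q }
                ; conn = labelOf-conn S-disj S-conn
                ; rep = λ p → case labelOf⁻ {S = S} p of λ { (i , q , _) → _ , A⊆∂ (S⊆A {i} q) , p } })
        (record { labelled = λ q → case A⊆S (∂-sub q) of λ { (i , r) → _ , labelOf⁺ {S = S} S-disj {i = i} r }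
                ; inj = λ a b p q → case (labelOf⁻ {S = S} p , labelOf⁻ {S = S} q) of λ
                    { ((i , r , refl) , (j , r' , eq)) → S-eq {i} r (subst (λ i → _ ∈ S i) (Finₚ.toℕ-injective eq) r') } })
      open Transfer t using (lab) renaming (ext to lab-ext; valid to lab-valid)
      S₁ : Fin 2 → VSet n
      S₁ i = fib lab (Fin.toℕ i)
      S₁⁺ : ∀ {i a} → a ∈ S i → a ∈ S₁ i
      S₁⁺ q = fib⁺ (lab-ext (labelOf⁺ S-disj q))
      x∈₁ : x ∈ S₁ zero
      x∈₁ = S₁⁺ {zero} ⁅⁆⁺
      y∈₁ : y ∈ S₁ (suc zero)
      y∈₁ = S₁⁺ {suc zero} ⁅⁆⁺
      tch : ∀ i {a} → a ∈ S₁ i → Touch E (S₁ i) (U ∖ Q)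
      tch i q with BoundaryLabelling.rep lab-valid (fib⁻ q)
      ... | b , b∂ , r with ∂⁻ b∂
      ... | _ , c , e , nc = b , c , fib⁺ r , ∖⁺ (TwoConn.supp tc e) nc , e
      open Parts (absorbSets {U = Q} {S = S₁} cQ (λ p q → Finₚ.toℕ-injective (just-inj (trans (sym (fib⁻ p)) (fib⁻ q))))
        (λ i q → BoundaryLabelling.inside lab-valid (fib⁻ q)) (λ i p q → wmap fib⁺ (BoundaryLabelling.conn lab-valid (fib⁻ p) (fib⁻ q))) {i = zero} x∈₁)

-- Path-width as vertex separation number

-- A vertex counted twice on the left lies in both sets and has a neighbour outside their union, so
-- it is on both boundaries.
∂-submodular : ∀ {n} {E : Rel n} {X Y} → count (∂ E (X ∪ Y)) + count (∂ E (X ∩ Y)) ≤ count (∂ E X) + count (∂ E Y)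
∂-submodular {E = E} {X} {Y} = count₄ union inter (λ a b → case (∂⁻ a , ∂⁻ b) of λ
    { ((_ , y , e , ny) , (x , _)) → ∂⁺ (proj₁ (∩⁻ x)) e (ny ∘ ∪ˡ) , ∂⁺ (proj₂ (∩⁻ x)) e (ny ∘ ∪ʳ) })
  where
  union : ∀ {x} → x ∈ ∂ E (X ∪ Y) → x ∈ ∂ E X ⊎ x ∈ ∂ E Y
  union q with ∂⁻ q
  ... | x , y , e , ny = Sum.map (λ a → ∂⁺ a e (ny ∘ ∪ˡ)) (λ a → ∂⁺ a e (ny ∘ ∪ʳ)) (∪⁻ x)
  inter : ∀ {x} → x ∈ ∂ E (X ∩ Y) → x ∈ ∂ E X ⊎ x ∈ ∂ E Y
  inter q with ∂⁻ q
  ... | x , y , e , ny with y ∈? X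
  ... | no nx = inj₁ (∂⁺ (proj₁ (∩⁻ x)) e nx)
  ... | yes yX = inj₂ (∂⁺ (proj₂ (∩⁻ x)) e (λ yY → ny (∩⁺ yX yY)))

-- For the whole vertex set, this is a linear layout of vertex separation at most `k`. The enlarged
-- set is described by inclusions, since two Boolean functions with the same members need not be
-- equal as terms.
data Good {n} (E : Rel n) (k : ℕ) : VSet n → Set where
  gempty : ∀ {A} → (∀ {x} → x ∉ A) → Good E k A
  gstep  : ∀ {A A'} v → Good E k A → v ∉ A → A ⊆ A' → v ∈ A' → (∀ {x} → x ∈ A' → x ∈ A ⊎ x ≡ v) →
           count (∂ E A') ≤ k → Good E k A'

module _ {n} {E : Rel n} {k : ℕ} where

  good-boundary : ∀ {A} → Good E k A → count (∂ E A) ≤ k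
  good-boundary (gempty em) = subst (_≤ k) (sym (count-∅ (λ q → em (∂-sub q)))) z≤n
  good-boundary (gstep v g nv A⊆ vA' spl le) = le

  good-resp : ∀ {A B} → A ⊆ B → B ⊆ A → Good E k A → Good E k B
  good-resp f g (gempty em) = gempty (em ∘ g)
  good-resp f g (gstep v h nv A⊆ vA' spl le) =
    gstep v h nv (λ q → f (A⊆ q)) (f vA') (λ q → spl (g q)) (ℕₚ.≤-trans (count-mono (∂-resp g f)) le)

  -- Intersect every set of the construction of `P` with `X`. By submodularity, passing from a set
  -- to its intersection with `X` cannot enlarge the boundary, because passing from `X` to the union
  -- does not shrink it.
  good-∩ : ∀ {P X} → Good E k P → (∀ {Q} → Q ⊆ P → count (∂ E X) ≤ count (∂ E (Q ∪ X))) → Good E k (P ∩ X)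
  good-∩ (gempty em) hyp = gempty (λ q → em (proj₁ (∩⁻ q)))
  good-∩ {P} {X} (gstep {A} v g nv A⊆ vP spl le) hyp with v ∈? X
  ... | no nx = good-resp (λ q → ∩⁺ (A⊆ (proj₁ (∩⁻ q))) (proj₂ (∩⁻ q))) back (good-∩ g (λ s → hyp (λ q → A⊆ (s q))))
    where back : P ∩ X ⊆ A ∩ X
          back q with spl (proj₁ (∩⁻ q))
          ... | inj₁ a = ∩⁺ a (proj₂ (∩⁻ q))
          ... | inj₂ refl = ⊥-elim (nx (proj₂ (∩⁻ q)))
  ... | yes vX = gstep v (good-∩ g (λ s → hyp (λ q → A⊆ (s q)))) (λ q → nv (proj₁ (∩⁻ q)))
      (λ q → ∩⁺ (A⊆ (proj₁ (∩⁻ q))) (proj₂ (∩⁻ q))) (∩⁺ vP vX)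
      (λ q → Sum.map₁ (λ a → ∩⁺ a (proj₂ (∩⁻ q))) (spl (proj₁ (∩⁻ q))))
      (ℕₚ.+-cancelˡ-≤ (count (∂ E X)) _ _ (ℕₚ.≤-trans (ℕₚ.+-monoˡ-≤ _ (hyp {P} id))
        (ℕₚ.≤-trans (∂-submodular {E = E} {P} {X}) (ℕₚ.≤-trans (ℕₚ.+-monoˡ-≤ (count (∂ E X)) le) (ℕₚ.≤-reflexive (ℕₚ.+-comm k _))))))

  -- Decided by trying every vertex as the last one added. This is what lets `maximise` search among
  -- good sets.
  good? : ∀ f A → count A ≤ f → Dec (Good E k A)
  good? f A le with any? (λ x → x ∈? A)
  ... | no none = yes (gempty (λ {x} q → none (x , q)))
  good? zero A le | yes (x , xA) = ⊥-elim (ℕₚ.<⇒≱ (count-strict {A = ∅} (λ q → ⊥-elim (∅⁻ q)) xA ∅⁻) (ℕₚ.≤-trans le z≤n))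
  good? (suc f) A le | yes (x , xA) with any? last? | count (∂ E A) ≤? k
    where
    last? : ∀ v → Dec (v ∈ A × Good E k (A ∖ ⁅ v ⁆))
    last? v with v ∈? A
    ... | no nv = no (nv ∘ proj₁)
    ... | yes vA with good? f (A ∖ ⁅ v ⁆) (s≤s⁻¹ (ℕₚ.≤-trans (count-strict (λ q → proj₁ (∖⁻ q)) vA (λ q → proj₂ (∖⁻ q) ⁅⁆⁺)) le))
    ... | yes g = yes (vA , g)
    ... | no ng = no (ng ∘ proj₂)
  ... | _ | no nle = no (nle ∘ good-boundary)
  ... | yes (v , vA , g) | yes c = yes (gstep v g (λ q → proj₂ (∖⁻ q) ⁅⁆⁺) (λ q → proj₁ (∖⁻ q)) vA spl c)
    where spl : ∀ {y} → y ∈ A → y ∈ (A ∖ ⁅ v ⁆) ⊎ y ≡ v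
          spl {y} yA with y Finₚ.≟ v
          ... | yes eq = inj₂ eq
          ... | no ne = inj₁ (∖⁺ yA (λ q → ne (⁅⁆⁻ q)))
  ... | no none | yes _ = no λ
    { (gempty em) → em xA
    ; (gstep v g nv A⊆ vA spl _) → none (v , vA , good-resp (λ q → ∖⁺ (A⊆ q) (λ r → nv (subst (_∈ _) (⁅⁆⁻ r) q)))
        (λ q → case spl (proj₁ (∖⁻ q)) of λ { (inj₁ a) → a ; (inj₂ refl) → ⊥-elim (proj₂ (∖⁻ q) ⁅⁆⁺) }) g) }

  -- By submodularity, a set of smallest boundary between A and P inherits goodness from P.
  opaque
    minimal-good : ∀ c {A P X} → Good E k P → A ⊆ X → X ⊆ P → count (∂ E X) ≤ c →
      ∃[ Y ] (A ⊆ Y × Y ⊆ P × count (∂ E Y) ≤ c × Good E k Y)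
    minimal-good c {A} {P} {X} g A⊆X X⊆P le with anySet? (λ Y → (A ⊆? Y) ×-dec (Y ⊆? P) ×-dec (suc (count (∂ E Y)) ≤? count (∂ E X)))
      (λ { f g (a , b , c) → (λ z → f (a z)) , (λ z → b (g z)) , ℕₚ.≤-trans (s≤s (count-mono (∂-resp g f))) c })
    ... | no none = X , A⊆X , X⊆P , le , good-resp (λ q → proj₂ (∩⁻ q)) (λ q → ∩⁺ (X⊆P q) q)
            (good-∩ g (λ {Q} s → ℕₚ.≮⇒≥ (λ lt → none (Q ∪ X , (λ z → ∪ʳ (A⊆X z)) , ∪-elim s X⊆P , lt))))
    minimal-good zero g A⊆X X⊆P le | yes (Y , a , b , lt) = ⊥-elim (ℕₚ.<⇒≱ lt (ℕₚ.≤-trans le z≤n))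
    minimal-good (suc c) g A⊆X X⊆P le | yes (Y , a , b , lt) with minimal-good c g a b (s≤s⁻¹ (ℕₚ.≤-trans lt le))
    ... | Z , p , q , r , s = Z , p , q , ℕₚ.m≤n⇒m≤1+n r , s

  record Maximal (A : VSet n) (c : ℕ) : Set where
    field
      set   : VSet n
      above : A ⊆ set
      good  : Good E k set
      bound : count (∂ E set) ≤ c
      max   : ∀ {Q} → set ⊆ Q → Good E k Q → count (∂ E Q) ≤ c → Q ⊆ set

  opaque
    maximise : ∀ {A} c → Good E k A → count (∂ E A) ≤ c → Maximal A c
    maximise {A} c g le = go (count (∁ A)) A id g le ℕₚ.≤-refl
      where
      go : ∀ f P → A ⊆ P → Good E k P → count (∂ E P) ≤ c → count (∁ P) ≤ f → Maximal A c
      go f P A⊆P g le cf with anySet? (λ Q → (P ⊆? Q) ×-dec good? _ Q ℕₚ.≤-refl ×-dec (count (∂ E Q) ≤? c) ×-dec any? (λ x → x ∈? (Q ∖ P)))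
        (λ { f g (a , b , c , (x , d)) → (λ z → f (a z)) , good-resp f g b , ℕₚ.≤-trans (count-mono (∂-resp g f)) c , x , ∖⁺ (f (proj₁ (∖⁻ d))) (proj₂ (∖⁻ d)) })
      ... | no none = record { set = P ; above = A⊆P ; good = g ; bound = le
              ; max = λ {Q} s gQ cQ {x} xQ → decidable-stable (x ∈? P) (λ nx → none (Q , s , gQ , cQ , x , ∖⁺ xQ nx)) }
      ... | yes (Q , s , gQ , cQ , x , x∈) = next f cf
        where
        next : ∀ f → count (∁ P) ≤ f → Maximal A c
        next zero cf = ⊥-elim (ℕₚ.<⇒≱ (count-strict {A = ∅} (λ q → ⊥-elim (∅⁻ q)) (∁⁺ (proj₂ (∖⁻ x∈))) ∅⁻) (ℕₚ.≤-trans cf z≤n))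
        next (suc f) cf = go f Q (λ q → s (A⊆P q)) gQ cQ
          (s≤s⁻¹ (ℕₚ.≤-trans (count-strict (λ q → ∁⁺ (λ p → ∁⁻ q (s p))) (∁⁺ (proj₂ (∖⁻ x∈))) (λ q → ∁⁻ q (proj₁ (∖⁻ x∈)))) cf))

  width : ∀ {A} → Good E k A → ℕ
  width (gempty _) = 0
  width (gstep v g _ _ _ _ _) = suc (width g)

  -- The bag of the moment when `v` is added consists of `v` and the boundary before that moment,
  -- whence the size `suc k`. Index zero belongs to the vertex added last.
  gbag : ∀ {A} (g : Good E k A) → Fin (width g) → VSet n
  gbag (gstep {A} v g _ _ _ _ _) zero = ∂ E A ∪ ⁅ v ⁆
  gbag (gstep v g _ _ _ _ _) (suc i) = gbag g i

  gbag-size : ∀ {A} (g : Good E k A) i → count (gbag g i) ≤ suc k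
  gbag-size (gstep v g _ _ _ _ _) zero = ℕₚ.≤-trans (count-insert (λ q → Sum.map₂ ⁅⁆⁻ (∪⁻ q))) (s≤s (good-boundary g))
  gbag-size (gstep v g _ _ _ _ _) (suc i) = gbag-size g i

  gbag-in : ∀ {A} (g : Good E k A) i → gbag g i ⊆ A
  gbag-in (gstep v g _ A⊆ vA _ _) zero q = ∪-elim (λ z → A⊆ (∂-sub z)) (λ z → subst (_∈ _) (sym (⁅⁆⁻ z)) vA) q
  gbag-in (gstep v g _ A⊆ vA _ _) (suc i) q = A⊆ (gbag-in g i q)

  gbag-vertex : ∀ {A x} (g : Good E k A) → x ∈ A → ∃[ i ] x ∈ gbag g i
  gbag-vertex (gempty em) xA = ⊥-elim (em xA)
  gbag-vertex (gstep v g _ _ _ spl _) xA with spl xA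
  ... | inj₂ refl = zero , ∪ʳ ⁅⁆⁺
  ... | inj₁ a with gbag-vertex g a
  ... | i , q = suc i , q

  -- A boundary vertex of `A` has a neighbour outside `A`, hence outside all earlier sets. Once it
  -- has entered, it stays on the boundary and so in all later bags, which have smaller indices.
  gbag-up : ∀ {A x} (g : Good E k A) → x ∈ ∂ E A → ∀ i j → j Fin.≤ i → x ∈ gbag g i → x ∈ gbag g j
  gbag-up (gstep v g _ A⊆ _ _ _) x∂ zero zero le q = q
  gbag-up (gstep v g _ A⊆ _ _ _) x∂ (suc i) j le q = go j le
    where
    x∂' : _ ∈ ∂ E _
    x∂' = case ∂⁻ x∂ of λ { (_ , y , e , ny) → ∂⁺ (gbag-in g i q) e (λ z → ny (A⊆ z)) }
    go : ∀ j → j Fin.≤ suc i → _ ∈ gbag (gstep v g _ A⊆ _ _ _) j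
    go zero _ = ∪ˡ x∂'
    go (suc j) le = gbag-up g x∂' i j (s≤s⁻¹ le) q

  gbag-interval : ∀ {A x} (g : Good E k A) i j l → i Fin.≤ j → j Fin.≤ l → x ∈ gbag g i → x ∈ gbag g l → x ∈ gbag g j
  gbag-interval (gstep v g nv _ _ _ _) zero zero l a b p q = p
  gbag-interval (gstep v g nv _ _ _ _) zero (suc j) (suc l) a b p q with ∪⁻ p
  ... | inj₁ x∂ = gbag-up g x∂ l j (s≤s⁻¹ b) q
  ... | inj₂ z = ⊥-elim (nv (subst (_∈ _) (⁅⁆⁻ z) (gbag-in g l q)))
  gbag-interval (gstep v g _ _ _ _ _) (suc i) (suc j) (suc l) a b p q = gbag-interval g i j l (s≤s⁻¹ a) (s≤s⁻¹ b) p q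

  -- The edge lies in the bag of its later end: the earlier end is then on the boundary because of
  -- this very edge.
  gbag-edge : (∀ {x y} → E x y ≡ true → E y x ≡ true) → ∀ {A x y} (g : Good E k A) → x ∈ A → y ∈ A → E x y ≡ true →
    ∃[ i ] (x ∈ gbag g i × y ∈ gbag g i)
  gbag-edge E-sym (gempty em) xA yA e = ⊥-elim (em xA)
  gbag-edge E-sym (gstep v g nv _ _ spl _) xA yA e with spl xA | spl yA
  ... | inj₁ a | inj₁ b = case gbag-edge E-sym g a b e of λ { (i , p , q) → suc i , p , q }
  ... | inj₁ a | inj₂ refl = zero , ∪ˡ (∂⁺ a e nv) , ∪ʳ ⁅⁆⁺
  ... | inj₂ refl | inj₁ b = zero , ∪ʳ ⁅⁆⁺ , ∪ˡ (∂⁺ b (E-sym e) nv)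
  ... | inj₂ refl | inj₂ refl = zero , ∪ʳ ⁅⁆⁺ , ∪ʳ ⁅⁆⁺

card-tabulate : ∀ {n} (S : VSet n) → Subset.∣ tabulate S ∣ ≡ count S
card-tabulate {zero} S = sym (count-zero S)
card-tabulate {suc n} S = trans (head (S zero) refl) (sym (count-suc S))
  where
  head : ∀ b → S zero ≡ b → Subset.∣ tabulate S ∣ ≡ ind S zero + count (S ∘ suc)
  head true eq rewrite eq = cong suc (card-tabulate (S ∘ suc))
  head false eq rewrite eq = card-tabulate (S ∘ suc)

module _ (G : Graph) where

  adj-symm : ∀ {x y} → adj G x y ≡ true → adj G y x ≡ true
  adj-symm {x} {y} e = trans (adj-sym G y x) e

  good⇒decomposition : ∀ {k} → Good (adj G) k full → PathDecomposition G k
  good⇒decomposition {k} g = record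
    { len = width g
    ; bag = λ i → tabulate (gbag g i)
    ; bag-size = λ i → subst (_≤ suc k) (sym (card-tabulate (gbag g i))) (gbag-size g i)
    ; vertex-in = λ v → case gbag-vertex g (full⁺ {x = v}) of λ { (i , q) → i , into q }
    ; interval = λ v i j l a b p q → into (gbag-interval g i j l a b (out p) (out q))
    ; edge-in = λ x y e → case gbag-edge adj-symm g full⁺ full⁺ e of λ { (i , p , q) → i , into p , into q } }
    where
    into : ∀ {S : VSet (size G)} {v} → v ∈ S → v Subset.∈ tabulate S
    into {S} {v} (mem p) = lookup⇒[]= v (tabulate S) (trans (lookup∘tabulate S v) p)
    out : ∀ {S : VSet (size G)} {v} → v Subset.∈ tabulate S → v ∈ S
    out {S} {v} p = mem (trans (sym (lookup∘tabulate S v)) ([]=⇒lookup p))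

-- parent m is the parent of the node suc m.
record TreeLabelling {n} (E : Rel n) (parent : ℕ → ℕ) (w : ℕ) (φ : Labelling n) : Set where
  field
    conn   : ConnFibres E φ
    range  : ∀ {x m} → φ x ≡ just m → m < w
    occurs : ∀ {m} → m < w → ∃[ x ] φ x ≡ just m
    edge   : ∀ {m} → suc m < w → ∃[ x ] ∃[ y ] (φ x ≡ just (suc m) × φ y ≡ just (parent m) × E x y ≡ true)

-- Growing a tree model when the whole graph is not good

module Growth {n} (E : Rel n) (E-sym : ∀ {x y} → E x y ≡ true → E y x ≡ true)
              (parent : ℕ → ℕ) (parent≤ : ∀ m → parent m ≤ m) (k : ℕ) (bad : ¬ Good E k full) where
  open Sym E E-sym
  open Menger E E-sym
  open BoundaryLabelling
  open Tight
  open TreeLabelling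

  record Stage (i : ℕ) : Set where
    field
      A : VSet n
      φ : Labelling n
      good  : Good E k A
      bound : count (∂ E A) ≤ i
      max   : ∀ {Q} → A ⊆ Q → Good E k Q → count (∂ E Q) ≤ i → Q ⊆ A
      lab   : BoundaryLabelling E E A φ
      tight : Tight E A φ
      tree  : TreeLabelling E parent i φ

  record NewVertex {i} (s : Stage i) : Set where
    open Stage s
    field
      v    : Fin n
      new  : v ∉ A
      joins : ∀ m → i ≡ suc m → ∃[ x ] (φ x ≡ just (parent m) × E v x ≡ true)

  -- Stage `suc i` uses the labels up to `i`, and the next node `suc i` has the parent `parent i`,
  -- which is at most `i` and hence present. Its branch set has a boundary vertex, and any neighbour
  -- of that vertex outside `A` will do. At stage zero, a vertex outside `A` exists because the
  -- whole graph is not good.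
  newVertex : ∀ i (s : Stage i) → NewVertex s
  newVertex zero s with any? (λ x → x ∈? ∁ (Stage.A s))
  ... | yes (x , q) = record { v = x ; new = ∁⁻ q ; joins = λ _ () }
  ... | no none = ⊥-elim (bad (good-resp (λ _ → full⁺) (λ {x} _ → decidable-stable (x ∈? Stage.A s) (λ nx → none (x , ∁⁺ nx))) (Stage.good s)))
  newVertex (suc i) s with occurs (Stage.tree s) {parent i} (s≤s (parent≤ i))
  ... | x , p with rep (Stage.lab s) p
  ... | y , y∂ , q with ∂⁻ y∂
  ... | _ , v , e , nv = record { v = v ; new = nv ; joins = λ { m refl → y , q , E-sym e } }

  grow : ∀ {i} → suc i ≤ k → Stage i → Stage (suc i)
  grow {i} i<k s = record
    { A = M.set ; φ = Transfer.lab t ; good = M.good ; bound = M.bound ; max = M.max ; lab = valid t ; tight = Transfer.tight t M.bound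
    ; tree = record
      { conn = conn (valid t)
      ; range = λ p → range' (proj₂ (used t p))
      ; occurs = λ {m} lt → case newer m lt of λ { (x , p) → x , ext t p }
      ; edge = λ {m} lt → case newer-edge m lt of λ { (x , y , p , q , e) → x , y , ext t p , ext t q , e } } }
    where
    open Stage s hiding (max; tight)
    open NewVertex (newVertex i s)
    A' : VSet n
    A' = A ∪ ⁅ v ⁆
    φ' : Labelling n
    φ' = upd φ v i
    ∂A'⊆ : ∀ {x} → x ∈ ∂ E A' → x ∈ ∂ E A ⊎ x ≡ v
    ∂A'⊆ q with ∂⁻ q
    ... | x , y , e , ny with ∪⁻ x
    ... | inj₁ a = inj₁ (∂⁺ a e (ny ∘ ∪ˡ))
    ... | inj₂ b = inj₂ (⁅⁆⁻ b)
    bound' : count (∂ E A') ≤ suc i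
    bound' = ℕₚ.≤-trans (count-insert ∂A'⊆) (s≤s bound)
    good' : Good E k A'
    good' = gstep v good new ∪ˡ (∪ʳ ⁅⁆⁺) (λ q → Sum.map₂ ⁅⁆⁻ (∪⁻ q)) (ℕₚ.≤-trans bound' i<k)
    module M = Maximal (maximise (suc i) good' bound')
    hyp : ∀ X → A' ⊆ X → X ⊆ M.set → suc i ≤ count (∂ E X)
    hyp X a b = ℕₚ.≰⇒> (λ le → case minimal-good i M.good a b le of λ
      { (Y , A'⊆Y , _ , cY , gY) → new (Stage.max s (λ q → A'⊆Y (∪ˡ q)) gY cY (A'⊆Y (∪ʳ ⁅⁆⁺))) })
    -- The lower bound for `A'` itself forces `suc i` boundary vertices, so adding `v` removes no
    -- vertex from the boundary, and `v` joins it.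
    R⊆ : ∂ E A ∪ ⁅ v ⁆ ⊆ ∂ E A'
    R⊆ = count-eq (λ q → ∪⁺ (Sum.map₂ (λ { refl → ⁅⁆⁺ }) (∂A'⊆ q)))
      (ℕₚ.≤-trans (ℕₚ.≤-trans (count-insert (λ q → Sum.map₂ ⁅⁆⁻ (∪⁻ q))) (s≤s bound)) (hyp A' id M.above))
    nu : φ v ≡ nothing
    nu with φ v in eq
    ... | nothing = refl
    ... | just l = ⊥-elim (new (inside lab eq))
    ex : Extends φ φ'
    ex = upd-ext φ i nu
    con' : ConnFibres E φ'
    con' p q with upd-inv φ v i p | upd-inv φ v i q
    ... | inj₁ (refl , _) | inj₁ (refl , _) = wstop p
    ... | inj₁ (_ , refl) | inj₂ (_ , q') = ⊥-elim (ℕₚ.<-irrefl refl (range tree q'))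
    ... | inj₂ (_ , p') | inj₁ (_ , refl) = ⊥-elim (ℕₚ.<-irrefl refl (range tree p'))
    ... | inj₂ (_ , p') | inj₂ (_ , q') = wmap ex (conn lab p' q')
    rep' : ∀ {x m} → φ' x ≡ just m → ∃[ y ] (y ∈ ∂ E A' × φ' y ≡ just m)
    rep' p with upd-inv φ v i p
    ... | inj₁ (_ , refl) = v , R⊆ (∪ʳ ⁅⁆⁺) , upd-same φ v i
    ... | inj₂ (_ , q) with rep lab q
    ... | y , y∂ , r = y , R⊆ (∪ˡ y∂) , ex r
    lab' : BoundaryLabelling E E A' φ'
    lab' = record { inside = λ p → case upd-inv φ v i p of λ { (inj₁ (refl , _)) → ∪ʳ ⁅⁆⁺ ; (inj₂ (_ , q)) → ∪ˡ (inside lab q) }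
                  ; conn = con' ; rep = rep' }
    inj' : ∀ {x y m} → x ∈ ∂ E A' → y ∈ ∂ E A' → φ' x ≡ just m → φ' y ≡ just m → x ≡ y
    inj' a b p q with upd-inv φ v i p | upd-inv φ v i q
    ... | inj₁ (refl , _) | inj₁ (refl , _) = refl
    ... | inj₁ (_ , refl) | inj₂ (_ , q') = ⊥-elim (ℕₚ.<-irrefl refl (range tree q'))
    ... | inj₂ (_ , p') | inj₁ (_ , refl) = ⊥-elim (ℕₚ.<-irrefl refl (range tree p'))
    ... | inj₂ (ne , p') | inj₂ (ne' , q') with ∂A'⊆ a | ∂A'⊆ b
    ... | inj₁ a' | inj₁ b' = inj (Stage.tight s) a' b' p' q'
    ... | inj₂ eq | _ = ⊥-elim (ne eq)
    ... | _ | inj₂ eq = ⊥-elim (ne' eq)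
    tight' : Tight E A' φ'
    tight' = record { inj = inj' ; labelled = λ q → case ∂A'⊆ q of λ
      { (inj₁ a) → case labelled (Stage.tight s) a of (λ { (m , p) → m , ex p }) ; (inj₂ refl) → i , upd-same φ v i } }
    open Transfer hiding (lab; tight)
    t : Transfer E M.set (suc i) φ'
    t = menger _ (suc i) E id M.above bound' hyp ℕₚ.≤-refl lab' tight'
    newer : ∀ m → m < suc i → ∃[ x ] φ' x ≡ just m
    newer m lt with m ℕₚ.≟ i
    ... | yes refl = v , upd-same φ v i
    ... | no ne with occurs tree (ℕₚ.≤∧≢⇒< (s≤s⁻¹ lt) ne)
    ... | x , p = x , ex p
    newer-edge : ∀ m → suc m < suc i → ∃[ x ] ∃[ y ] (φ' x ≡ just (suc m) × φ' y ≡ just (parent m) × E x y ≡ true)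
    newer-edge m lt with suc m ℕₚ.≟ i
    ... | yes eq with joins m (sym eq)
    ... | y , q , e = v , y , trans (upd-same φ v i) (cong just (sym eq)) , ex q , e
    newer-edge m lt | no ne with edge tree (ℕₚ.≤∧≢⇒< (s≤s⁻¹ lt) ne)
    ... | x , y , p , q , e = x , y , ex p , ex q , e
    range' : ∀ {x m} → φ' x ≡ just m → m < suc i
    range' p with upd-inv φ v i p
    ... | inj₁ (_ , refl) = ℕₚ.≤-refl
    ... | inj₂ (_ , q) = ℕₚ.m≤n⇒m≤1+n (range tree q)

  stage : ∀ i → i ≤ k → Stage i
  stage zero _ = record
    { A = M.set ; φ = φ₀ ; good = M.good ; bound = M.bound ; max = M.max
    ; lab = record { inside = λ () ; conn = λ () ; rep = λ () }
    ; tight = record { labelled = λ q → ⊥-elim (ℕₚ.<⇒≱ (count-strict {A = ∅} (λ z → ⊥-elim (∅⁻ z)) q ∅⁻) (ℕₚ.≤-trans M.bound z≤n))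
                     ; inj = λ _ _ () }
    ; tree = record { conn = λ () ; range = λ () ; occurs = λ () ; edge = λ () } }
    where
    φ₀ : Labelling n
    φ₀ _ = nothing
    module M = Maximal (maximise {A = ∅} 0 (gempty ∅⁻) (ℕₚ.≤-reflexive (count-∅ (λ q → ∅⁻ (∂-sub q)))))
  stage (suc i) le = grow le (stage i (ℕₚ.≤-trans (ℕₚ.n≤1+n i) le))

  tree-labelling : ∃[ φ ] TreeLabelling E parent k φ
  tree-labelling = _ , Stage.tree (stage k ℕₚ.≤-refl)

-- Minor models from families of blobs

-- The vertices of `H` form an arbitrary type, so `locate` supplies the decision from which the
-- partial map of a minor model is defined.
record Blobs (H : PGraph) (G : Graph) : Set where
  field
    blob  : V H → VSet (size G)
    disj  : ∀ {h h' x} → x ∈ blob h → x ∈ blob h' → h ≡ h'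
    conn  : ∀ h → Conn (adj G) (blob h)
    inhab : ∀ h → ∃[ x ] x ∈ blob h
    touch : ∀ {h h'} → E H h h' → Touch (adj G) (blob h) (blob h')
    locate : ∀ x → Dec (∃[ h ] x ∈ blob h)

toWalkIn : ∀ {G : Graph} {P Q : Fin (size G) → Set} → (∀ {z} → P z → Q z) → ∀ {x y} → Walk (adj G) P x y → WalkIn G Q x y
toWalkIn f (wstop p) = stop (f p)
toWalkIn f (wstep p e w) = step (f p) e (toWalkIn f w)

fromWalkIn : ∀ {G : Graph} {P Q : Fin (size G) → Set} → (∀ {z} → P z → Q z) → ∀ {x y} → WalkIn G P x y → Walk (adj G) Q x y
fromWalkIn f (stop p) = wstop (f p)
fromWalkIn f (step p e w) = wstep (f p) e (fromWalkIn f w)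

module _ {H : PGraph} {G : Graph} (B : Blobs H G) where
  open Blobs B

  blobOf : Fin (size G) → Maybe (V H)
  blobOf x with locate x
  ... | yes (h , _) = just h
  ... | no _ = nothing

  blobOf⁻ : ∀ {x h} → blobOf x ≡ just h → x ∈ blob h
  blobOf⁻ {x} p with locate x
  blobOf⁻ refl | yes (h , q) = q

  blobOf⁺ : ∀ {x h} → x ∈ blob h → blobOf x ≡ just h
  blobOf⁺ {x} q with locate x
  ... | yes (h , p) = cong just (disj p q)
  ... | no none = ⊥-elim (none (_ , q))

  blobs⇒minor : IsMinorOf H G
  blobs⇒minor = record
    { φ = blobOf
    ; nonempty = λ h → proj₁ (inhab h) , blobOf⁺ (proj₂ (inhab h))
    ; connected = λ h x y p q → toWalkIn blobOf⁺ (conn h (blobOf⁻ p) (blobOf⁻ q))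
    ; edges = λ h h' e → case touch e of λ { (a , b , p , q , r) → a , b , blobOf⁺ p , blobOf⁺ q , r } }

-- Tree E K l D B: a model inside D of the complete binary tree of height l,
-- with root blob B, all of whose leaf blobs are adjacent to K.
data Tree {n} (E : Rel n) (K : VSet n) : ℕ → VSet n → VSet n → Set where
  tleaf : ∀ {D B} → Conn E B → B ⊆ D → Touch E B K → Tree E K 0 D B
  tnode : ∀ {l D B D₀ B₀ D₁ B₁} → Conn E B → B ⊆ D → D₀ ⊆ D → D₁ ⊆ D →
          Disjoint B D₀ → Disjoint B D₁ → Disjoint D₀ D₁ → Touch E B B₀ → Touch E B B₁ →
          Tree E K l D₀ B₀ → Tree E K l D₁ B₁ → Tree E K (suc l) D B

module _ {n} {E : Rel n} where

  tree-root : ∀ {K l D B} → Tree E K l D B → B ⊆ D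
  tree-root (tleaf _ i _) = i
  tree-root (tnode _ i _ _ _ _ _ _ _ _ _) = i

  tree-conn : ∀ {K l D B} → Tree E K l D B → Conn E B
  tree-conn (tleaf c _ _) = c
  tree-conn (tnode c _ _ _ _ _ _ _ _ _ _) = c

  tree-apex : ∀ {K K' l D B} → K ⊆ K' → Tree E K l D B → Tree E K' l D B
  tree-apex f (tleaf c i t) = tleaf c i (touch-mono id f t)
  tree-apex f (tnode c i a b d₁ d₂ d₃ u v s t) = tnode c i a b d₁ d₂ d₃ u v (tree-apex f s) (tree-apex f t)

  tree-extend : ∀ {K l D B P} → Disjoint P D → Conn E (B ∪ P) → Tree E K l D B → Tree E K l (D ∪ P) (B ∪ P)
  tree-extend d c (tleaf _ i t) = tleaf c (∪-elim (∪ˡ ∘ i) ∪ʳ) (touch-mono ∪ˡ id t)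
  tree-extend d c (tnode _ i a b d₁ d₂ d₃ u v s t) = tnode c (∪-elim (∪ˡ ∘ i) ∪ʳ) (∪ˡ ∘ a) (∪ˡ ∘ b)
    (∪-disj d₁ (λ p q → d p (a q))) (∪-disj d₂ (λ p q → d p (b q))) d₃ (touch-mono ∪ˡ id u) (touch-mono ∪ˡ id v) s t

  module _ {K : VSet n} where

    treeBlob : ∀ {l D B} → Tree E K l D B → List Bool → VSet n
    treeBlob {B = B} t [] = B
    treeBlob (tleaf _ _ _) (b ∷ u) = ∅
    treeBlob (tnode _ _ _ _ _ _ _ _ _ s t) (false ∷ u) = treeBlob s u
    treeBlob (tnode _ _ _ _ _ _ _ _ _ s t) (true ∷ u) = treeBlob t u

    treeBlob-in : ∀ {l D B} (t : Tree E K l D B) u → treeBlob t u ⊆ D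
    treeBlob-in t [] = tree-root t
    treeBlob-in (tleaf _ _ _) (b ∷ u) q = ⊥-elim (∅⁻ q)
    treeBlob-in (tnode _ _ a b _ _ _ _ _ s t) (false ∷ u) q = a (treeBlob-in s u q)
    treeBlob-in (tnode _ _ a b _ _ _ _ _ s t) (true ∷ u) q = b (treeBlob-in t u q)

    treeBlob-disj : ∀ {l D B} (t : Tree E K l D B) u v {x} → x ∈ treeBlob t u → x ∈ treeBlob t v → u ≡ v
    treeBlob-disj t [] [] p q = refl
    treeBlob-disj (tleaf _ _ _) [] (_ ∷ _) p q = ⊥-elim (∅⁻ q)
    treeBlob-disj (tleaf _ _ _) (_ ∷ _) _ p q = ⊥-elim (∅⁻ p)
    treeBlob-disj (tnode _ _ _ _ d₁ d₂ d₃ _ _ s t) [] (false ∷ v) p q = ⊥-elim (d₁ p (treeBlob-in s v q))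
    treeBlob-disj (tnode _ _ _ _ d₁ d₂ d₃ _ _ s t) [] (true ∷ v) p q = ⊥-elim (d₂ p (treeBlob-in t v q))
    treeBlob-disj (tnode _ _ _ _ d₁ d₂ d₃ _ _ s t) (false ∷ u) [] p q = ⊥-elim (d₁ q (treeBlob-in s u p))
    treeBlob-disj (tnode _ _ _ _ d₁ d₂ d₃ _ _ s t) (true ∷ u) [] p q = ⊥-elim (d₂ q (treeBlob-in t u p))
    treeBlob-disj (tnode _ _ _ _ d₁ d₂ d₃ _ _ s t) (false ∷ u) (false ∷ v) p q = cong (false ∷_) (treeBlob-disj s u v p q)
    treeBlob-disj (tnode _ _ _ _ d₁ d₂ d₃ _ _ s t) (true ∷ u) (true ∷ v) p q = cong (true ∷_) (treeBlob-disj t u v p q)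
    treeBlob-disj (tnode _ _ _ _ d₁ d₂ d₃ _ _ s t) (false ∷ u) (true ∷ v) p q = ⊥-elim (d₃ (treeBlob-in s u p) (treeBlob-in t v q))
    treeBlob-disj (tnode _ _ _ _ d₁ d₂ d₃ _ _ s t) (true ∷ u) (false ∷ v) p q = ⊥-elim (d₃ (treeBlob-in s v q) (treeBlob-in t u p))

    treeBlob-conn : ∀ {l D B} (t : Tree E K l D B) u → Conn E (treeBlob t u)
    treeBlob-conn t [] = tree-conn t
    treeBlob-conn (tleaf _ _ _) (b ∷ u) p = ⊥-elim (∅⁻ p)
    treeBlob-conn (tnode _ _ _ _ _ _ _ _ _ s t) (false ∷ u) = treeBlob-conn s u
    treeBlob-conn (tnode _ _ _ _ _ _ _ _ _ s t) (true ∷ u) = treeBlob-conn t u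

    treeBlob-leaf : ∀ {l D B} (t : Tree E K l D B) u → length u ≡ l → Touch E (treeBlob t u) K
    treeBlob-leaf (tleaf _ _ t) [] p = t
    treeBlob-leaf (tnode _ _ _ _ _ _ _ _ _ s t) (false ∷ u) p = treeBlob-leaf s u (ℕₚ.suc-injective p)
    treeBlob-leaf (tnode _ _ _ _ _ _ _ _ _ s t) (true ∷ u) p = treeBlob-leaf t u (ℕₚ.suc-injective p)

    treeBlob-edge : ∀ {l D B} (t : Tree E K l D B) u b → length u < l → Touch E (treeBlob t u) (treeBlob t (u ++ [ b ]))
    treeBlob-edge (tnode _ _ _ _ _ _ _ u v s t) [] false p = u
    treeBlob-edge (tnode _ _ _ _ _ _ _ u v s t) [] true p = v
    treeBlob-edge (tnode _ _ _ _ _ _ _ _ _ s t) (false ∷ u) b p = treeBlob-edge s u b (s≤s⁻¹ p)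
    treeBlob-edge (tnode _ _ _ _ _ _ _ _ _ s t) (true ∷ u) b p = treeBlob-edge t u b (s≤s⁻¹ p)

    treeBlob-inhab : ∀ {l D B} (t : Tree E K l D B) u → length u ≤ l → ∃[ x ] x ∈ treeBlob t u
    treeBlob-inhab (tleaf _ _ (x , _ , p , _)) [] _ = x , p
    treeBlob-inhab (tnode _ _ _ _ _ _ _ (x , _ , p , _) _ _ _) [] _ = x , p
    treeBlob-inhab (tnode _ _ _ _ _ _ _ _ _ s t) (false ∷ u) p = treeBlob-inhab s u (s≤s⁻¹ p)
    treeBlob-inhab (tnode _ _ _ _ _ _ _ _ _ s t) (true ∷ u) p = treeBlob-inhab t u (s≤s⁻¹ p)

    treeBlob-length : ∀ {l D B} (t : Tree E K l D B) u {x} → x ∈ treeBlob t u → length u ≤ l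
    treeBlob-length t [] p = z≤n
    treeBlob-length (tleaf _ _ _) (b ∷ u) p = ⊥-elim (∅⁻ p)
    treeBlob-length (tnode _ _ _ _ _ _ _ _ _ s t) (false ∷ u) p = s≤s (treeBlob-length s u p)
    treeBlob-length (tnode _ _ _ _ _ _ _ _ _ s t) (true ∷ u) p = s≤s (treeBlob-length t u p)

    treeBlob-locate : ∀ {l D B} (t : Tree E K l D B) x → Dec (∃[ u ] x ∈ treeBlob t u)
    treeBlob-locate {B = B} t x with x ∈? B
    ... | yes p = yes ([] , p)
    treeBlob-locate (tleaf _ _ _) x | no np = no λ { ([] , p) → np p ; (_ ∷ _ , p) → ∅⁻ p }
    treeBlob-locate (tnode _ _ _ _ _ _ _ _ _ s t) x | no np with treeBlob-locate s x | treeBlob-locate t x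
    ... | yes (u , p) | _ = yes (false ∷ u , p)
    ... | no _ | yes (u , p) = yes (true ∷ u , p)
    ... | no ns | no nt = no λ { ([] , p) → np p ; (false ∷ u , p) → ns (u , p) ; (true ∷ u , p) → nt (u , p) }

module _ (G : Graph) where
  open Sym (adj G) (adj-symm G)

  tree⇒gamma : ∀ {l D B K} → Tree (adj G) K l D B → Conn (adj G) K → Disjoint K D → IsMinorOf (GammaPlus l) G
  tree⇒gamma {l} {D} {B} {K} t cK K∩D = blobs⇒minor {H = GammaPlus l} record
    { blob = bl ; disj = λ {h} {h'} → dj h h' ; conn = cn ; inhab = ih ; touch = tc ; locate = lc }
    where
    bl : Maybe (TreeV l) → VSet (size G)
    bl nothing = K
    -- A word of `TreeV` has the last step from the root at its head, a word read by `treeBlob` the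
    -- first.
    bl (just (w , _)) = treeBlob t (reverse w)
    dj : ∀ h h' {x} → x ∈ bl h → x ∈ bl h' → h ≡ h'
    dj nothing nothing p q = refl
    dj nothing (just (w , _)) p q = ⊥-elim (K∩D p (treeBlob-in t (reverse w) q))
    dj (just (w , _)) nothing p q = ⊥-elim (K∩D q (treeBlob-in t (reverse w) p))
    dj (just (w , i)) (just (w' , i')) p q with Listₚ.reverse-injective {x = w} {y = w'} (treeBlob-disj t (reverse w) (reverse w') p q)
    ... | refl = cong (λ i → just (w , i)) (ℕₚ.≤-irrelevant i i')
    cn : ∀ h → Conn (adj G) (bl h)
    cn nothing = cK
    cn (just (w , _)) = treeBlob-conn t (reverse w)
    len-rev : ∀ (w : List Bool) {m} → length w ≤ m → length (reverse w) ≤ m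
    len-rev w = subst (_≤ _) (sym (Listₚ.length-reverse w))
    ih : ∀ h → ∃[ x ] x ∈ bl h
    ih nothing = leaf t
      where leaf : ∀ {l D B} → Tree (adj G) K l D B → ∃[ x ] x ∈ K
            leaf (tleaf _ _ (_ , x , _ , p , _)) = x , p
            leaf (tnode _ _ _ _ _ _ _ _ _ s _) = leaf s
    ih (just (w , i)) = treeBlob-inhab t (reverse w) (len-rev w i)
    tc₁ : ∀ {h h'} → GammaPlusE l h h' → Touch (adj G) (bl h) (bl h')
    tc₁ (child b w p q) rewrite Listₚ.unfold-reverse b w = treeBlob-edge t (reverse w) b (subst (λ k → suc k ≤ l) (sym (Listₚ.length-reverse w)) q)
    tc₁ (apex w p q) = treeBlob-leaf t (reverse w) (trans (Listₚ.length-reverse w) q)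
    tc : ∀ {h h'} → GammaPlusE l h h' ⊎ GammaPlusE l h' h → Touch (adj G) (bl h) (bl h')
    tc (inj₁ e) = tc₁ e
    tc (inj₂ e) = touch-sym (tc₁ e)
    lc : ∀ x → Dec (∃[ h ] x ∈ bl h)
    lc x with x ∈? K
    ... | yes p = yes (nothing , p)
    ... | no np with treeBlob-locate t x
    ... | yes (u , p) = yes (just (reverse u , len-rev u (treeBlob-length t u p)) , subst (λ u → x ∈ treeBlob t u) (sym (Listₚ.reverse-involutive u)) p)
    ... | no nt = no λ { (nothing , p) → np p ; (just (w , _) , p) → nt (reverse w , p) }

-- Unlike a Tree, a Bush partitions D into blobs, so that complements of subtrees are connected.
data Bush {n} (E : Rel n) : ℕ → VSet n → VSet n → Set where
  bleaf : ∀ {D r} → Conn E D → r ∈ D → Bush E 0 D D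
  bnode : ∀ {h D B D₀ B₀ D₁ B₁ r} → Conn E B → r ∈ B → B ⊆ D → D₀ ⊆ D → D₁ ⊆ D →
          Disjoint B D₀ → Disjoint B D₁ → Disjoint D₀ D₁ → (∀ {x} → x ∈ D → x ∈ B ⊎ x ∈ D₀ ⊎ x ∈ D₁) →
          Touch E B B₀ → Touch E B B₁ → Bush E h D₀ B₀ → Bush E h D₁ B₁ → Bush E (suc h) D B

-- Pods and cores

mutual
  data Core {n} (E : Rel n) : ℕ → VSet n → Set where
    core-z : ∀ {C r} → Conn E C → r ∈ C → Core E 0 C
    core-s : ∀ {M C E₀ E₁} → Conn E C → Pod E M E₀ → Pod E M E₁ → E₀ ⊆ C → E₁ ⊆ C → Disjoint E₀ E₁ → Core E (suc M) C

  -- The fields `outer`, `outX` and `outY` are there for the quotient: when one contracted rail is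
  -- deleted, the other is still attached to the connected complement of `D`.
  record Pod {n} (E : Rel n) (M : ℕ) (D : VSet n) : Set where
    inductive
    field
      X Y C : VSet n
      X⊆    : X ⊆ D
      Y⊆    : Y ⊆ D
      C⊆    : C ⊆ D
      cover : ∀ {z} → z ∈ D → z ∈ X ⊎ z ∈ Y ⊎ z ∈ C
      X∩Y   : Disjoint X Y
      X∩C   : Disjoint X C
      Y∩C   : Disjoint Y C
      cX    : Conn E X
      cY    : Conn E Y
      tXY   : Touch E X Y
      tXC   : Touch E X C
      tYC   : Touch E Y C
      closed : ∀ {a b} → a ∈ C → E a b ≡ true → b ∈ X ⊎ b ∈ Y ⊎ b ∈ C
      outX  : Touch E X (∁ D)
      outY  : Touch E Y (∁ D)
      outer : Conn E (∁ D)
      core  : Core E M C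

core-conn : ∀ {n} {E : Rel n} {M C} → Core E M C → Conn E C
core-conn (core-z c _) = c
core-conn (core-s c _ _ _ _ _) = c

-- One level separates the child that is searched from its sibling, and `l` levels leave room for a
-- binary tree of that height. The inner `suc` gives the core two distinct vertices, from which the
-- rails are split; in a core of positive level, it is also the branching into two pods.
podHeight coreHeight : ℕ → ℕ → ℕ
podHeight l M = suc (l + suc (coreHeight l M))
coreHeight l zero = zero
coreHeight l (suc M) = podHeight l M

-- Finding pods in a spanning tree model

module Pods {n} (E : Rel n) (E-sym : ∀ {x y} → E x y ≡ true → E y x ≡ true) (tc : TwoConn E full) where
  open Sym E E-sym
  open SymParts E E-sym

  bush-root : ∀ {h D B} → Bush E h D B → B ⊆ D
  bush-root (bleaf _ _) = id
  bush-root (bnode _ _ i _ _ _ _ _ _ _ _ _ _) = i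

  bush-point : ∀ {h D B} → Bush E h D B → ∃[ r ] r ∈ B
  bush-point (bleaf _ r) = _ , r
  bush-point (bnode _ r _ _ _ _ _ _ _ _ _ _ _) = _ , r

  bush-conn : ∀ {h D B} → Bush E h D B → Conn E D
  bush-conn (bleaf c _) = c
  bush-conn (bnode {D = D} {B} {D₀} {B₀} {D₁} {B₁} cB _ B⊆ D₀⊆ D₁⊆ _ _ _ cov t₀ t₁ s t) =
    conn-ext (∪-elim (∪-elim B⊆ D₀⊆) D₁⊆) back
      (conn-∪ (conn-∪ cB (bush-conn s) (touch-mono id (bush-root s) t₀)) (bush-conn t) (touch-mono ∪ˡ (bush-root t) t₁))
    where back : D ⊆ B ∪ D₀ ∪ D₁
          back q with cov q
          ... | inj₁ b = ∪ˡ (∪ˡ b)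
          ... | inj₂ (inj₁ b) = ∪ˡ (∪ʳ b)
          ... | inj₂ (inj₂ b) = ∪ʳ b

  -- Quantifying over `K` lets the property pass down the tree: for a child, `K` is enlarged by the
  -- root blob and the sibling subtree. It is later applied both with the complement of `D` and with
  -- a part of the tree itself.
  Hangs : (D B C B' : VSet n) → Set
  Hangs D B C B' = ∀ {K} → Conn E K → Disjoint K D → Touch E K B → Conn E (K ∪ (D ∖ C)) × Touch E (K ∪ (D ∖ C)) B'

  record SubBush (K : VSet n) (h : ℕ) (D B : VSet n) : Set where
    field
      {C B'} : VSet n
      bush  : Bush E h C B'
      C⊆    : C ⊆ D
      clean : ¬ Touch E C K
      hangs : Hangs D B C B'

  hangs-child : ∀ {D B D₀ B₀ D₁ C B'} → Conn E (B ∪ D₁) → B ⊆ D → D₀ ⊆ D → D₁ ⊆ D → Disjoint B D₀ → Disjoint D₁ D₀ →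
    (∀ {x} → x ∈ D → x ∈ B ⊎ x ∈ D₁ ⊎ x ∈ D₀) → C ⊆ D₀ → Touch E B B₀ → Hangs D₀ B₀ C B' → Hangs D B C B'
  hangs-child {D} {B} {D₀} {B₀} {D₁} {C} {B'} cBD B⊆ D₀⊆ D₁⊆ d d' cov C⊆ t hg {K} cK K∩D tK =
    conn-ext to from (proj₁ r) , touch-mono to id (proj₂ r)
    where
    r : Conn E (K ∪ (B ∪ D₁) ∪ (D₀ ∖ C)) × Touch E (K ∪ (B ∪ D₁) ∪ (D₀ ∖ C)) B'
    r = hg {K ∪ (B ∪ D₁)} (conn-∪ cK cBD (touch-mono id ∪ˡ tK)) (∪-disj (λ k q → K∩D k (D₀⊆ q)) (∪-disj d d')) (touch-mono {A = B} {B = B₀} (λ q → ∪ʳ (∪ˡ q)) id t)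
    to : (K ∪ (B ∪ D₁)) ∪ (D₀ ∖ C) ⊆ K ∪ (D ∖ C)
    to = ∪-elim (∪-elim ∪ˡ (∪-elim (λ b → ∪ʳ (∖⁺ (B⊆ b) (λ c → d b (C⊆ c)))) (λ b → ∪ʳ (∖⁺ (D₁⊆ b) (λ c → d' b (C⊆ c))))))
                (λ q → ∪ʳ (∖⁺ (D₀⊆ (proj₁ (∖⁻ q))) (proj₂ (∖⁻ q))))
    from : K ∪ (D ∖ C) ⊆ K ∪ (B ∪ D₁) ∪ (D₀ ∖ C)
    from = ∪-elim (∪ˡ ∘ ∪ˡ) (λ q → case cov (proj₁ (∖⁻ q)) of λ
      { (inj₁ b) → ∪ˡ (∪ʳ (∪ˡ b)) ; (inj₂ (inj₁ b)) → ∪ˡ (∪ʳ (∪ʳ b)) ; (inj₂ (inj₂ b)) → ∪ʳ (∖⁺ b (proj₂ (∖⁻ q))) })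

  -- After `l` levels, the remaining subtree of height `h` either touches `K` and becomes a leaf
  -- blob as a whole, which is why the root blob may grow to `B'`, or is clean itself. One clean
  -- subtree anywhere decides for the second alternative.
  rich-or-clean : ∀ l {h D B} (K : VSet n) → Bush E (l + h) D B → (∃[ B' ] (B ⊆ B' × Tree E K l D B')) ⊎ SubBush K h D B
  rich-or-clean zero {h} {D} {B} K b with touch? E D K
  ... | yes t = inj₁ (D , bush-root b , tleaf (bush-conn b) id t)
  ... | no nt = inj₂ (record { bush = b ; C⊆ = id ; clean = nt ; hangs = λ cK _ t →
          conn-ext ∪ˡ (∪-elim id (λ q → ⊥-elim (proj₂ (∖⁻ q) (proj₁ (∖⁻ q))))) cK , touch-mono ∪ˡ id t })
  rich-or-clean (suc l) {h} {D} {B} K (bnode {D₀ = D₀} {B₀} {D₁} {B₁} cB rB B⊆ D₀⊆ D₁⊆ d₀ d₁ d₀₁ cov t₀ t₁ s t)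
    with rich-or-clean l K s | rich-or-clean l K t
  ... | inj₁ (B₀' , i , s') | inj₁ (B₁' , j , t') =
    inj₁ (B , id , tnode cB B⊆ D₀⊆ D₁⊆ d₀ d₁ d₀₁ (touch-mono id i t₀) (touch-mono id j t₁) s' t')
  ... | inj₂ sb | _ = inj₂ (record { bush = bush ; C⊆ = D₀⊆ ∘ C⊆ ; clean = clean
        ; hangs = hangs-child (conn-∪ cB (bush-conn t) (touch-mono id (bush-root t) t₁)) B⊆ D₀⊆ D₁⊆ d₀ (disj-sym d₀₁)
            (λ q → case cov q of λ { (inj₁ b) → inj₁ b ; (inj₂ (inj₁ b)) → inj₂ (inj₂ b) ; (inj₂ (inj₂ b)) → inj₂ (inj₁ b) }) C⊆ t₀ hangs })
    where open SubBush sb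
  ... | _ | inj₂ sb = inj₂ (record { bush = bush ; C⊆ = D₁⊆ ∘ C⊆ ; clean = clean
        ; hangs = hangs-child (conn-∪ cB (bush-conn s) (touch-mono id (bush-root s) t₀)) B⊆ D₁⊆ D₀⊆ d₁ d₀₁ cov C⊆ t₁ hangs })
    where open SubBush sb

  record Rails (D C : VSet n) : Set where
    field
      X Y  : VSet n
      X⊆   : X ⊆ D ∖ C
      Y⊆   : Y ⊆ D ∖ C
      cover : ∀ {z} → z ∈ D ∖ C → z ∈ X ⊎ z ∈ Y
      disj : Disjoint X Y
      cX   : Conn E X
      cY   : Conn E Y
      tXY  : Touch E X Y
      tXC  : Touch E X C
      tYC  : Touch E Y C
      outX : Touch E X (∁ D)
      outY : Touch E Y (∁ D)

  opaque
    -- Split `D` at two points of `C` into parts that reach the complement of `D`. As `C` does not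
    -- touch that complement, each part leaves `D` from a vertex outside `C`, whose component in the
    -- part minus `C` also touches `C`. These two components absorb the rest of `D ∖ C`.
    rails : ∀ {D C c₁ c₂ z} → C ⊆ D → Conn E D → Conn E (D ∖ C) → c₁ ∈ C → c₂ ∈ C → c₁ ≢ c₂ → ¬ Touch E C (∁ D) → z ∉ D → Rails D C
    rails {D} {C} {c₁} {c₂} C⊆ cD cDC c₁C c₂C ne clean zD = record
      { X = part zero ; Y = part (suc zero) ; X⊆ = inside zero ; Y⊆ = inside (suc zero)
      ; cover = λ q → case cover q of λ { (zero , p) → inj₁ p ; (suc zero , p) → inj₂ p }
      ; disj = λ p q → case disj p q of λ ()
      ; cX = conn zero ; cY = conn (suc zero)
      ; tXY = joined
      ; tXC = touch-mono (ext zero) id (Trim.toC X₁) ; tYC = touch-mono (ext (suc zero)) id (Trim.toC Y₁)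
      ; outX = touch-mono (ext zero) id (Trim.out X₁) ; outY = touch-mono (ext (suc zero)) id (Trim.out Y₁) }
      where
      module S = Split (split tc (λ _ → full⁺) cD full⁺ zD (C⊆ c₁C) (C⊆ c₂C) ne)
      record Trim (X' : VSet n) : Set where
        field
          set   : VSet n
          sub   : set ⊆ X'
          avoid : set ⊆ D ∖ C
          conn  : Conn E set
          toC   : Touch E set C
          out   : Touch E set (∁ D)
      trim : ∀ {X' c} → X' ⊆ D → Conn E X' → c ∈ X' → c ∈ C → Touch E X' (full ∖ D) → Trim X'
      trim {X'} {c} X'⊆ cX' cX c∈C (a , b , aX , b∈ , e) = record
        { set = K.set ; sub = λ q → proj₁ (∖⁻ (K.inside q)) ; avoid = λ q → ∖⁺ (X'⊆ (proj₁ (∖⁻ (K.inside q)))) (proj₂ (∖⁻ (K.inside q)))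
        ; conn = K.conn ; toC = toC ; out = a , b , K.start , b∉ , e }
        where
        b∉ : b ∈ ∁ D
        b∉ = ∁⁺ (proj₂ (∖⁻ b∈))
        aC : a ∉ C
        aC q = clean (a , b , q , b∉ , e)
        module K = Component (component (X' ∖ C) (∖⁺ aX aC))
        toC : Touch E K.set C
        toC with crossing K.set (cX' aX cX) K.start (λ q → proj₂ (∖⁻ (K.inside q)) c∈C)
        ... | x , y , xK , yK , xX , yX , e' = x , y , xK , decidable-stable (y ∈? C) (λ ny → yK (K.closed xK (∖⁺ yX ny) e')) , e'
      X₁ : Trim S.X
      X₁ = trim S.X⊆ S.cX S.x∈ c₁C S.tX
      Y₁ : Trim S.Y
      Y₁ = trim S.Y⊆ S.cY S.y∈ c₂C S.tY
      F : Fin 2 → VSet n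
      F zero = Trim.set X₁
      F (suc zero) = Trim.set Y₁
      F-in : ∀ i → F i ⊆ D ∖ C
      F-in zero = Trim.avoid X₁
      F-in (suc zero) = Trim.avoid Y₁
      F-conn : ∀ i → Conn E (F i)
      F-conn zero = Trim.conn X₁
      F-conn (suc zero) = Trim.conn Y₁
      open Parts (absorbSets {U = D ∖ C} {S = F} cDC (two-disjoint {S = F} (λ p q → S.disj (Trim.sub X₁ p) (Trim.sub Y₁ q))) F-in F-conn {i = zero} (proj₁ (proj₂ (proj₂ (Trim.toC X₁)))))
      joined : Touch E (part zero) (part (suc zero))
      joined with Trim.toC X₁ | Trim.toC Y₁
      ... | a , _ , aX , _ | b , _ , bY , _ with crossing (part zero) (cDC (F-in zero aX) (F-in (suc zero) bY)) (ext zero aX)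
                                                 (λ q → case disj q (ext (suc zero) bY) of λ ())
      ... | x , y , x∈ , y∉ , _ , y∈ , e with cover y∈
      ... | zero , r = ⊥-elim (y∉ r)
      ... | suc zero , r = x , y , x∈ , r , e

  ApexTree : ℕ → Set
  ApexTree l = ∃[ K ] ∃[ D ] ∃[ B ] (Tree E K l D B × Conn E K × Disjoint K D)

  makePod : ∀ {M D C c₁ c₂} → C ⊆ D → Conn E D → Conn E (D ∖ C) → Conn E (∁ D) → c₁ ∈ C → c₂ ∈ C → c₁ ≢ c₂ →
    ¬ Touch E C (∁ D) → ∀ {z} → z ∉ D → Core E M C → Pod E M D
  makePod {M} {D} {C} C⊆D cD cDC cK c₁ c₂ ne clean zD core = record
    { X = R.X ; Y = R.Y ; C = C ; X⊆ = λ q → proj₁ (∖⁻ (R.X⊆ q)) ; Y⊆ = λ q → proj₁ (∖⁻ (R.Y⊆ q)) ; C⊆ = C⊆D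
    ; cover = cov ; X∩Y = R.disj ; X∩C = λ p q → proj₂ (∖⁻ (R.X⊆ p)) q ; Y∩C = λ p q → proj₂ (∖⁻ (R.Y⊆ p)) q
    ; cX = R.cX ; cY = R.cY ; tXY = R.tXY ; tXC = R.tXC ; tYC = R.tYC
    ; closed = λ {a} {b} aC e → cov (decidable-stable (b ∈? D) (λ nb → clean (a , b , aC , ∁⁺ nb , e)))
    ; outX = R.outX ; outY = R.outY ; outer = cK ; core = core }
    where
    module R = Rails (rails C⊆D cD cDC c₁ c₂ ne clean zD)
    cov : ∀ {z} → z ∈ D → z ∈ R.X ⊎ z ∈ R.Y ⊎ z ∈ C
    cov {z} q with z ∈? C
    ... | yes c = inj₂ (inj₂ c)
    ... | no nc with R.cover (∖⁺ q nc)
    ... | inj₁ x = inj₁ x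
    ... | inj₂ y = inj₂ (inj₁ y)

  child-outside : ∀ {C B F BF G BG h} → Conn E (∁ C) → Touch E (∁ C) B → Conn E B → Bush E h G BG → F ⊆ C → G ⊆ C → Disjoint B F → Disjoint G F →
    (∀ {x} → x ∈ C → x ∈ B ⊎ x ∈ F ⊎ x ∈ G) → Touch E B BF → Touch E B BG → Conn E (∁ F) × Touch E BF (∁ F)
  child-outside {C} {B} {F} {BF} {G} cC tB cB bG F⊆ G⊆ dF dG cv tF tG =
    conn-ext (∪-elim (∪-elim (λ q → ∁⁺ (λ f → ∁⁻ q (F⊆ f))) (λ b → ∁⁺ (dF b))) (λ g → ∁⁺ (dG g))) back
      (conn-∪ (conn-∪ cC cB tB) (bush-conn bG) (touch-mono ∪ʳ (bush-root bG) tG))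
    , touch-mono id (λ b → ∁⁺ (dF b)) (touch-sym tF)
    where
    back : ∁ F ⊆ ∁ C ∪ B ∪ G
    back {x} q with x ∈? C
    ... | no nc = ∪ˡ (∪ˡ (∁⁺ nc))
    ... | yes c with cv c
    ... | inj₁ b = ∪ˡ (∪ʳ b)
    ... | inj₂ (inj₁ f) = ⊥-elim (∁⁻ q f)
    ... | inj₂ (inj₂ g) = ∪ʳ g

  hangs⇒conn : ∀ {D B D₀ B₀ D₁ C B'} → Conn E (B ∪ D₁) → B ⊆ D → D₀ ⊆ D → D₁ ⊆ D → Disjoint B D₀ → Disjoint D₁ D₀ →
    (∀ {x} → x ∈ D → x ∈ B ⊎ x ∈ D₁ ⊎ x ∈ D₀) → C ⊆ D₀ → Touch E B B₀ → Hangs D₀ B₀ C B' → Conn E (D ∖ C)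
  hangs⇒conn {D} {B} {D₀} {B₀} {D₁} {C} cBD₁ B⊆ D₀⊆ D₁⊆ d d' cov C⊆ t hangs =
    conn-ext (∪-elim (∪-elim (λ b → ∖⁺ (B⊆ b) (λ c → d b (C⊆ c))) (λ b → ∖⁺ (D₁⊆ b) (λ c → d' b (C⊆ c))))
                           (λ q → ∖⁺ (D₀⊆ (proj₁ (∖⁻ q))) (proj₂ (∖⁻ q))))
                   (λ q → case cov (proj₁ (∖⁻ q)) of λ { (inj₁ b) → ∪ˡ (∪ˡ b) ; (inj₂ (inj₂ b)) → ∪ʳ (∖⁺ b (proj₂ (∖⁻ q))) ; (inj₂ (inj₁ b)) → ∪ˡ (∪ʳ b) })
                   (proj₁ (hangs cBD₁ (∪-disj d d') (touch-mono ∪ˡ id t)))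

  hangs⇒outside : ∀ {D B C B'} → C ⊆ D → Conn E (∁ D) → Touch E (∁ D) B → Hangs D B C B' → Conn E (∁ C) × Touch E (∁ C) B'
  hangs⇒outside {D} {B} {C} {B'} C⊆D cK tK hang = conn-ext to from (proj₁ r) , touch-mono to id (proj₂ r)
    where
    r : Conn E (∁ D ∪ (D ∖ C)) × Touch E (∁ D ∪ (D ∖ C)) B'
    r = hang cK (λ k q → ∁⁻ k q) tK
    to : ∁ D ∪ (D ∖ C) ⊆ ∁ C
    to = ∪-elim (λ q → ∁⁺ (λ c → ∁⁻ q (C⊆D c))) (λ q → ∁⁺ (proj₂ (∖⁻ q)))
    from : ∁ C ⊆ ∁ D ∪ (D ∖ C)
    from {x} q with x ∈? D
    ... | yes d = ∪ʳ (∖⁺ d (∁⁻ q))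
    ... | no nd = ∪ˡ (∁⁺ nd)

  record CleanCore (h : ℕ) (D : VSet n) : Set where
    field
      {C B'} : VSet n
      bush  : Bush E h C B'
      C⊆    : C ⊆ D
      clean : ¬ Touch E C (∁ D)
      cDC   : Conn E (D ∖ C)
      outC  : Conn E (∁ C)
      toutC : Touch E (∁ C) B'

  -- Only the child `D₀` is searched. The root blob and `D₁` stay outside `C` and keep `D ∖ C`
  -- connected without the help of the complement of `D`; this is what the rails require.
  clean-core : ∀ l {h D B} → Bush E (suc (l + h)) D B → Conn E (∁ D) → Touch E B (∁ D) → ApexTree l ⊎ CleanCore h D
  clean-core l {h} {D} {B} (bnode {D₀ = D₀} {B₀} {D₁} {B₁} cB rB B⊆ D₀⊆ D₁⊆ d₀ d₁ d₀₁ cov t₀ t₁ s t) cK tK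
    with rich-or-clean l (∁ D) s
  ... | inj₁ (B₀' , _ , tr) = inj₁ (∁ D , D₀ , B₀' , tr , cK , λ k q → ∁⁻ k (D₀⊆ q))
  ... | inj₂ sb = inj₂ (record { bush = bush ; C⊆ = λ q → D₀⊆ (C⊆ q) ; clean = clean
      ; cDC = hangs⇒conn cBD₁ B⊆ D₀⊆ D₁⊆ d₀ (disj-sym d₀₁) cov' C⊆ t₀ hangs ; outC = proj₁ outs ; toutC = proj₂ outs })
    where
    open SubBush sb
    cBD₁ : Conn E (B ∪ D₁)
    cBD₁ = conn-∪ cB (bush-conn t) (touch-mono id (bush-root t) t₁)
    cov' : ∀ {x} → x ∈ D → x ∈ B ⊎ x ∈ D₁ ⊎ x ∈ D₀
    cov' q = case cov q of λ { (inj₁ b) → inj₁ b ; (inj₂ (inj₁ b)) → inj₂ (inj₂ b) ; (inj₂ (inj₂ b)) → inj₂ (inj₁ b) }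
    outs : Conn E (∁ C) × Touch E (∁ C) B'
    outs = hangs⇒outside (λ q → D₀⊆ (C⊆ q)) cK (touch-sym tK) (hangs-child cBD₁ B⊆ D₀⊆ D₁⊆ d₀ (disj-sym d₀₁) cov' C⊆ t₀ hangs)

  bush-pair : ∀ {h D B} → Bush E (suc h) D B → ∃[ x ] ∃[ y ] (x ∈ D × y ∈ D × x ≢ y)
  bush-pair (bnode _ rB B⊆ D₀⊆ _ d₀ _ _ _ _ _ s _) with bush-point s
  ... | y , yB = _ , y , B⊆ rB , D₀⊆ (bush-root s yB) , λ { refl → d₀ rB (bush-root s yB) }

  buildPod : ∀ l M {D B} → Bush E (podHeight l M) D B → Conn E (∁ D) → Touch E B (∁ D) → ApexTree l ⊎ Pod E M D
  buildCore : ∀ l M {C B} → Bush E (suc (coreHeight l M)) C B → Conn E (∁ C) → Touch E (∁ C) B → ApexTree l ⊎ Core E M C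
  buildPod l M b cK tK with clean-core l b cK tK
  ... | inj₁ a = inj₁ a
  ... | inj₂ cc with buildCore l M (CleanCore.bush cc) (CleanCore.outC cc) (CleanCore.toutC cc)
  ... | inj₁ a = inj₁ a
  ... | inj₂ core with bush-pair (CleanCore.bush cc) | tK
  ... | _ , _ , x , y , ne | _ , _ , _ , z , _ =
    inj₂ (makePod (CleanCore.C⊆ cc) (bush-conn b) (CleanCore.cDC cc) cK x y ne (CleanCore.clean cc) (∁⁻ z) core)
  buildCore l zero b cC tC = inj₂ (core-z (bush-conn b) (bush-root b (proj₂ (bush-point b))))
  buildCore l (suc M) b@(bnode {D₀ = C₀} {D₁ = C₁} cB rB B⊆ C₀⊆ C₁⊆ e₀ e₁ e₀₁ cov u₀ u₁ p q) cC tC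
    with child-outside cC tC cB q C₀⊆ C₁⊆ e₀ (disj-sym e₀₁) cov u₀ u₁
       | child-outside cC tC cB p C₁⊆ C₀⊆ e₁ e₀₁ (λ x → case cov x of λ { (inj₁ b) → inj₁ b ; (inj₂ (inj₁ b)) → inj₂ (inj₂ b) ; (inj₂ (inj₂ b)) → inj₂ (inj₁ b) }) u₁ u₀
  ... | o₀ , v₀ | o₁ , v₁ with buildPod l M p o₀ v₀ | buildPod l M q o₁ v₁
  ... | inj₁ a | _ = inj₁ a
  ... | inj₂ _ | inj₁ a = inj₁ a
  ... | inj₂ p₀ | inj₂ p₁ = inj₂ (core-s (bush-conn b) p₀ p₁ C₀⊆ C₁⊆ e₀₁)

-- Heap indices of binary words: the children of node i are 2i+1 and 2i+2.

bit : Bool → ℕ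
bit false = 0
bit true = 1

heapIndex : List Bool → ℕ
heapIndex [] = 0
heapIndex (b ∷ w) = suc (bit b + (heapIndex w + heapIndex w))

half-bit : ∀ b i → ⌊ bit b + (i + i) /2⌋ ≡ i
half-bit false i = sym (ℕₚ.n≡⌊n+n/2⌋ i)
half-bit true i = sym (ℕₚ.n≡⌈n+n/2⌉ i)

bit-injective : ∀ b b' {i} → bit b + i ≡ bit b' + i → b ≡ b'
bit-injective false false p = refl
bit-injective true true p = refl
bit-injective false true p = ⊥-elim (ℕₚ.1+n≢n (sym p))
bit-injective true false p = ⊥-elim (ℕₚ.1+n≢n p)

heapIndex-injective : ∀ w w' → heapIndex w ≡ heapIndex w' → w ≡ w'
heapIndex-injective [] [] p = refl
heapIndex-injective (b ∷ w) (b' ∷ w') p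
  with heapIndex-injective w w' (trans (sym (half-bit b _)) (trans (cong ⌊_/2⌋ (ℕₚ.suc-injective p)) (half-bit b' _)))
... | refl = cong (_∷ w) (bit-injective b b' (ℕₚ.suc-injective p))

-- The number of binary words of length at most `N`, that is 2^(N+1) - 1.
heapSize : ℕ → ℕ
heapSize zero = 1
heapSize (suc N) = suc (heapSize N + heapSize N)

bit≤1 : ∀ b → bit b ≤ 1
bit≤1 false = z≤n
bit≤1 true = s≤s z≤n

heapIndex-bound : ∀ N w → length w ≤ N → heapIndex w < heapSize N
heapIndex-bound zero [] _ = s≤s z≤n
heapIndex-bound (suc N) [] _ = s≤s z≤n
heapIndex-bound (suc N) (b ∷ w) (s≤s p) = s≤s (ℕₚ.≤-trans (s≤s (ℕₚ.+-monoˡ-≤ (heapIndex w + heapIndex w) (bit≤1 b)))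
  (subst (_≤ heapSize N + heapSize N) (cong suc (ℕₚ.+-suc (heapIndex w) (heapIndex w))) (ℕₚ.+-mono-≤ q q)))
  where q = heapIndex-bound N w p

parity : ∀ m → ∃[ b ] m ≡ bit b + (⌊ m /2⌋ + ⌊ m /2⌋)
parity zero = false , refl
parity (suc zero) = true , refl
parity (suc (suc m)) with parity m
... | false , p = false , cong suc (trans (cong suc p) (sym (ℕₚ.+-suc ⌊ m /2⌋ ⌊ m /2⌋)))
... | true , p = true , cong suc (trans (cong suc p) (cong suc (sym (ℕₚ.+-suc ⌊ m /2⌋ ⌊ m /2⌋))))

heapIndex-surjective : ∀ N m → m < heapSize N → ∃[ w ] (length w ≤ N × heapIndex w ≡ m)
heapIndex-surjective N zero p = [] , z≤n , refl
heapIndex-surjective zero (suc m) (s≤s ())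
heapIndex-surjective (suc N) (suc m) (s≤s p) with parity m
... | b , eq with heapIndex-surjective N ⌊ m /2⌋ (ℕₚ.≰⇒> (λ le → ℕₚ.<⇒≱ p (ℕₚ.≤-trans (ℕₚ.+-mono-≤ le le)
                    (subst (⌊ m /2⌋ + ⌊ m /2⌋ ≤_) (sym eq) (ℕₚ.m≤n+m _ (bit b))))))
... | w , l , q = b ∷ w , s≤s l , cong suc (trans (cong (λ i → bit b + (i + i)) q) (sym eq))

-- The two sides are descendants of the two children of `w`. Cancelling the suffix `w` leaves words
-- with different last letters.
ʳ++-ends : ∀ (u v w : List Bool) → u ʳ++ (false ∷ w) ≡ v ʳ++ (true ∷ w) → ⊥
ʳ++-ends u v w p = case Listₚ.∷ʳ-injectiveʳ (reverse u) (reverse v)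
    (Listₚ.++-cancelʳ w (reverse u ∷ʳ false) (reverse v ∷ʳ true) (trans (back u false) (trans p (sym (back v true))))) of λ ()
  where
  back : ∀ u b → (reverse u ∷ʳ b) ++ w ≡ u ʳ++ (b ∷ w)
  back u b = trans (Listₚ.++-assoc (reverse u) [ b ] w) (sym (Listₚ.ʳ++-defn u))

-- From a heap labelling to a spanning bush

module FromLabelling {n} (E : Rel n) (E-sym : ∀ {x y} → E x y ≡ true → E y x ≡ true) (connected : Conn E full)
                     (N : ℕ) {φ : Labelling n} (tl : TreeLabelling E ⌊_/2⌋ (heapSize N) φ) where
  open Sym E E-sym
  open TreeLabelling tl

  private
    root-labelled : ∃[ x ] φ x ≡ just 0
    root-labelled = occurs (heapIndex-bound N [] z≤n)

  -- The vertices outside the model are absorbed first, so that the bush covers the whole graph.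
  open Absorbed (absorb full φ connected (λ _ → full⁺) conn (proj₂ root-labelled)) using (lab; ext; total; used) renaming (conn to lab-conn)

  blobAt : List Bool → VSet n
  blobAt w = fib lab (heapIndex w)

  -- Descendants extend a word at its front: `u ʳ++ w` is the node reached from `w` by the steps
  -- `u`.
  below : ℕ → List Bool → VSet n
  below zero w = blobAt w
  below (suc h) w = blobAt w ∪ below h (false ∷ w) ∪ below h (true ∷ w)

  below⁻ : ∀ h w {x} → x ∈ below h w → ∃[ u ] lab x ≡ just (heapIndex (u ʳ++ w))
  below⁻ zero w q = [] , fib⁻ q
  below⁻ (suc h) w q with ∪⁻ q
  ... | inj₂ r = case below⁻ h (true ∷ w) r of λ { (u , p) → true ∷ u , p }
  ... | inj₁ q' with ∪⁻ q'
  ... | inj₁ r = [] , fib⁻ r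
  ... | inj₂ r = case below⁻ h (false ∷ w) r of λ { (u , p) → false ∷ u , p }

  below⁺ : ∀ h w u {x} → length u ≤ h → lab x ≡ just (heapIndex (u ʳ++ w)) → x ∈ below h w
  below⁺ zero w [] p q = fib⁺ q
  below⁺ (suc h) w [] p q = ∪ˡ (∪ˡ (fib⁺ q))
  below⁺ (suc h) w (false ∷ u) (s≤s p) q = ∪ˡ (∪ʳ (below⁺ h (false ∷ w) u p q))
  below⁺ (suc h) w (true ∷ u) (s≤s p) q = ∪ʳ (below⁺ h (true ∷ w) u p q)

  same-word : ∀ {x w w'} → lab x ≡ just (heapIndex w) → lab x ≡ just (heapIndex w') → w ≡ w'
  same-word p q = heapIndex-injective _ _ (just-inj (trans (sym p) q))

  blob-below-disj : ∀ b h w → Disjoint (blobAt w) (below h (b ∷ w))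
  blob-below-disj b h w p q with below⁻ h (b ∷ w) q
  ... | u , r = ℕₚ.<⇒≢ (ℕₚ.≤-trans (s≤s (ℕₚ.m≤n+m (length w) (length u))) (ℕₚ.≤-reflexive (sym (ℕₚ.+-suc (length u) (length w)))))
    (trans (cong length (same-word {w = w} (fib⁻ p) r)) (Listₚ.length-ʳ++ u))

  below-disj : ∀ h w → Disjoint (below h (false ∷ w)) (below h (true ∷ w))
  below-disj h w p q with below⁻ h (false ∷ w) p | below⁻ h (true ∷ w) q
  ... | u , r | v , s = ʳ++-ends u v w (same-word r s)

  blob-edge : ∀ b w → suc (length w) ≤ N → Touch E (blobAt w) (blobAt (b ∷ w))
  blob-edge b w p with edge {bit b + (heapIndex w + heapIndex w)} (heapIndex-bound N (b ∷ w) p)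
  ... | x , y , px , py , e = y , x , fib⁺ (ext (trans py (cong just (half-bit b (heapIndex w))))) , fib⁺ (ext px) , E-sym e

  bush : ∀ h w → length w + h ≡ N → Bush E h (below h w) (blobAt w)
  bush h w eq with occurs (heapIndex-bound N w (subst (length w ≤_) eq (ℕₚ.m≤m+n (length w) h)))
  bush zero w eq | x , p = bleaf (λ p q → wmap fib⁺ (lab-conn (fib⁻ p) (fib⁻ q))) (fib⁺ (ext p))
  bush (suc h) w eq | x , p = bnode (λ p q → wmap fib⁺ (lab-conn (fib⁻ p) (fib⁻ q))) (fib⁺ (ext p))
      (∪ˡ ∘ ∪ˡ) (∪ˡ ∘ ∪ʳ) ∪ʳ (blob-below-disj false h w) (blob-below-disj true h w) (below-disj h w)
      (λ q → case ∪⁻ q of λ { (inj₂ r) → inj₂ (inj₂ r) ; (inj₁ r) → Sum.map₂ inj₁ (∪⁻ r) })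
      (blob-edge false w le) (blob-edge true w le) (bush h (false ∷ w) eq') (bush h (true ∷ w) eq')
    where
    eq' : suc (length w) + h ≡ N
    eq' = trans (sym (ℕₚ.+-suc (length w) h)) eq
    le : suc (length w) ≤ N
    le = subst (suc (length w) ≤_) eq' (ℕₚ.m≤m+n (suc (length w)) h)

  everything : ∀ {x} → x ∈ below N []
  everything {x} with total (full⁺ {x = x})
  ... | m , p with used p
  ... | y , q with heapIndex-surjective N m (range q)
  ... | w , l , refl = below⁺ N [] (reverse w) (subst (_≤ N) (sym (Listₚ.length-reverse w)) l)
          (trans p (cong (just ∘ heapIndex) (sym (Listₚ.reverse-involutive w))))

-- Two pairs of vertices between two terminals: series or parallel

Pair : ∀ {n} (p q a b : Fin n) → Set
Pair p q a b = (a ≡ p × b ≡ q) ⊎ (a ≡ q × b ≡ p)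

module Local {n} (E : Rel n) (E-sym : ∀ {x y} → E x y ≡ true → E y x ≡ true) (U : VSet n) (tc : TwoConn E U) where
  open Sym E E-sym
  open SymParts E E-sym
  open TwoConn tc

  Inner : (o w : Fin n) → VSet n → Set
  Inner o w S = ∀ {x} → x ∈ S → x ∈ U × x ≢ o × x ≢ w

  -- From `o` to `w` the order is `L`, first pod, `M`, second pod, `R`. The first pod has its rails
  -- at `a` and `b`, the second at `d` and `c`.
  record Series (o w a b c d : Fin n) : Set where
    field
      L M R : VSet n
      L⊆ : Inner o w L
      M⊆ : Inner o w M
      R⊆ : Inner o w R
      L∩M : Disjoint L M
      R∩M : Disjoint R M
      L∩R : Disjoint L R
      cL : Conn E L
      cM : Conn E M
      cR : Conn E R
      tL : Touch E L ⁅ o ⁆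
      tR : Touch E R ⁅ w ⁆
      a∈ : a ∈ L
      b∈ : b ∈ M
      c∈ : c ∈ R
      d∈ : d ∈ M

  -- `Z` is the tripod, joining `a`, `c` and a neighbour of `o` without containing `o`. The sets
  -- `R₀` and `R₁` may overlap, as both will end up in the same apex.
  record Parallel (o w a c b d : Fin n) : Set where
    field
      Z R₀ R₁ : VSet n
      Z⊆ : Inner o w Z
      R₀⊆ : Inner o w R₀
      R₁⊆ : Inner o w R₁
      Z∩R₀ : Disjoint Z R₀
      Z∩R₁ : Disjoint Z R₁
      cZ : Conn E Z
      cR₀ : Conn E R₀
      cR₁ : Conn E R₁
      tZ : Touch E Z ⁅ o ⁆
      tR₀ : Touch E R₀ ⁅ w ⁆
      tR₁ : Touch E R₁ ⁅ w ⁆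
      a∈ : a ∈ Z
      c∈ : c ∈ Z
      b∈ : b ∈ R₀
      d∈ : d ∈ R₁

  inner-swap : ∀ {o w S} → Inner w o S → Inner o w S
  inner-swap i q = case i q of λ { (u , x , y) → u , y , x }

  series-swap : ∀ {o w a b c d} → Series w o a b c d → Series o w c d a b
  series-swap s = record
    { L = R ; M = M ; R = L ; L⊆ = inner-swap R⊆ ; M⊆ = inner-swap M⊆ ; R⊆ = inner-swap L⊆ ; L∩M = R∩M ; R∩M = L∩M ; L∩R = disj-sym L∩R
    ; cL = cR ; cM = cM ; cR = cL ; tL = tR ; tR = tL ; a∈ = c∈ ; b∈ = d∈ ; c∈ = a∈ ; d∈ = b∈ }
    where open Series s

  data Shape (o w p q r s : Fin n) : Set where
    series₁   : ∀ {a b c d} → Pair p q a b → Pair r s c d → Series o w a b c d → Shape o w p q r s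
    series₂   : ∀ {a b c d} → Pair p q a b → Pair r s c d → Series o w c d a b → Shape o w p q r s
    parallel₁ : ∀ {a b c d} → Pair p q a b → Pair r s c d → Parallel o w a c b d → Shape o w p q r s
    parallel₂ : ∀ {a b c d} → Pair p q a b → Pair r s c d → Parallel w o a c b d → Shape o w p q r s

  shape-swap : ∀ {o w p q r s} → Shape w o p q r s → Shape o w p q r s
  shape-swap (series₁ x y z) = series₂ x y (series-swap z)
  shape-swap (series₂ x y z) = series₁ x y (series-swap z)
  shape-swap (parallel₁ x y z) = parallel₂ x y z
  shape-swap (parallel₂ x y z) = parallel₁ x y z

  shape-map : ∀ {o w p q r s p' q' r' s'} → (∀ {a b} → Pair p' q' a b → Pair p q a b) → (∀ {a b} → Pair r' s' a b → Pair r s a b) →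
    Shape o w p' q' r' s' → Shape o w p q r s
  shape-map f g (series₁ x y z) = series₁ (f x) (g y) z
  shape-map f g (series₂ x y z) = series₂ (f x) (g y) z
  shape-map f g (parallel₁ x y z) = parallel₁ (f x) (g y) z
  shape-map f g (parallel₂ x y z) = parallel₂ (f x) (g y) z

  record Branch (P : VSet n) (o a : Fin n) : Set where
    field
      set    : VSet n
      start  : a ∈ set
      inside : ∀ {x} → x ∈ set → x ∈ P × x ≢ o
      conn   : Conn E set
      touch  : Touch E set ⁅ o ⁆
      closed : ∀ {x y} → x ∈ set → y ∈ P → y ≢ o → E x y ≡ true → y ∈ set

  branch : ∀ {P o a} → Conn E P → o ∈ P → a ∈ P → a ≢ o → Branch P o a
  branch {P} {o} {a} cP oP aP ne = record
    { set = K.set ; start = K.start ; conn = K.conn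
    ; inside = λ q → proj₁ (∖⁻ (K.inside q)) , λ { refl → proj₂ (∖⁻ (K.inside q)) ⁅⁆⁺ }
    ; touch = tch ; closed = λ x y z e → K.closed x (∖⁺ y (λ q → z (⁅⁆⁻ q))) e }
    where
    module K = Component (component (P ∖ ⁅ o ⁆) (∖⁺ aP (λ q → ne (⁅⁆⁻ q))))
    tch : Touch E K.set ⁅ o ⁆
    tch with crossing K.set (cP aP oP) K.start (λ q → proj₂ (∖⁻ (K.inside q)) ⁅⁆⁺)
    ... | x , y , xK , yK , xP , yP , e = x , y , xK , decidable-stable (y ∈? ⁅ o ⁆) (λ ny → yK (K.closed xK (∖⁺ yP ny) e)) , e

  branch-disj : ∀ {P o a b} (A : Branch P o a) (B : Branch P o b) → b ∉ Branch.set A → Disjoint (Branch.set A) (Branch.set B)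
  branch-disj A B nb xA xB with crossing (Branch.set A) (Branch.conn B xB (Branch.start B)) xA nb
  ... | y , z , yA , zA , yB , zB , e = zA (Branch.closed A yA (proj₁ (Branch.inside B zB)) (proj₂ (Branch.inside B zB)) e)

  -- A pair of disjoint connected sets separating both rails; either one side stays connected
  -- without its terminal, or a link between the four branches rearranges them.
  module Crossed {o w a b c d : Fin n} (o≢w : o ≢ w) (cI : Conn E (U ∖ ⁅ o ⁆ ∖ ⁅ w ⁆))
                 {P S : VSet n} (P⊆ : P ⊆ U) (S⊆ : S ⊆ U) (P∩S : Disjoint P S) (cP : Conn E P) (cS : Conn E S)
                 (oP : o ∈ P) (aP : a ∈ P) (cP∈ : c ∈ P) (wS : w ∈ S) (bS : b ∈ S) (dS : d ∈ S)
                 (a≢o : a ≢ o) (c≢o : c ≢ o) (b≢w : b ≢ w) (d≢w : d ≢ w) where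

    private
      A C B D : VSet n
      A* : Branch P o a
      A* = branch cP oP aP a≢o
      C* : Branch P o c
      C* = branch cP oP cP∈ c≢o
      B* : Branch S w b
      B* = branch cS wS bS b≢w
      D* : Branch S w d
      D* = branch cS wS dS d≢w
      A = Branch.set A*
      C = Branch.set C*
      B = Branch.set B*
      D = Branch.set D*

      I : VSet n
      I = U ∖ ⁅ o ⁆ ∖ ⁅ w ⁆

      I⁻ : Inner o w I
      I⁻ q = proj₁ (∖⁻ (proj₁ (∖⁻ q))) , (λ { refl → proj₂ (∖⁻ (proj₁ (∖⁻ q))) ⁅⁆⁺ }) , (λ { refl → proj₂ (∖⁻ q) ⁅⁆⁺ })

      inP : ∀ {a} (K : Branch P o a) → Inner o w (Branch.set K)
      inP K q = P⊆ (proj₁ (Branch.inside K q)) , proj₂ (Branch.inside K q) , λ { refl → P∩S (proj₁ (Branch.inside K q)) wS }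

      inS : ∀ {a} (K : Branch S w a) → Inner o w (Branch.set K)
      inS K q = S⊆ (proj₁ (Branch.inside K q)) , (λ { refl → P∩S oP (proj₁ (Branch.inside K q)) }) , proj₂ (Branch.inside K q)

      I⁺ : ∀ {S} → Inner o w S → S ⊆ I
      I⁺ f q = case f q of λ { (u , x , y) → ∖⁺ (∖⁺ u (λ r → x (⁅⁆⁻ r))) (λ r → y (⁅⁆⁻ r)) }

      PS : ∀ {a b} (K : Branch P o a) (L : Branch S w b) → Disjoint (Branch.set K) (Branch.set L)
      PS K L p q = P∩S (proj₁ (Branch.inside K p)) (proj₁ (Branch.inside L q))

    shape : Shape o w a b c d
    shape with c ∈? A | d ∈? B
    ... | yes cA | _ = parallel₁ (inj₁ (refl , refl)) (inj₁ (refl , refl)) record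
      { Z = A ; R₀ = B ; R₁ = D ; Z⊆ = inP A* ; R₀⊆ = inS B* ; R₁⊆ = inS D* ; Z∩R₀ = PS A* B* ; Z∩R₁ = PS A* D*
      ; cZ = Branch.conn A* ; cR₀ = Branch.conn B* ; cR₁ = Branch.conn D*
      ; tZ = Branch.touch A* ; tR₀ = Branch.touch B* ; tR₁ = Branch.touch D*
      ; a∈ = Branch.start A* ; c∈ = cA ; b∈ = Branch.start B* ; d∈ = Branch.start D* }
    ... | no _ | yes dB = parallel₂ (inj₂ (refl , refl)) (inj₂ (refl , refl)) record
      { Z = B ; R₀ = A ; R₁ = C ; Z⊆ = inner-swap (inS B*) ; R₀⊆ = inner-swap (inP A*) ; R₁⊆ = inner-swap (inP C*) ; Z∩R₀ = disj-sym (PS A* B*) ; Z∩R₁ = disj-sym (PS C* B*)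
      ; cZ = Branch.conn B* ; cR₀ = Branch.conn A* ; cR₁ = Branch.conn C*
      ; tZ = Branch.touch B* ; tR₀ = Branch.touch A* ; tR₁ = Branch.touch C*
      ; a∈ = Branch.start B* ; c∈ = dB ; b∈ = Branch.start A* ; d∈ = Branch.start C* }
    ... | no cA | no dB = result
      where
      F : Fin 4 → VSet n
      F zero = A
      F (suc zero) = C
      F (suc (suc zero)) = B
      F (suc (suc (suc zero))) = D
      AC : Disjoint A C
      AC = branch-disj A* C* cA
      BD : Disjoint B D
      BD = branch-disj B* D* dB
      F-disj : ∀ {i j x} → x ∈ F i → x ∈ F j → i ≡ j
      F-disj {zero} {zero} p q = refl
      F-disj {zero} {suc zero} p q = ⊥-elim (AC p q)
      F-disj {zero} {suc (suc zero)} p q = ⊥-elim (PS A* B* p q)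
      F-disj {zero} {suc (suc (suc zero))} p q = ⊥-elim (PS A* D* p q)
      F-disj {suc zero} {zero} p q = ⊥-elim (AC q p)
      F-disj {suc zero} {suc zero} p q = refl
      F-disj {suc zero} {suc (suc zero)} p q = ⊥-elim (PS C* B* p q)
      F-disj {suc zero} {suc (suc (suc zero))} p q = ⊥-elim (PS C* D* p q)
      F-disj {suc (suc zero)} {zero} p q = ⊥-elim (PS A* B* q p)
      F-disj {suc (suc zero)} {suc zero} p q = ⊥-elim (PS C* B* q p)
      F-disj {suc (suc zero)} {suc (suc zero)} p q = refl
      F-disj {suc (suc zero)} {suc (suc (suc zero))} p q = ⊥-elim (BD p q)
      F-disj {suc (suc (suc zero))} {zero} p q = ⊥-elim (PS A* D* q p)
      F-disj {suc (suc (suc zero))} {suc zero} p q = ⊥-elim (PS C* D* q p)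
      F-disj {suc (suc (suc zero))} {suc (suc zero)} p q = ⊥-elim (BD q p)
      F-disj {suc (suc (suc zero))} {suc (suc (suc zero))} p q = refl
      F-in : ∀ i → F i ⊆ I
      F-in zero = I⁺ (inP A*)
      F-in (suc zero) = I⁺ (inP C*)
      F-in (suc (suc zero)) = I⁺ (inS B*)
      F-in (suc (suc (suc zero))) = I⁺ (inS D*)
      F-conn : ∀ i → Conn E (F i)
      F-conn zero = Branch.conn A*
      F-conn (suc zero) = Branch.conn C*
      F-conn (suc (suc zero)) = Branch.conn B*
      F-conn (suc (suc (suc zero))) = Branch.conn D*
      open Parts (absorbSets {U = I} {S = F} cI F-disj F-in F-conn {i = zero} (Branch.start A*)) renaming (conn to pconn)
      A' C' B' D' : VSet n
      A' = part zero
      C' = part (suc zero)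
      B' = part (suc (suc zero))
      D' = part (suc (suc (suc zero)))
      aA : a ∈ A'
      aA = ext zero (Branch.start A*)
      cC : c ∈ C'
      cC = ext (suc zero) (Branch.start C*)
      bB : b ∈ B'
      bB = ext (suc (suc zero)) (Branch.start B*)
      dD : d ∈ D'
      dD = ext (suc (suc (suc zero))) (Branch.start D*)
      tA : Touch E A' ⁅ o ⁆
      tA = touch-mono (ext zero) id (Branch.touch A*)
      tC : Touch E C' ⁅ o ⁆
      tC = touch-mono (ext (suc zero)) id (Branch.touch C*)
      tB : Touch E B' ⁅ w ⁆
      tB = touch-mono (ext (suc (suc zero))) id (Branch.touch B*)
      tD : Touch E D' ⁅ w ⁆
      tD = touch-mono (ext (suc (suc (suc zero)))) id (Branch.touch D*)
      inn : ∀ i → Inner o w (part i)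
      inn i q = I⁻ (inside i q)
      ne : ∀ {i j} → i ≢ j → Disjoint (part i) (part j)
      ne i≢j p q = i≢j (disj p q)
      inn∪ : ∀ i j → Inner o w (part i ∪ part j)
      inn∪ i j q = Sum.[ inn i , inn j ] (∪⁻ q)
      linkAC : Touch E A' C' → Shape o w a b c d
      linkAC t = parallel₁ (inj₁ (refl , refl)) (inj₁ (refl , refl)) record
        { Z = A' ∪ C' ; R₀ = B' ; R₁ = D' ; Z⊆ = inn∪ _ _ ; R₀⊆ = inn _ ; R₁⊆ = inn _
        ; Z∩R₀ = ∪-disj (ne (λ ())) (ne (λ ())) ; Z∩R₁ = ∪-disj (ne (λ ())) (ne (λ ()))
        ; cZ = conn-∪ (pconn _) (pconn _) t ; cR₀ = pconn _ ; cR₁ = pconn _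
        ; tZ = touch-mono ∪ˡ id tA ; tR₀ = tB ; tR₁ = tD ; a∈ = ∪ˡ aA ; c∈ = ∪ʳ cC ; b∈ = bB ; d∈ = dD }
      linkBD : Touch E B' D' → Shape o w a b c d
      linkBD t = parallel₂ (inj₂ (refl , refl)) (inj₂ (refl , refl)) record
        { Z = B' ∪ D' ; R₀ = A' ; R₁ = C' ; Z⊆ = inner-swap (inn∪ _ _) ; R₀⊆ = inner-swap (inn _) ; R₁⊆ = inner-swap (inn _)
        ; Z∩R₀ = ∪-disj (disj-sym (ne (λ ()))) (disj-sym (ne (λ ()))) ; Z∩R₁ = ∪-disj (disj-sym (ne (λ ()))) (disj-sym (ne (λ ())))
        ; cZ = conn-∪ (pconn _) (pconn _) t ; cR₀ = pconn _ ; cR₁ = pconn _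
        ; tZ = touch-mono ∪ˡ id tB ; tR₀ = tA ; tR₁ = tC ; a∈ = ∪ˡ bB ; c∈ = ∪ʳ dD ; b∈ = aA ; d∈ = cC }
      linkAD : Touch E A' D' → Shape o w a b c d
      linkAD t = series₂ (inj₂ (refl , refl)) (inj₁ (refl , refl)) record
        { L = C' ; M = A' ∪ D' ; R = B' ; L⊆ = inn _ ; M⊆ = inn∪ _ _ ; R⊆ = inn _
        ; L∩M = disj-sym (∪-disj (ne (λ ())) (disj-sym (ne (λ ())))) ; R∩M = disj-sym (∪-disj (ne (λ ())) (disj-sym (ne (λ ())))) ; L∩R = ne (λ ())
        ; cL = pconn _ ; cM = conn-∪ (pconn _) (pconn _) t ; cR = pconn _
        ; tL = tC ; tR = tB ; a∈ = cC ; b∈ = ∪ʳ dD ; c∈ = bB ; d∈ = ∪ˡ aA }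
      linkBC : Touch E B' C' → Shape o w a b c d
      linkBC t = series₁ (inj₁ (refl , refl)) (inj₂ (refl , refl)) record
        { L = A' ; M = B' ∪ C' ; R = D' ; L⊆ = inn _ ; M⊆ = inn∪ _ _ ; R⊆ = inn _
        ; L∩M = disj-sym (∪-disj (disj-sym (ne (λ ()))) (disj-sym (ne (λ ())))) ; R∩M = disj-sym (∪-disj (ne (λ ())) (ne (λ ()))) ; L∩R = ne (λ ())
        ; cL = pconn _ ; cM = conn-∪ (pconn _) (pconn _) t ; cR = pconn _
        ; tL = tA ; tR = tD ; a∈ = aA ; b∈ = ∪ˡ bB ; c∈ = dD ; d∈ = ∪ʳ cC }
      result : Shape o w a b c d
      -- The first pair joins `A'` to `B'`, the second `C'` to `D'`, and some edge leads from one
      -- couple to the other. Between two parts at the same terminal it makes a tripod; between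
      -- parts at different terminals it makes the middle of a series.
      result with crossing (A' ∪ B') (cI (inside _ aA) (inside _ cC)) (∪ˡ aA)
                    (λ q → Sum.[ (λ p → ne (λ ()) p cC) , (λ p → ne (λ ()) cC p) ] (∪⁻ q))
      ... | x , y , x∈ , y∉ , _ , yI , e with ∪⁻ x∈ | cover yI
      ... | _ | zero , q = ⊥-elim (y∉ (∪ˡ q))
      ... | _ | suc (suc zero) , q = ⊥-elim (y∉ (∪ʳ q))
      ... | inj₁ p | suc zero , q = linkAC (x , y , p , q , e)
      ... | inj₁ p | suc (suc (suc zero)) , q = linkAD (x , y , p , q , e)
      ... | inj₂ p | suc zero , q = linkBC (x , y , p , q , e)
      ... | inj₂ p | suc (suc (suc zero)) , q = linkBD (x , y , p , q , e)

  record Separated (o w a b : Fin n) : Set where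
    field
      P S  : VSet n
      P⊆   : P ⊆ U
      S⊆   : S ⊆ U
      cov  : ∀ {x} → x ∈ U → x ∈ P ⊎ x ∈ S
      P∩S  : Disjoint P S
      cP   : Conn E P
      cS   : Conn E S
      oP   : o ∈ P
      aP   : a ∈ P
      wS   : w ∈ S
      bS   : b ∈ S

  separated-swap : ∀ {o w a b} → Separated o w a b → Separated w o b a
  separated-swap s = record { P = S ; S = P ; P⊆ = S⊆ ; S⊆ = P⊆ ; cov = λ u → Sum.swap (cov u) ; P∩S = disj-sym P∩S
                            ; cP = cS ; cS = cP ; oP = wS ; aP = bS ; wS = oP ; bS = aP }
    where open Separated s

  record Terminals (o w p q r s : Fin n) : Set where
    field
      o∈ : o ∈ U
      w∈ : w ∈ U
      o≢w : o ≢ w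
      p✓ : p ∈ U × p ≢ o × p ≢ w
      q✓ : q ∈ U × q ≢ o × q ≢ w
      r✓ : r ∈ U × r ≢ o × r ≢ w
      s✓ : s ∈ U × s ≢ o × s ≢ w
      p≢q : p ≢ q
      r≢s : r ≢ s
      inner : Conn E (U ∖ ⁅ o ⁆ ∖ ⁅ w ⁆)

  terminals-flip₁ : ∀ {o w p q r s} → Terminals o w p q r s → Terminals o w q p r s
  terminals-flip₁ t = record { Terminals t hiding (p✓; q✓; p≢q) ; p✓ = q✓ ; q✓ = p✓ ; p≢q = p≢q ∘ sym }
    where open Terminals t

  terminals-flip₂ : ∀ {o w p q r s} → Terminals o w p q r s → Terminals o w p q s r
  terminals-flip₂ t = record { Terminals t hiding (r✓; s✓; r≢s) ; r✓ = s✓ ; s✓ = r✓ ; r≢s = r≢s ∘ sym }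
    where open Terminals t

  terminals-swap : ∀ {o w p q r s} → Terminals o w p q r s → Terminals w o q p r s
  terminals-swap t = terminals-flip₁ (record
    { o∈ = w∈ ; w∈ = o∈ ; o≢w = o≢w ∘ sym ; p✓ = flip p✓ ; q✓ = flip q✓ ; r✓ = flip r✓ ; s✓ = flip s✓ ; p≢q = p≢q ; r≢s = r≢s
    ; inner = conn-ext reorder reorder inner })
    where
    open Terminals t
    flip : ∀ {x y z} → x ∈ U × x ≢ y × x ≢ z → x ∈ U × x ≢ z × x ≢ y
    flip (u , y , z) = u , z , y
    reorder : ∀ {x y} → U ∖ ⁅ x ⁆ ∖ ⁅ y ⁆ ⊆ U ∖ ⁅ y ⁆ ∖ ⁅ x ⁆
    reorder z = ∖⁺ (∖⁺ (proj₁ (∖⁻ (proj₁ (∖⁻ z)))) (proj₂ (∖⁻ z))) (proj₂ (∖⁻ (proj₁ (∖⁻ z))))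

  both-crossed : ∀ {o w p q r s} → Terminals o w p q r s → (sp : Separated o w p q) → r ∈ Separated.P sp → s ∈ Separated.S sp → Shape o w p q r s
  both-crossed t sp rP sS = Crossed.shape o≢w inner P⊆ S⊆ P∩S cP cS oP aP rP wS bS sS (proj₁ (proj₂ p✓)) (proj₁ (proj₂ r✓)) (proj₂ (proj₂ q✓)) (proj₂ (proj₂ s✓))
    where
    open Separated sp
    open Terminals t

  -- If `p` lies in `X`, moving `Y` over to `S` separates both pairs in the same way, which is the
  -- crossed case. If `p` lies in `Y`, the order `X`, pair `r s`, `Y`, pair `p q`, `S` is already a
  -- series.
  one-side : ∀ {o w p q r s} → Terminals o w p q r s → (sp : Separated o w p q) → ∀ {X Y} →
    X ⊆ Separated.P sp → Y ⊆ Separated.P sp → (∀ {z} → z ∈ Separated.P sp → z ∈ X ⊎ z ∈ Y) → Disjoint X Y → Conn E X → Conn E Y →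
    Touch E Y (Separated.S sp) → o ∈ X → r ∈ X → s ∈ Y → Shape o w p q r s
  one-side {o} {w} {p} {q} {r} {s} t sp {X} {Y} X⊆ Y⊆ covP X∩Y cX cY tY oX rX sY with covP (Separated.aP sp)
  ... | inj₁ pX = both-crossed t (record
    { P = X ; S = Y ∪ S ; P⊆ = P⊆ ∘ X⊆ ; S⊆ = ∪-elim (P⊆ ∘ Y⊆) S⊆
    ; cov = λ u → case cov u of λ { (inj₂ y) → inj₂ (∪ʳ y) ; (inj₁ x) → Sum.map₂ ∪ˡ (covP x) }
    ; P∩S = disj-sym (∪-disj (disj-sym X∩Y) (λ y x → P∩S (X⊆ x) y)) ; cP = cX ; cS = conn-∪ cY cS tY
    ; oP = oX ; aP = pX ; wS = ∪ʳ wS ; bS = ∪ʳ bS }) rX (∪ˡ sY)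
    where open Separated sp
  ... | inj₂ pY = series₂ (inj₂ (refl , refl)) (inj₁ (refl , refl)) (record
    { L = L.set ; M = Y ; R = R.set
    ; L⊆ = λ z → P⊆ (X⊆ (proj₁ (L.inside z))) , proj₂ (L.inside z) , λ { refl → P∩S (X⊆ (proj₁ (L.inside z))) wS }
    ; M⊆ = λ z → P⊆ (Y⊆ z) , (λ { refl → X∩Y oX z }) , λ { refl → P∩S (Y⊆ z) wS }
    ; R⊆ = λ z → S⊆ (proj₁ (R.inside z)) , (λ { refl → P∩S oP (proj₁ (R.inside z)) }) , proj₂ (R.inside z)
    ; L∩M = λ x y → X∩Y (proj₁ (L.inside x)) y ; R∩M = λ x y → P∩S (Y⊆ y) (proj₁ (R.inside x))
    ; L∩R = λ x y → P∩S (X⊆ (proj₁ (L.inside x))) (proj₁ (R.inside y))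
    ; cL = L.conn ; cM = cY ; cR = R.conn ; tL = L.touch ; tR = R.touch
    ; a∈ = L.start ; b∈ = sY ; c∈ = R.start ; d∈ = pY })
    where
    open Separated sp
    open Terminals t
    module L = Branch (branch cX oX rX (proj₁ (proj₂ r✓)))
    module R = Branch (branch cS wS bS (proj₂ (proj₂ q✓)))

  -- By 2-connectivity, `P` splits at `r` and `s` into two connected parts that both touch `S`. The
  -- part containing `o` takes the role of `X` in `one-side`.
  same-side : ∀ {o w p q r s} → Terminals o w p q r s → (sp : Separated o w p q) → r ∈ Separated.P sp → s ∈ Separated.P sp → Shape o w p q r s
  same-side {o} {w} {p} {q} {r} {s} t sp rP sP = go (K.cover oP)
    where
    open Separated sp
    open Terminals t
    module K = Split (split {z = w} tc P⊆ cP w∈ (λ z → P∩S z wS) rP sP r≢s)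
    toS : U ∖ P ⊆ S
    toS z = case cov (proj₁ (∖⁻ z)) of λ { (inj₁ x) → ⊥-elim (proj₂ (∖⁻ z) x) ; (inj₂ y) → y }
    go : o ∈ K.X ⊎ o ∈ K.Y → Shape o w p q r s
    go (inj₁ oX) = one-side t sp K.X⊆ K.Y⊆ K.cover K.disj K.cX K.cY (touch-mono id toS K.tY) oX K.x∈ K.y∈
    go (inj₂ oY) = shape-map id Sum.swap (one-side (terminals-flip₂ t) sp K.Y⊆ K.X⊆ (λ z → Sum.swap (K.cover z)) (disj-sym K.disj) K.cY K.cX
                     (touch-mono id toS K.tX) oY K.y∈ K.x∈)

  with-separation : ∀ {o w p q r s} → Terminals o w p q r s → Separated o w p q → Shape o w p q r s
  with-separation t sp with Separated.cov sp (proj₁ (Terminals.r✓ t)) | Separated.cov sp (proj₁ (Terminals.s✓ t))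
  ... | inj₁ r | inj₁ s = same-side t sp r s
  ... | inj₁ r | inj₂ s = both-crossed t sp r s
  ... | inj₂ r | inj₁ s = shape-map id Sum.swap (both-crossed (terminals-flip₂ t) sp s r)
  ... | inj₂ r | inj₂ s = shape-map Sum.swap id (shape-swap (same-side (terminals-swap t) (separated-swap sp) r s))

  walk-in : ∀ {v x y} → Walk E (_≢ v) x y → x ∈ U → Walk E (_∈ (U ∖ ⁅ v ⁆)) x y
  walk-in (wstop p) u = wstop (∖⁺ u (λ q → p (⁅⁆⁻ q)))
  walk-in (wstep p e k) u = wstep (∖⁺ u (λ q → p (⁅⁆⁻ q))) e (walk-in k (supp e))

  -- Delete `o` and split the rest at `p` and `q` into two parts touching `o`. Returning `o` to the
  -- part without `w` separates the terminals together with the ends of the first pair.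
  shapes : ∀ {o w p q r s} → Terminals o w p q r s → Shape o w p q r s
  shapes {o} {w} {p} {q} {r} {s} t = go (K.cover (∖⁺ w∈ (λ z → o≢w (sym (⁅⁆⁻ z)))))
    where
    open Terminals t
    Q : VSet n
    Q = U ∖ ⁅ o ⁆
    cQ : Conn E Q
    cQ x y = walk-in (link o (proj₁ (∖⁻ x)) (proj₁ (∖⁻ y)) (λ { refl → proj₂ (∖⁻ x) ⁅⁆⁺ }) (λ { refl → proj₂ (∖⁻ y) ⁅⁆⁺ })) (proj₁ (∖⁻ x))
    module K = Split (split tc (λ z → proj₁ (∖⁻ z)) cQ o∈ (λ z → proj₂ (∖⁻ z) ⁅⁆⁺) (∖⁺ (proj₁ p✓) (λ z → proj₁ (proj₂ p✓) (⁅⁆⁻ z))) (∖⁺ (proj₁ q✓) (λ z → proj₁ (proj₂ q✓) (⁅⁆⁻ z))) p≢q)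
    toO : U ∖ Q ⊆ ⁅ o ⁆
    toO {x} z = decidable-stable (x ∈? ⁅ o ⁆) (λ nx → proj₂ (∖⁻ z) (∖⁺ (proj₁ (∖⁻ z)) nx))
    sep : ∀ {X Y a b} → X ⊆ Q → Y ⊆ Q → (∀ {z} → z ∈ Q → z ∈ X ⊎ z ∈ Y) → Disjoint X Y → Conn E X → Conn E Y → Touch E X (U ∖ Q) →
      a ∈ X → b ∈ Y → w ∈ Y → Separated o w a b
    sep {X} {Y} X⊆ Y⊆ cv dj cX cY tX aX bY wY = record
      { P = X ∪ ⁅ o ⁆ ; S = Y ; P⊆ = ∪-elim (λ z → proj₁ (∖⁻ (X⊆ z))) (λ z → subst (_∈ U) (sym (⁅⁆⁻ z)) o∈) ; S⊆ = λ z → proj₁ (∖⁻ (Y⊆ z))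
      ; cov = λ {x} u → case x ∈? ⁅ o ⁆ of λ { (yes z) → inj₁ (∪ʳ z) ; (no nz) → Sum.map₁ ∪ˡ (cv (∖⁺ u nz)) }
      ; P∩S = ∪-disj dj (λ z y → proj₂ (∖⁻ (Y⊆ y)) z) ; cP = conn-∪ cX conn-single (touch-mono id toO tX) ; cS = cY
      ; oP = ∪ʳ ⁅⁆⁺ ; aP = ∪ˡ aX ; wS = wY ; bS = bY }
    go : w ∈ K.X ⊎ w ∈ K.Y → Shape o w p q r s
    go (inj₂ wY) = with-separation t (sep K.X⊆ K.Y⊆ K.cover K.disj K.cX K.cY K.tX K.x∈ K.y∈ wY)
    go (inj₁ wX) = shape-map Sum.swap id (with-separation (terminals-flip₁ t)
      (sep K.Y⊆ K.X⊆ (λ z → Sum.swap (K.cover z)) (disj-sym K.disj) K.cY K.cX K.tY K.y∈ K.x∈ wX))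

-- One step inside a core, by way of a quotient graph

record State {n} (E : Rel n) (C O W : VSet n) : Set where
  field
    O∩C : Disjoint O C
    W∩C : Disjoint W C
    O∩W : Disjoint O W
    cO  : Conn E O
    cW  : Conn E W
    tOW : Touch E O W
    tOC : Touch E O C
    tWC : Touch E W C
    closed : ∀ {a b} → a ∈ C → E a b ≡ true → b ∈ C ⊎ b ∈ O ⊎ b ∈ W

record SeriesStep {n} (E : Rel n) (C O W C₀ C₁ : VSet n) : Set where
  field
    L M R : VSet n
    L⊆ : L ⊆ C
    M⊆ : M ⊆ C
    R⊆ : R ⊆ C
    L∩M : Disjoint L M
    R∩M : Disjoint R M
    L∩R : Disjoint L R
    L∩C₁ : Disjoint L C₁
    R∩C₀ : Disjoint R C₀
    cM : Conn E M
    tL : Touch E L O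
    tR : Touch E R W
    st₀ : State E C₀ L M
    st₁ : State E C₁ R M

record ParallelStep {n} (E : Rel n) (C O W C₀ C₁ : VSet n) : Set where
  field
    Z R₀ R₁ : VSet n
    Z⊆ : Z ⊆ C
    R₀⊆ : R₀ ⊆ C
    R₁⊆ : R₁ ⊆ C
    Z∩R₀ : Disjoint Z R₀
    Z∩R₁ : Disjoint Z R₁
    R₀∩C₁ : Disjoint R₀ C₁
    R₁∩C₀ : Disjoint R₁ C₀
    tZ : Touch E Z O
    tR₀ : Touch E R₀ W
    tR₁ : Touch E R₁ W
    st₀ : State E C₀ Z R₀
    st₁ : State E C₁ Z R₁

data Step {n} (E : Rel n) (C O W C₀ C₁ : VSet n) : Set where
  series₁   : SeriesStep E C O W C₀ C₁ → Step E C O W C₀ C₁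
  series₂   : SeriesStep E C O W C₁ C₀ → Step E C O W C₀ C₁
  parallel₁ : ParallelStep E C O W C₀ C₁ → Step E C O W C₀ C₁
  parallel₂ : ParallelStep E C W O C₀ C₁ → Step E C O W C₀ C₁

pattern qo = zero
pattern qw = suc zero
pattern q0 = suc (suc zero)
pattern q1 = suc (suc (suc zero))
pattern q2 = suc (suc (suc (suc zero)))
pattern q3 = suc (suc (suc (suc (suc zero))))
pattern qs v = suc (suc (suc (suc (suc (suc v)))))

-- The graph obtained by contracting O, W and the four rails to single vertices and discarding the two inner cores.
module Quotient {n} (E : Rel n) (E-sym : ∀ {x y} → E x y ≡ true → E y x ≡ true) (tc : TwoConn E full)
                {h : ℕ} {C O W E₀ E₁ : VSet n} (st : State E C O W) (cC : Conn E C)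
                (pod₀ : Pod E h E₀) (pod₁ : Pod E h E₁) (E₀⊆ : E₀ ⊆ C) (E₁⊆ : E₁ ⊆ C) (E₀∩E₁ : Disjoint E₀ E₁) where
  open Sym E E-sym
  open State st
  module P₀ = Pod pod₀
  module P₁ = Pod pod₁

  blob : Fin (6 + n) → VSet n
  blob qo = O
  blob qw = W
  blob q0 = P₀.X
  blob q1 = P₀.Y
  blob q2 = P₁.X
  blob q3 = P₁.Y
  -- Empty unless `v` lies in `C` outside both pods; `U` retains only the inhabited classes.
  blob (qs v) = ⁅ v ⁆ ∩ (C ∖ E₀ ∖ E₁)

  -- Walks of the original graph are to be pushed to the quotient, so every vertex needs a class,
  -- the discarded ones included: an inner core joins its rail `X`, and everything outside both `C`
  -- and `W` joins `O`.
  data View (z : Fin n) : Fin (6 + n) → Set where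
    vo : z ∉ C → z ∉ W → View z qo
    vw : z ∉ C → z ∈ W → View z qw
    v0 : z ∈ E₀ → z ∉ P₀.Y → View z q0
    v1 : z ∈ E₀ → z ∈ P₀.Y → View z q1
    v2 : z ∉ E₀ → z ∈ E₁ → z ∉ P₁.Y → View z q2
    v3 : z ∉ E₀ → z ∈ E₁ → z ∈ P₁.Y → View z q3
    vs : z ∈ C → z ∉ E₀ → z ∉ E₁ → View z (qs z)

  viewed : ∀ z → ∃[ i ] View z i
  viewed z with z ∈? C | z ∈? W | z ∈? E₀ | z ∈? P₀.Y | z ∈? E₁ | z ∈? P₁.Y
  ... | no c | no w | _ | _ | _ | _ = _ , vo c w
  ... | no c | yes w | _ | _ | _ | _ = _ , vw c w
  ... | yes c | _ | yes e | no y | _ | _ = _ , v0 e y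
  ... | yes c | _ | yes e | yes y | _ | _ = _ , v1 e y
  ... | yes c | _ | no e | _ | yes f | no y = _ , v2 e f y
  ... | yes c | _ | no e | _ | yes f | yes y = _ , v3 e f y
  ... | yes c | _ | no e | _ | no f | _ = _ , vs c e f

  opaque
    pick : VSet n → Fin n → Fin (6 + n) → Fin (6 + n) → Fin (6 + n)
    pick S z i j with z ∈? S
    ... | yes _ = i
    ... | no _ = j

    pick⁺ : ∀ {S z i j} → z ∈ S → pick S z i j ≡ i
    pick⁺ {S} {z} p with z ∈? S
    ... | yes _ = refl
    ... | no np = ⊥-elim (np p)

    pick⁻ : ∀ {S z i j} → z ∉ S → pick S z i j ≡ j
    pick⁻ {S} {z} np with z ∈? S
    ... | yes p = ⊥-elim (np p)
    ... | no _ = refl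

    g : Fin n → Fin (6 + n)
    g z = pick C z (pick E₀ z (pick P₀.Y z q1 q0) (pick E₁ z (pick P₁.Y z q3 q2) (qs z))) (pick W z qw qo)

    g-view : ∀ {z i} → View z i → g z ≡ i
    g-view (vo c w) = trans (pick⁻ c) (pick⁻ w)
    g-view (vw c w) = trans (pick⁻ c) (pick⁺ w)
    g-view (v0 e y) = trans (pick⁺ (E₀⊆ e)) (trans (pick⁺ e) (pick⁻ y))
    g-view (v1 e y) = trans (pick⁺ (E₀⊆ e)) (trans (pick⁺ e) (pick⁺ y))
    g-view (v2 e f y) = trans (pick⁺ (E₁⊆ f)) (trans (pick⁻ e) (trans (pick⁺ f) (pick⁻ y)))
    g-view (v3 e f y) = trans (pick⁺ (E₁⊆ f)) (trans (pick⁻ e) (trans (pick⁺ f) (pick⁺ y)))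
    g-view (vs c e f) = trans (pick⁺ c) (trans (pick⁻ e) (pick⁻ f))

  view : ∀ z → View z (g z)
  view z with viewed z
  ... | i , v = subst (View z) (sym (g-view v)) v

  blob-view : ∀ i {x} → x ∈ blob i → View x i
  blob-view qo q = vo (O∩C q) (O∩W q)
  blob-view qw q = vw (W∩C q) q
  blob-view q0 q = v0 (P₀.X⊆ q) (P₀.X∩Y q)
  blob-view q1 q = v1 (P₀.Y⊆ q) q
  blob-view q2 q = v2 (λ e → E₀∩E₁ e (P₁.X⊆ q)) (P₁.X⊆ q) (P₁.X∩Y q)
  blob-view q3 q = v3 (λ e → E₀∩E₁ e (P₁.Y⊆ q)) (P₁.Y⊆ q) q
  blob-view (qs v) q with ⁅⁆⁻ (proj₁ (∩⁻ q))
  ... | refl = let r = proj₂ (∩⁻ q) in vs (proj₁ (∖⁻ (proj₁ (∖⁻ r)))) (proj₂ (∖⁻ (proj₁ (∖⁻ r)))) (proj₂ (∖⁻ r))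

  g-blob : ∀ i {x} → x ∈ blob i → g x ≡ i
  g-blob i q = g-view (blob-view i q)

  blob-disj : ∀ {i j x} → x ∈ blob i → x ∈ blob j → i ≡ j
  blob-disj {i} {j} p q = trans (sym (g-blob i p)) (g-blob j q)

  blob-conn : ∀ i → Conn E (blob i)
  blob-conn qo = cO
  blob-conn qw = cW
  blob-conn q0 = P₀.cX
  blob-conn q1 = P₀.cY
  blob-conn q2 = P₁.cX
  blob-conn q3 = P₁.cY
  blob-conn (qs v) p q with ⁅⁆⁻ (proj₁ (∩⁻ p)) | ⁅⁆⁻ (proj₁ (∩⁻ q))
  ... | refl | refl = wstop p

  blob⊆C : ∀ i → i ≢ qo → i ≢ qw → blob i ⊆ C
  blob⊆C qo ne _ q = ⊥-elim (ne refl)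
  blob⊆C qw _ ne q = ⊥-elim (ne refl)
  blob⊆C q0 _ _ q = E₀⊆ (P₀.X⊆ q)
  blob⊆C q1 _ _ q = E₀⊆ (P₀.Y⊆ q)
  blob⊆C q2 _ _ q = E₁⊆ (P₁.X⊆ q)
  blob⊆C q3 _ _ q = E₁⊆ (P₁.Y⊆ q)
  blob⊆C (qs v) _ _ q = proj₁ (∖⁻ (proj₁ (∖⁻ (proj₂ (∩⁻ q)))))

  blob∩C₀ : ∀ i → Disjoint (blob i) P₀.C
  blob∩C₀ i p c with blob-view i p
  ... | vo nc _ = nc (E₀⊆ (P₀.C⊆ c))
  ... | vw nc _ = nc (E₀⊆ (P₀.C⊆ c))
  ... | v0 _ _ = P₀.X∩C p c
  ... | v1 _ _ = P₀.Y∩C p c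
  ... | v2 ne _ _ = ne (P₀.C⊆ c)
  ... | v3 ne _ _ = ne (P₀.C⊆ c)
  ... | vs _ ne _ = ne (P₀.C⊆ c)

  blob∩C₁ : ∀ i → Disjoint (blob i) P₁.C
  blob∩C₁ i p c with blob-view i p
  ... | vo nc _ = nc (E₁⊆ (P₁.C⊆ c))
  ... | vw nc _ = nc (E₁⊆ (P₁.C⊆ c))
  ... | v0 e _ = E₀∩E₁ e (P₁.C⊆ c)
  ... | v1 e _ = E₀∩E₁ e (P₁.C⊆ c)
  ... | v2 _ _ _ = P₁.X∩C p c
  ... | v3 _ _ _ = P₁.Y∩C p c
  ... | vs _ _ ne = ne (P₁.C⊆ c)

  opaque
    F : Rel (6 + n)
    F i j = does (touch? E (blob i) (blob j))

    F⁺ : ∀ {i j} → Touch E (blob i) (blob j) → F i j ≡ true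
    F⁺ {i} {j} t with touch? E (blob i) (blob j)
    ... | yes _ = refl
    ... | no nt = ⊥-elim (nt t)

    F⁻ : ∀ {i j} → F i j ≡ true → Touch E (blob i) (blob j)
    F⁻ {i} {j} p with touch? E (blob i) (blob j)
    ... | yes t = t
    F⁻ () | no _

    U : VSet (6 + n)
    U = ⟦ (λ i → any? (λ x → x ∈? blob i)) ⟧

    U⁺ : ∀ {i x} → x ∈ blob i → i ∈ U
    U⁺ q = mk⁺ (λ i → any? (λ x → x ∈? blob i)) (_ , q)

    U⁻ : ∀ {i} → i ∈ U → ∃[ x ] x ∈ blob i
    U⁻ = mk⁻ (λ i → any? (λ x → x ∈? blob i))

  F-sym : ∀ {i j} → F i j ≡ true → F j i ≡ true
  F-sym p = F⁺ (touch-sym (F⁻ p))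

  data Status (z : Fin n) : Set where
    good  : z ∈ blob (g z) → Status z
    core₀ : z ∈ P₀.C → Status z
    core₁ : z ∈ P₁.C → Status z
    other : z ∉ C → z ∉ O → z ∉ W → Status z

  status : ∀ z → Status z
  status z with g z | view z | good {z}
  ... | _ | vo c w | gd with z ∈? O
  ... | yes o = gd o
  ... | no o = other c o w
  status z | _ | vw _ w | gd = gd w
  status z | _ | v1 _ y | gd = gd y
  status z | _ | v3 _ _ y | gd = gd y
  status z | _ | vs c e f | gd = gd (∩⁺ ⁅⁆⁺ (∖⁺ (∖⁺ c e) f))
  status z | _ | v0 e y | gd with P₀.cover e
  ... | inj₁ x = gd x
  ... | inj₂ (inj₁ y') = ⊥-elim (y y')
  ... | inj₂ (inj₂ c) = core₀ c
  status z | _ | v2 _ e y | gd with P₁.cover e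
  ... | inj₁ x = gd x
  ... | inj₂ (inj₁ y') = ⊥-elim (y y')
  ... | inj₂ (inj₂ c) = core₁ c

  Near : Fin n → Fin n → Set
  Near a b = g a ≡ g b ⊎ F (g a) (g b) ≡ true

  near : ∀ {a b i j} → g a ≡ i → g b ≡ j → i ≡ j ⊎ Touch E (blob i) (blob j) → Near a b
  near refl refl (inj₁ p) = inj₁ p
  near refl refl (inj₂ t) = inj₂ (F⁺ t)

  g-core₀ : ∀ {z} → z ∈ P₀.C → g z ≡ q0
  g-core₀ c = g-view (v0 (P₀.C⊆ c) (λ y → P₀.Y∩C y c))

  g-core₁ : ∀ {z} → z ∈ P₁.C → g z ≡ q2
  g-core₁ c = g-view (v2 (λ e → E₀∩E₁ e (P₁.C⊆ c)) (P₁.C⊆ c) (λ y → P₁.Y∩C y c))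

  -- The exceptional vertices lose no edges. A vertex of an inner core has its neighbours in that
  -- core and its two rails, which touch each other; a vertex outside `C`, `O` and `W` has no
  -- neighbour in `C`.
  near-bad : ∀ {a b} → E a b ≡ true → a ∈ blob (g a) ⊎ Near a b
  near-bad {a} {b} e with status a
  ... | good p = inj₁ p
  ... | core₀ c with P₀.closed c e
  ... | inj₁ x = inj₂ (near (g-core₀ c) (g-blob q0 x) (inj₁ refl))
  ... | inj₂ (inj₁ y) = inj₂ (near (g-core₀ c) (g-blob q1 y) (inj₂ P₀.tXY))
  ... | inj₂ (inj₂ c') = inj₂ (near (g-core₀ c) (g-core₀ c') (inj₁ refl))
  near-bad {a} {b} e | core₁ c with P₁.closed c e
  ... | inj₁ x = inj₂ (near (g-core₁ c) (g-blob q2 x) (inj₁ refl))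
  ... | inj₂ (inj₁ y) = inj₂ (near (g-core₁ c) (g-blob q3 y) (inj₂ P₁.tXY))
  ... | inj₂ (inj₂ c') = inj₂ (near (g-core₁ c) (g-core₁ c') (inj₁ refl))
  near-bad {a} {b} e | other nc nO nW with b ∈? C
  ... | yes bC with closed bC (E-sym e)
  ... | inj₁ c = ⊥-elim (nc c)
  ... | inj₂ (inj₁ o) = ⊥-elim (nO o)
  ... | inj₂ (inj₂ w) = ⊥-elim (nW w)
  near-bad {a} {b} e | other nc nO nW | no bC with b ∈? W
  ... | yes w = inj₂ (near (g-view (vo nc nW)) (g-view (vw bC w)) (inj₂ tOW))
  ... | no w = inj₂ (near (g-view (vo nc nW)) (g-view (vo bC w)) (inj₁ refl))

  simulate : ∀ {a b} → E a b ≡ true → Near a b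
  simulate e with near-bad e | near-bad (E-sym e)
  ... | inj₂ r | _ = r
  ... | _ | inj₂ r = Sum.map sym F-sym r
  ... | inj₁ p | inj₁ q = inj₂ (F⁺ (_ , _ , p , q , e))

  push : ∀ {P : Fin n → Set} {Q : Fin (6 + n) → Set} → (∀ {z} → P z → Q (g z)) → ∀ {x y} → Walk E P x y → Walk F Q (g x) (g y)
  push f (wstop p) = wstop (f p)
  push {Q = Q} f {y = y} (wstep p e w) with simulate e
  ... | inj₁ eq = subst (λ i → Walk F Q i (g y)) (sym eq) (push f w)
  ... | inj₂ e' = wstep (f p) e' (push f w)

  module QS = Sym F F-sym

  -- Walk inside a connected set `P` of the original graph whose image misses `v`, and push the walk
  -- forward; `reach` leads every other class to the image of `P`.
  link-via : ∀ v (P : VSet n) → Conn E P → (∀ {z} → z ∈ P → g z ≢ v) →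
    (∀ {i} → i ∈ U → i ≢ v → ∃[ a ] (a ∈ P × Walk F (_≢ v) i (g a))) →
    ∀ {i j} → i ∈ U → j ∈ U → i ≢ v → j ≢ v → Walk F (_≢ v) i j
  link-via v P cP avoid reach iU jU i≢ j≢ with reach iU i≢ | reach jU j≢
  ... | a , aP , w | b , bP , w' = w ++ʷ (push avoid (cP aP bP) ++ʷ QS.wrev w')

  reach-pod : ∀ {D} i j → (∀ {z} → z ∉ D → g z ≢ i × g z ≢ j) → (∀ {z} → z ∈ D → g z ≡ i ⊎ g z ≡ j) → i ≢ j → Touch E (blob j) (∁ D) →
    ∀ {k} → k ∈ U → k ≢ i → ∃[ a ] (a ∈ ∁ D × Walk F (_≢ i) k (g a))
  reach-pod {D} i j out inn i≢j (b , c , bj , cD , e) {k} kU k≢ with U⁻ kU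
  ... | a , a∈ with a ∈? D | g-blob k a∈
  ... | no na | eq = a , ∁⁺ na , subst (λ m → Walk F (_≢ i) m (g a)) eq (wstop (λ p → k≢ (trans (sym eq) p)))
  ... | yes aD | eq with inn aD
  ... | inj₁ p = ⊥-elim (k≢ (trans (sym eq) p))
  ... | inj₂ p with simulate e
  ... | inj₁ same' = ⊥-elim (proj₂ (out (∁⁻ cD)) (trans (sym same') (g-blob j bj)))
  ... | inj₂ f = c , cD , subst (λ m → Walk F (_≢ i) m (g c)) (trans (g-blob j bj) (trans (sym p) eq))
                   (wstep (λ q → i≢j (trans (sym q) (g-blob j bj))) f (wstop (proj₁ (out (∁⁻ cD)))))

  out₀ : ∀ {z} → z ∉ E₀ → g z ≢ q0 × g z ≢ q1
  out₀ {z} ne with g z | view z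
  ... | _ | vo _ _ = (λ ()) , λ ()
  ... | _ | vw _ _ = (λ ()) , λ ()
  ... | _ | v0 e _ = ⊥-elim (ne e)
  ... | _ | v1 e _ = ⊥-elim (ne e)
  ... | _ | v2 _ _ _ = (λ ()) , λ ()
  ... | _ | v3 _ _ _ = (λ ()) , λ ()
  ... | _ | vs _ _ _ = (λ ()) , λ ()

  out₁ : ∀ {z} → z ∉ E₁ → g z ≢ q2 × g z ≢ q3
  out₁ {z} ne with g z | view z
  ... | _ | vo _ _ = (λ ()) , λ ()
  ... | _ | vw _ _ = (λ ()) , λ ()
  ... | _ | v0 _ _ = (λ ()) , λ ()
  ... | _ | v1 _ _ = (λ ()) , λ ()
  ... | _ | v2 _ e _ = ⊥-elim (ne e)
  ... | _ | v3 _ e _ = ⊥-elim (ne e)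
  ... | _ | vs _ _ _ = (λ ()) , λ ()

  in₀ : ∀ {z} → z ∈ E₀ → g z ≡ q0 ⊎ g z ≡ q1
  in₀ {z} e with z ∈? P₀.Y
  ... | yes y = inj₂ (g-view (v1 e y))
  ... | no y = inj₁ (g-view (v0 e y))

  in₁ : ∀ {z} → z ∈ E₁ → g z ≡ q2 ⊎ g z ≡ q3
  in₁ {z} e with z ∈? P₁.Y
  ... | yes y = inj₂ (g-view (v3 (λ f → E₀∩E₁ f e) e y))
  ... | no y = inj₁ (g-view (v2 (λ f → E₀∩E₁ f e) e y))

  gC≢ : ∀ {z} → z ∈ C → g z ≢ qo × g z ≢ qw
  gC≢ {z} c with g z | view z
  ... | _ | vo nc _ = ⊥-elim (nc c)
  ... | _ | vw nc _ = ⊥-elim (nc c)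
  ... | _ | v0 _ _ = (λ ()) , λ ()
  ... | _ | v1 _ _ = (λ ()) , λ ()
  ... | _ | v2 _ _ _ = (λ ()) , λ ()
  ... | _ | v3 _ _ _ = (λ ()) , λ ()
  ... | _ | vs _ _ _ = (λ ()) , λ ()

  g-single : ∀ {z u} → g z ≡ qs u → z ≡ u
  g-single {z} p with g z | view z
  g-single refl | _ | vs _ _ _ = refl

  full-minus : ∀ u → Conn E (full ∖ ⁅ u ⁆)
  full-minus u x y = wmap (λ p → ∖⁺ full⁺ (λ q → p (⁅⁆⁻ q)))
    (TwoConn.link tc u full⁺ full⁺ (λ { refl → proj₂ (∖⁻ x) ⁅⁆⁺ }) (λ { refl → proj₂ (∖⁻ y) ⁅⁆⁺ }))

  reach-direct : ∀ {v k a} {P : VSet n} → a ∈ blob k → a ∈ P → k ≢ v → ∃[ a ] (a ∈ P × Walk F (_≢ v) k (g a))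
  reach-direct {v} {k} {a} q aP ne = a , aP , subst (λ m → Walk F (_≢ v) m (g a)) (g-blob k q) (wstop (λ p → ne (trans (sym (g-blob k q)) p)))

  blob⊆COW : ∀ i → blob i ⊆ C ∪ O ∪ W
  blob⊆COW i q with i Finₚ.≟ qo | i Finₚ.≟ qw
  ... | yes refl | _ = ∪ˡ (∪ʳ q)
  ... | no _ | yes refl = ∪ʳ q
  ... | no nO | no nW = ∪ˡ (∪ˡ (blob⊆C i nO nW q))

  -- Without one terminal, `C` and the other terminal remain connected. Without a rail, the
  -- complement of its pod remains, to which the second rail is attached. Without a single vertex,
  -- the 2-connectivity of the original graph applies.
  link : ∀ v {i j} → i ∈ U → j ∈ U → i ≢ v → j ≢ v → Walk F (_≢ v) i j
  link qo = link-via qo (C ∪ W) (conn-∪ cC cW (touch-sym tWC)) avoid reach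
    where
    avoid : ∀ {z} → z ∈ C ∪ W → g z ≢ qo
    avoid q = Sum.[ (λ c → proj₁ (gC≢ c)) , (λ w p → case trans (sym p) (g-blob qw w) of λ ()) ] (∪⁻ q)
    reach : ∀ {i} → i ∈ U → i ≢ qo → ∃[ a ] (a ∈ C ∪ W × Walk F (_≢ qo) i (g a))
    reach {i} iU ne with U⁻ iU
    ... | a , a∈ with i Finₚ.≟ qw
    ... | yes refl = reach-direct {k = qw} a∈ (∪ʳ a∈) ne
    ... | no nw = reach-direct {k = i} a∈ (∪ˡ (blob⊆C i ne nw a∈)) ne
  link qw = link-via qw (C ∪ O) (conn-∪ cC cO (touch-sym tOC)) avoid reach
    where
    avoid : ∀ {z} → z ∈ C ∪ O → g z ≢ qw
    avoid q = Sum.[ (λ c → proj₂ (gC≢ c)) , (λ w p → case trans (sym p) (g-blob qo w) of λ ()) ] (∪⁻ q)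
    reach : ∀ {i} → i ∈ U → i ≢ qw → ∃[ a ] (a ∈ C ∪ O × Walk F (_≢ qw) i (g a))
    reach {i} iU ne with U⁻ iU
    ... | a , a∈ with i Finₚ.≟ qo
    ... | yes refl = reach-direct {k = qo} a∈ (∪ʳ a∈) ne
    ... | no nO = reach-direct {k = i} a∈ (∪ˡ (blob⊆C i nO ne a∈)) ne
  link q0 = link-via q0 (∁ E₀) P₀.outer (λ q → proj₁ (out₀ (∁⁻ q))) (reach-pod q0 q1 out₀ in₀ (λ ()) P₀.outY)
  link q1 = link-via q1 (∁ E₀) P₀.outer (λ q → proj₂ (out₀ (∁⁻ q)))
    (reach-pod q1 q0 (λ z → proj₂ (out₀ z) , proj₁ (out₀ z)) (λ z → Sum.swap (in₀ z)) (λ ()) P₀.outX)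
  link q2 = link-via q2 (∁ E₁) P₁.outer (λ q → proj₁ (out₁ (∁⁻ q))) (reach-pod q2 q3 out₁ in₁ (λ ()) P₁.outY)
  link q3 = link-via q3 (∁ E₁) P₁.outer (λ q → proj₂ (out₁ (∁⁻ q)))
    (reach-pod q3 q2 (λ z → proj₂ (out₁ z) , proj₁ (out₁ z)) (λ z → Sum.swap (in₁ z)) (λ ()) P₁.outX)
  link (qs u) with g u Finₚ.≟ qs u
  ... | yes eq = link-via (qs u) (full ∖ ⁅ u ⁆) (full-minus u) (λ q p → proj₂ (∖⁻ q) (subst (_∈ ⁅ u ⁆) (sym (g-single p)) ⁅⁆⁺))
        (λ {i} iU ne → case U⁻ iU of λ { (a , a∈) → reach-direct {k = i} a∈
          (∖⁺ full⁺ (λ q → ne (trans (sym (g-blob i a∈)) (trans (cong g (⁅⁆⁻ q)) eq)))) ne })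
  -- Here no vertex at all is mapped to `qs u`, so nothing has to be avoided.
  ... | no neq = link-via (qs u) (C ∪ O ∪ W) (conn-∪ (conn-∪ cC cO (touch-sym tOC)) cW (touch-mono (λ c → ∪ˡ c) id (touch-sym tWC))) (λ _ p → neq (subst (λ z → g z ≡ qs u) (g-single p) p))
        (λ {i} iU ne → case U⁻ iU of λ { (a , a∈) → reach-direct {k = i} a∈ (blob⊆COW i a∈) ne })

  quotient-twoConn : TwoConn F U
  quotient-twoConn = record { supp = λ e → case F⁻ e of λ { (_ , _ , _ , q , _) → U⁺ q } ; link = link }

  inner : Conn F (U ∖ ⁅ qo ⁆ ∖ ⁅ qw ⁆)
  inner {i} {j} p q = subst₂' (g-blob i xi) (g-blob j yj) (push (λ c → inn c) (cC (toC i p xi) (toC j q yj)))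
    where
    inn : ∀ {z} → z ∈ C → g z ∈ (U ∖ ⁅ qo ⁆ ∖ ⁅ qw ⁆)
    gU : ∀ {z} → z ∈ C → g z ∈ U
    gU {z} c with status z
    ... | good b = U⁺ b
    ... | core₀ c' = subst (_∈ U) (sym (g-core₀ c')) (U⁺ {i = q0} (proj₁ (proj₂ (proj₂ P₀.tXC))))
    ... | core₁ c' = subst (_∈ U) (sym (g-core₁ c')) (U⁺ {i = q2} (proj₁ (proj₂ (proj₂ P₁.tXC))))
    ... | other nc _ _ = ⊥-elim (nc c)
    inn c = ∖⁺ (∖⁺ (gU c) (λ r → proj₁ (gC≢ c) (⁅⁆⁻ r))) (λ r → proj₂ (gC≢ c) (⁅⁆⁻ r))
    xi = proj₂ (U⁻ (proj₁ (∖⁻ (proj₁ (∖⁻ p)))))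
    yj = proj₂ (U⁻ (proj₁ (∖⁻ (proj₁ (∖⁻ q)))))
    toC : ∀ i → i ∈ (U ∖ ⁅ qo ⁆ ∖ ⁅ qw ⁆) → blob i ⊆ C
    toC i r = blob⊆C i (λ { refl → proj₂ (∖⁻ (proj₁ (∖⁻ r))) ⁅⁆⁺ }) (λ { refl → proj₂ (∖⁻ r) ⁅⁆⁺ })
    subst₂' : ∀ {a b i j} → a ≡ i → b ≡ j → Walk F (_∈ (U ∖ ⁅ qo ⁆ ∖ ⁅ qw ⁆)) a b → Walk F (_∈ (U ∖ ⁅ qo ⁆ ∖ ⁅ qw ⁆)) i j
    subst₂' refl refl w = w

  open Local F F-sym U quotient-twoConn

  terminals : Terminals qo qw q0 q1 q2 q3
  terminals = record
    { o∈ = U⁺ {i = qo} (proj₁ (proj₂ (proj₂ tOC))) ; w∈ = U⁺ {i = qw} (proj₁ (proj₂ (proj₂ tWC)))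
    ; o≢w = λ ()
    ; p✓ = U⁺ {i = q0} (proj₁ (proj₂ (proj₂ P₀.tXC))) , (λ ()) , λ () ; q✓ = U⁺ {i = q1} (proj₁ (proj₂ (proj₂ P₀.tYC))) , (λ ()) , λ ()
    ; r✓ = U⁺ {i = q2} (proj₁ (proj₂ (proj₂ P₁.tXC))) , (λ ()) , λ () ; s✓ = U⁺ {i = q3} (proj₁ (proj₂ (proj₂ P₁.tYC))) , (λ ()) , λ ()
    ; p≢q = λ () ; r≢s = λ () ; inner = inner }

  opaque
    lift : VSet (6 + n) → VSet n
    lift S = ⟦ (λ x → any? (λ i → (i ∈? S) ×-dec (x ∈? blob i))) ⟧

    lift⁺ : ∀ {S i} → i ∈ S → blob i ⊆ lift S
    lift⁺ {S} iS q = mk⁺ (λ x → any? (λ i → (i ∈? S) ×-dec (x ∈? blob i))) (_ , iS , q)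

    lift⁻ : ∀ {S x} → x ∈ lift S → ∃[ i ] (i ∈ S × x ∈ blob i)
    lift⁻ {S} = mk⁻ (λ x → any? (λ i → (i ∈? S) ×-dec (x ∈? blob i)))

  lift-conn : ∀ {S} → Conn F S → Conn E (lift S)
  lift-conn {S} cS x y with lift⁻ x | lift⁻ y
  ... | i , iS , xi | j , jS , yj = go (cS iS jS) xi yj
    where
    go : ∀ {i j x y} → Walk F (_∈ S) i j → x ∈ blob i → y ∈ blob j → Walk E (_∈ lift S) x y
    go (wstop {i} iS) p q = wmap (lift⁺ {i = i} iS) (blob-conn i p q)
    go (wstep {i} iS f w) p q with F⁻ f
    ... | a , b , a∈ , b∈ , e = wmap (lift⁺ {i = i} iS) (blob-conn i p a∈) ++ʷ wstep (lift⁺ {i = i} iS a∈) e (go w b∈ q)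

  lift-disj : ∀ {S T} → Disjoint S T → Disjoint (lift S) (lift T)
  lift-disj d p q with lift⁻ p | lift⁻ q
  ... | i , iS , x | j , jT , y with blob-disj {i} {j} x y
  ... | refl = d iS jT

  lift∩C₀ : ∀ {S} → Disjoint (lift S) P₀.C
  lift∩C₀ p c with lift⁻ p
  ... | i , _ , x = blob∩C₀ i x c

  lift∩C₁ : ∀ {S} → Disjoint (lift S) P₁.C
  lift∩C₁ p c with lift⁻ p
  ... | i , _ , x = blob∩C₁ i x c

  lift⊆C : ∀ {S} → Inner qo qw S → lift S ⊆ C
  lift⊆C inn p with lift⁻ p
  ... | i , iS , x with inn iS
  ... | _ , a , b = blob⊆C i a b x

  lift-touch : ∀ {S i} → Touch F S ⁅ i ⁆ → Touch E (lift S) (blob i)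
  lift-touch (a , b , aS , b∈ , f) with ⁅⁆⁻ b∈ | F⁻ f
  ... | refl | x , y , p , q , e = x , y , lift⁺ {i = a} aS p , q , e

  -- The two sets swallow one rail of the pod each. All neighbours of the core outside it lie in the
  -- rails, so the sets become its new `O` and `W`; the pair records which rail went where.
  state-of : ∀ {D p q} (pod : Pod E h D) → Pod.X pod ⊆ blob p → Pod.Y pod ⊆ blob q → (∀ {S} → Disjoint (lift S) (Pod.C pod)) →
    ∀ {S T a b} → Pair p q a b → Disjoint S T → Conn F S → Conn F T → a ∈ S → b ∈ T → State E (Pod.C pod) (lift S) (lift T)
  state-of {p = p} {q} pod X⊆ Y⊆ avoid {S} {T} pr d cS cT aS bT = record
    { O∩C = avoid ; W∩C = avoid ; O∩W = lift-disj d ; cO = lift-conn cS ; cW = lift-conn cT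
    ; tOW = touches pr aS bT ; tOC = proj₁ (cores pr aS bT) ; tWC = proj₂ (cores pr aS bT) ; closed = cl pr aS bT }
    where
    module P = Pod pod
    X⁺ : ∀ {S} → p ∈ S → P.X ⊆ lift S
    X⁺ pS x = lift⁺ pS (X⊆ x)
    Y⁺ : ∀ {S} → q ∈ S → P.Y ⊆ lift S
    Y⁺ qS y = lift⁺ qS (Y⊆ y)
    touches : ∀ {a b} → Pair p q a b → a ∈ S → b ∈ T → Touch E (lift S) (lift T)
    touches (inj₁ (refl , refl)) i j = touch-mono (X⁺ i) (Y⁺ j) P.tXY
    touches (inj₂ (refl , refl)) i j = touch-mono (Y⁺ i) (X⁺ j) (touch-sym P.tXY)
    cores : ∀ {a b} → Pair p q a b → a ∈ S → b ∈ T → Touch E (lift S) P.C × Touch E (lift T) P.C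
    cores (inj₁ (refl , refl)) i j = touch-mono (X⁺ i) id P.tXC , touch-mono (Y⁺ j) id P.tYC
    cores (inj₂ (refl , refl)) i j = touch-mono (Y⁺ i) id P.tYC , touch-mono (X⁺ j) id P.tXC
    cl : ∀ {a b} → Pair p q a b → a ∈ S → b ∈ T → ∀ {x y} → x ∈ P.C → E x y ≡ true → y ∈ P.C ⊎ y ∈ lift S ⊎ y ∈ lift T
    cl pr i j c e with P.closed c e | pr
    ... | inj₂ (inj₂ z) | _ = inj₁ z
    ... | inj₁ x | inj₁ (refl , refl) = inj₂ (inj₁ (X⁺ i x))
    ... | inj₁ x | inj₂ (refl , refl) = inj₂ (inj₂ (X⁺ j x))
    ... | inj₂ (inj₁ y) | inj₁ (refl , refl) = inj₂ (inj₂ (Y⁺ j y))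
    ... | inj₂ (inj₁ y) | inj₂ (refl , refl) = inj₂ (inj₁ (Y⁺ i y))

  state₀ : ∀ {S T a b} → Pair q0 q1 a b → Disjoint S T → Conn F S → Conn F T → a ∈ S → b ∈ T → State E P₀.C (lift S) (lift T)
  state₀ = state-of pod₀ id id lift∩C₀

  state₁ : ∀ {S T a b} → Pair q2 q3 a b → Disjoint S T → Conn F S → Conn F T → a ∈ S → b ∈ T → State E P₁.C (lift S) (lift T)
  state₁ = state-of pod₁ id id lift∩C₁

  lift-series : ∀ {a b c d C₀ C₁} (s : Series qo qw a b c d) → (∀ {S} → Disjoint (lift S) C₀) → (∀ {S} → Disjoint (lift S) C₁) →
    State E C₀ (lift (Series.L s)) (lift (Series.M s)) → State E C₁ (lift (Series.R s)) (lift (Series.M s)) → SeriesStep E C O W C₀ C₁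
  lift-series s avoid₀ avoid₁ st₀ st₁ = record
    { L = lift L ; M = lift M ; R = lift R ; L⊆ = lift⊆C L⊆ ; M⊆ = lift⊆C M⊆ ; R⊆ = lift⊆C R⊆
    ; L∩M = lift-disj L∩M ; R∩M = lift-disj R∩M ; L∩R = lift-disj L∩R ; L∩C₁ = avoid₁ ; R∩C₀ = avoid₀
    ; cM = lift-conn cM ; tL = lift-touch tL ; tR = lift-touch tR ; st₀ = st₀ ; st₁ = st₁ }
    where open Series s

  lift-parallel : ∀ {o w a b c d} (s : Parallel o w a c b d) → (∀ {S} → Inner o w S → Inner qo qw S) → Pair q0 q1 a b → Pair q2 q3 c d →
    ParallelStep E C (blob o) (blob w) P₀.C P₁.C
  lift-parallel s inn pr pr' = record
    { Z = lift Z ; R₀ = lift R₀ ; R₁ = lift R₁ ; Z⊆ = lift⊆C (inn Z⊆) ; R₀⊆ = lift⊆C (inn R₀⊆) ; R₁⊆ = lift⊆C (inn R₁⊆)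
    ; Z∩R₀ = lift-disj Z∩R₀ ; Z∩R₁ = lift-disj Z∩R₁ ; R₀∩C₁ = lift∩C₁ ; R₁∩C₀ = lift∩C₀
    ; tZ = lift-touch tZ ; tR₀ = lift-touch tR₀ ; tR₁ = lift-touch tR₁
    ; st₀ = state₀ pr Z∩R₀ cZ cR₀ a∈ b∈ ; st₁ = state₁ pr' Z∩R₁ cZ cR₁ c∈ d∈ }
    where open Parallel s

  step-of : Shape qo qw q0 q1 q2 q3 → Step E C O W P₀.C P₁.C
  step-of (series₁ pr pr' s) = series₁ (lift-series s lift∩C₀ lift∩C₁ (state₀ pr L∩M cL cM a∈ b∈) (state₁ pr' R∩M cR cM c∈ d∈))
    where open Series s
  step-of (series₂ pr pr' s) = series₂ (lift-series s lift∩C₁ lift∩C₀ (state₁ pr' L∩M cL cM a∈ b∈) (state₀ pr R∩M cR cM c∈ d∈))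
    where open Series s
  step-of (parallel₁ pr pr' s) = parallel₁ (lift-parallel s (λ i → i) pr pr')
  step-of (parallel₂ pr pr' s) = parallel₂ (lift-parallel s inner-swap pr pr')

  opaque
    next-step : Step E C O W P₀.C P₁.C
    next-step = step-of (shapes terminals)

-- A model of Γₗ⁺ whose root blob touches O and whose apex K contains W.
record Fan {n} (E : Rel n) (l : ℕ) (C O W : VSet n) : Set where
  field
    D B K : VSet n
    tree : Tree E K l D B
    D⊆   : D ⊆ C
    K⊆   : ∀ {x} → x ∈ K → x ∈ C ⊎ x ∈ W
    W⊆   : W ⊆ K
    cK   : Conn E K
    K∩D  : Disjoint K D
    tB   : Touch E B O

-- A model of ∇ₖ₊₁ in C ∪ O ∪ W whose root blobs contain O and W.
record Web {n} (E : Rel n) (k : ℕ) (C O W : VSet n) : Set where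
  field
    blob  : NV k → VSet n
    O⊆    : O ⊆ blob (inj₁ false)
    W⊆    : W ⊆ blob (inj₁ true)
    ⊆O    : ∀ {x} → x ∈ blob (inj₁ false) → x ∈ C ⊎ x ∈ O
    ⊆W    : ∀ {x} → x ∈ blob (inj₁ true) → x ∈ C ⊎ x ∈ W
    ⊆C    : ∀ i → blob (inj₂ i) ⊆ C
    disj  : ∀ {h h' x} → x ∈ blob h → x ∈ blob h' → h ≡ h'
    conn  : ∀ h → Conn E (blob h)
    inhab : ∀ h → ∃[ x ] x ∈ blob h
    touch : ∀ {h h'} → NablaE k h h' → Touch E (blob h) (blob h')

-- Assembling fans and webs along the steps

module Gadgets {n} (E : Rel n) (E-sym : ∀ {x y} → E x y ≡ true → E y x ≡ true) where
  open Sym E E-sym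

  state-swap : ∀ {C O W} → State E C O W → State E C W O
  state-swap s = record { O∩C = W∩C ; W∩C = O∩C ; O∩W = disj-sym O∩W ; cO = cW ; cW = cO ; tOW = touch-sym tOW ; tOC = tWC ; tWC = tOC
                        ; closed = λ c e → Sum.map₂ Sum.swap (closed c e) }
    where open State s

  fan₀ : ∀ {C O W} → Conn E C → State E C O W → Fan E 0 C O W
  fan₀ {C} {O} {W} cC st = record
    { D = C ; B = C ; K = W ; tree = tleaf cC id (touch-sym tWC) ; D⊆ = id ; K⊆ = inj₂ ; W⊆ = id ; cK = cW ; K∩D = W∩C ; tB = touch-sym tOC }
    where open State st

  -- `P` prolongs the root blob from `O'` to `O`, and `Q` prolongs the apex from `W'` to `W`,
  -- meeting it in the point `z`.
  fan-pass : ∀ {l C O W C' O' W' P Q z} → C' ⊆ C → O' ⊆ P → P ⊆ C → Disjoint P C' → Conn E P → Touch E P O →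
    z ∈ W' → W' ⊆ Q → W ⊆ Q → (∀ {x} → x ∈ Q → x ∈ C ⊎ x ∈ W) → Disjoint Q C' → Disjoint Q P → Conn E Q →
    Fan E l C' O' W' → Fan E l C O W
  fan-pass {P = P} {Q} C'⊆ O'⊆ P⊆ P∩C' cP tP zW W'⊆ W⊆Q Q⊆ Q∩C' Q∩P cQ f = record
    { D = D ∪ P ; B = B ∪ P ; K = K ∪ Q
    ; tree = tree-extend (λ p d → P∩C' p (D⊆ d)) (conn-∪ (tree-conn tree) cP (touch-mono id O'⊆ tB)) (tree-apex ∪ˡ tree)
    ; D⊆ = ∪-elim (λ d → C'⊆ (D⊆ d)) P⊆
    ; K⊆ = λ q → case ∪⁻ q of λ { (inj₂ y) → Q⊆ y ; (inj₁ k) → case K⊆ k of (λ { (inj₁ c) → inj₁ (C'⊆ c) ; (inj₂ w) → Q⊆ (W'⊆ w) }) }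
    ; W⊆ = λ w → ∪ʳ (W⊆Q w)
    ; cK = conn-share cK cQ (W⊆ zW) (W'⊆ zW)
    ; K∩D = ∪-disj (λ k q → case ∪⁻ q of λ { (inj₁ d) → K∩D k d ; (inj₂ p) → case K⊆ k of (λ { (inj₁ c) → P∩C' p c ; (inj₂ w) → Q∩P (W'⊆ w) p }) })
                   (λ y q → case ∪⁻ q of λ { (inj₁ d) → Q∩C' y (D⊆ d) ; (inj₂ p) → Q∩P y p })
    ; tB = touch-mono ∪ʳ id tP }
    where open Fan f

  -- Both trees have their roots next to `Z`, which becomes the new root. Their apexes contain `R₀`
  -- and `R₁`, which touch `W`, so the two apexes and `W` merge into one.
  fan-join : ∀ {l C O W C₀ C₁} → State E C O W → C₀ ⊆ C → C₁ ⊆ C → Disjoint C₀ C₁ → (s : ParallelStep E C O W C₀ C₁) →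
    Fan E l C₀ (ParallelStep.Z s) (ParallelStep.R₀ s) → Fan E l C₁ (ParallelStep.Z s) (ParallelStep.R₁ s) → Fan E (suc l) C O W
  fan-join {l} {C} {O} {W} {C₀} {C₁} st C₀⊆ C₁⊆ C₀∩C₁ s f₀ f₁ = record
    { D = Z ∪ A.D ∪ B.D ; B = Z ; K = A.K ∪ B.K ∪ W
    ; tree = tnode (State.cO st₀) (∪ˡ ∘ ∪ˡ) (∪ˡ ∘ ∪ʳ) ∪ʳ (λ z d → State.O∩C st₀ z (A.D⊆ d)) (λ z d → State.O∩C st₁ z (B.D⊆ d))
        (λ d e → C₀∩C₁ (A.D⊆ d) (B.D⊆ e)) (touch-sym A.tB) (touch-sym B.tB) (tree-apex (∪ˡ ∘ ∪ˡ) A.tree) (tree-apex (∪ˡ ∘ ∪ʳ) B.tree)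
    ; D⊆ = ∪-elim (∪-elim Z⊆ (λ d → C₀⊆ (A.D⊆ d))) (λ d → C₁⊆ (B.D⊆ d))
    ; K⊆ = λ q → case ∪⁻ q of λ { (inj₂ w) → inj₂ w ; (inj₁ q') → inj₁ (∪-elim K₀⊆C K₁⊆C q') }
    ; W⊆ = ∪ʳ
    ; cK = conn-ext (∪-elim (∪-elim (∪ˡ ∘ ∪ˡ) ∪ʳ) (∪ˡ ∘ ∪ʳ)) (∪-elim (∪-elim (∪ˡ ∘ ∪ˡ) ∪ʳ) (∪ˡ ∘ ∪ʳ))
        (conn-∪ (conn-∪ A.cK (State.cW st) (touch-mono A.W⊆ id tR₀)) B.cK (touch-mono ∪ʳ B.W⊆ (touch-sym tR₁)))
    ; K∩D = λ k d → apart (∪⁻ k) (∪⁻ d)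
    ; tB = tZ }
    where
    open ParallelStep s
    module A = Fan f₀
    module B = Fan f₁
    K₀⊆C : A.K ⊆ C
    K₀⊆C k = case A.K⊆ k of λ { (inj₁ c) → C₀⊆ c ; (inj₂ r) → R₀⊆ r }
    K₁⊆C : B.K ⊆ C
    K₁⊆C k = case B.K⊆ k of λ { (inj₁ c) → C₁⊆ c ; (inj₂ r) → R₁⊆ r }
    Z∩K₀ : Disjoint A.K Z
    Z∩K₀ k z = case A.K⊆ k of λ { (inj₁ c) → State.O∩C st₀ z c ; (inj₂ r) → Z∩R₀ z r }
    Z∩K₁ : Disjoint B.K Z
    Z∩K₁ k z = case B.K⊆ k of λ { (inj₁ c) → State.O∩C st₁ z c ; (inj₂ r) → Z∩R₁ z r }
    K₀∩C₁ : Disjoint A.K C₁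
    K₀∩C₁ k c₁ = case A.K⊆ k of λ { (inj₁ c) → C₀∩C₁ c c₁ ; (inj₂ r) → R₀∩C₁ r c₁ }
    K₁∩C₀ : Disjoint B.K C₀
    K₁∩C₀ k c₀ = case B.K⊆ k of λ { (inj₁ c) → C₀∩C₁ c₀ c ; (inj₂ r) → R₁∩C₀ r c₀ }
    apart : ∀ {x} → x ∈ A.K ∪ B.K ⊎ x ∈ W → x ∈ Z ∪ A.D ⊎ x ∈ B.D → ⊥
    apart (inj₂ w) (inj₁ q) = State.W∩C st w (∪-elim Z⊆ (λ d → C₀⊆ (A.D⊆ d)) q)
    apart (inj₂ w) (inj₂ d) = State.W∩C st w (C₁⊆ (B.D⊆ d))
    apart (inj₁ k) (inj₁ q) with ∪⁻ k | ∪⁻ q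
    ... | inj₁ a | inj₁ z = Z∩K₀ a z
    ... | inj₁ a | inj₂ d = A.K∩D a d
    ... | inj₂ b | inj₁ z = Z∩K₁ b z
    ... | inj₂ b | inj₂ d = K₁∩C₀ b (A.D⊆ d)
    apart (inj₁ k) (inj₂ d) with ∪⁻ k
    ... | inj₁ a = K₀∩C₁ a (B.D⊆ d)
    ... | inj₂ b = B.K∩D b d

  web₀ : ∀ {C O W} → Conn E C → State E C O W → Web E 0 C O W
  web₀ {C} {O} {W} cC st = record
    { blob = bl ; O⊆ = id ; W⊆ = id ; ⊆O = inj₂ ; ⊆W = inj₂ ; ⊆C = λ _ → id
    ; disj = λ {h} {h'} → dj h h' ; conn = cn ; inhab = ih ; touch = tch }
    where
    open State st
    bl : NV 0 → VSet n
    bl (inj₁ false) = O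
    bl (inj₁ true) = W
    bl (inj₂ _) = C
    dj : ∀ h h' {x} → x ∈ bl h → x ∈ bl h' → h ≡ h'
    dj (inj₁ false) (inj₁ false) p q = refl
    dj (inj₁ false) (inj₁ true) p q = ⊥-elim (O∩W p q)
    dj (inj₁ false) (inj₂ _) p q = ⊥-elim (O∩C p q)
    dj (inj₁ true) (inj₁ false) p q = ⊥-elim (O∩W q p)
    dj (inj₁ true) (inj₁ true) p q = refl
    dj (inj₁ true) (inj₂ _) p q = ⊥-elim (W∩C p q)
    dj (inj₂ _) (inj₁ false) p q = ⊥-elim (O∩C q p)
    dj (inj₂ _) (inj₁ true) p q = ⊥-elim (W∩C q p)
    dj (inj₂ _) (inj₂ _) p q = refl
    cn : ∀ h → Conn E (bl h)
    cn (inj₁ false) = cO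
    cn (inj₁ true) = cW
    cn (inj₂ _) = cC
    ih : ∀ h → ∃[ x ] x ∈ bl h
    ih (inj₁ false) = _ , proj₁ (proj₂ (proj₂ tOC))
    ih (inj₁ true) = _ , proj₁ (proj₂ (proj₂ tWC))
    ih (inj₂ _) = _ , proj₁ (proj₂ (proj₂ (proj₂ tOC)))
    tch : ∀ {h h'} → NablaE 0 h h' → Touch E (bl h) (bl h')
    tch root = tOW
    tch sideA = tOC
    tch sideB = tWC

  -- The root blobs contain `O'` and `W'`, so they stay connected when `O` and `W` are added to
  -- them.
  web-pass : ∀ {k C O W C' O' W'} → State E C O W → C' ⊆ C → O' ⊆ C → W' ⊆ C → Touch E O' O → Touch E W' W →
    Web E k C' O' W' → Web E k C O W
  web-pass {k} {C} {O} {W} st C'⊆ O'⊆ W'⊆ tO tW web = record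
    { blob = bl ; O⊆ = ∪ʳ ; W⊆ = ∪ʳ
    ; ⊆O = λ q → Sum.map₁ (λ p → old⊆ (inj₁ false) p) (∪⁻ q) ; ⊆W = λ q → Sum.map₁ (λ p → old⊆ (inj₁ true) p) (∪⁻ q)
    ; ⊆C = λ i q → C'⊆ (⊆C i q) ; disj = λ {h} {h'} → dj h h' ; conn = cn ; inhab = λ h → proj₁ (inhab h) , grow h (proj₂ (inhab h))
    ; touch = λ {h} {h'} e → touch-mono (grow h) (grow h') (touch e) }
    where
    open Web web
    open State st using (O∩C; W∩C; O∩W; cO; cW)
    bl : NV k → VSet n
    bl (inj₁ false) = blob (inj₁ false) ∪ O
    bl (inj₁ true) = blob (inj₁ true) ∪ W
    bl (inj₂ i) = blob (inj₂ i)
    old⊆ : ∀ h → blob h ⊆ C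
    old⊆ (inj₁ false) q = Sum.[ (λ c → C'⊆ c) , (λ o → O'⊆ o) ] (⊆O q)
    old⊆ (inj₁ true) q = Sum.[ (λ c → C'⊆ c) , (λ o → W'⊆ o) ] (⊆W q)
    old⊆ (inj₂ i) q = C'⊆ (⊆C i q)
    grow : ∀ h → blob h ⊆ bl h
    grow (inj₁ false) = ∪ˡ
    grow (inj₁ true) = ∪ˡ
    grow (inj₂ i) = id
    data Source (x : Fin n) : NV k → Set where
      old : ∀ {h} → x ∈ blob h → Source x h
      isO : x ∈ O → Source x (inj₁ false)
      isW : x ∈ W → Source x (inj₁ true)
    source : ∀ h {x} → x ∈ bl h → Source x h
    source (inj₁ false) q = Sum.[ old , isO ] (∪⁻ q)
    source (inj₁ true) q = Sum.[ old , isW ] (∪⁻ q)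
    source (inj₂ i) q = old q
    agree : ∀ {x h h'} → Source x h → Source x h' → h ≡ h'
    agree (old p) (old q) = disj p q
    agree (old p) (isO o) = ⊥-elim (O∩C o (old⊆ _ p))
    agree (old p) (isW w) = ⊥-elim (W∩C w (old⊆ _ p))
    agree (isO o) (old p) = ⊥-elim (O∩C o (old⊆ _ p))
    agree (isO _) (isO _) = refl
    agree (isO o) (isW w) = ⊥-elim (O∩W o w)
    agree (isW w) (old p) = ⊥-elim (W∩C w (old⊆ _ p))
    agree (isW w) (isO o) = ⊥-elim (O∩W o w)
    agree (isW _) (isW _) = refl
    dj : ∀ h h' {x} → x ∈ bl h → x ∈ bl h' → h ≡ h'
    dj h h' p q = agree (source h p) (source h' q)
    cn : ∀ h → Conn E (bl h)
    cn (inj₁ false) = conn-∪ (conn (inj₁ false)) cO (touch-mono O⊆ id tO)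
    cn (inj₁ true) = conn-∪ (conn (inj₁ true)) cW (touch-mono W⊆ id tW)
    cn (inj₂ i) = conn (inj₂ i)

  -- The blobs containing `M` in the two webs merge into the third vertex of the new triangle. The
  -- root edges of the two webs become two of its sides, and the contact of `O` with `W` becomes the
  -- new root edge.
  web-join : ∀ {k C O W C₀ C₁} → State E C O W → C₀ ⊆ C → C₁ ⊆ C → Disjoint C₀ C₁ → (s : SeriesStep E C O W C₀ C₁) →
    Web E k C₀ (SeriesStep.L s) (SeriesStep.M s) → Web E k C₁ (SeriesStep.R s) (SeriesStep.M s) → Web E (suc k) C O W
  web-join {k} {C} {O} {W} {C₀} {C₁} st C₀⊆ C₁⊆ C₀∩C₁ s u v = record
    { blob = bl ; O⊆ = ∪ʳ ; W⊆ = ∪ʳ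
    ; ⊆O = λ q → Sum.map₁ (λ p → A⊆C (inj₁ false) p) (∪⁻ q) ; ⊆W = λ q → Sum.map₁ (λ p → B⊆C (inj₁ false) p) (∪⁻ q)
    ; ⊆C = inC ; disj = λ {h} {h'} p q → agree (source h p) (source h' q) ; conn = cn ; inhab = ih ; touch = tch }
    where
    open SeriesStep s
    open State st using (O∩C; W∩C; O∩W; cO; cW; tOW)
    module S₀ = State st₀
    module S₁ = State st₁
    module A = Web u
    module B = Web v
    bl : NV (suc k) → VSet n
    bl (inj₁ false) = A.blob (inj₁ false) ∪ O
    bl (inj₁ true) = B.blob (inj₁ false) ∪ W
    bl (inj₂ (inj₁ _)) = A.blob (inj₁ true) ∪ B.blob (inj₁ true)
    bl (inj₂ (inj₂ (inj₁ i))) = A.blob (inj₂ i)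
    bl (inj₂ (inj₂ (inj₂ i))) = B.blob (inj₂ i)
    A⊆ : ∀ h {x} → x ∈ A.blob h → x ∈ C₀ ⊎ x ∈ L ⊎ x ∈ M
    A⊆ (inj₁ false) q = Sum.map₂ inj₁ (A.⊆O q)
    A⊆ (inj₁ true) q = Sum.map₂ inj₂ (A.⊆W q)
    A⊆ (inj₂ i) q = inj₁ (A.⊆C i q)
    B⊆ : ∀ h {x} → x ∈ B.blob h → x ∈ C₁ ⊎ x ∈ R ⊎ x ∈ M
    B⊆ (inj₁ false) q = Sum.map₂ inj₁ (B.⊆O q)
    B⊆ (inj₁ true) q = Sum.map₂ inj₂ (B.⊆W q)
    B⊆ (inj₂ i) q = inj₁ (B.⊆C i q)
    A⊆C : ∀ h → A.blob h ⊆ C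
    A⊆C h q = case A⊆ h q of λ { (inj₁ c) → C₀⊆ c ; (inj₂ (inj₁ l)) → L⊆ l ; (inj₂ (inj₂ m)) → M⊆ m }
    B⊆C : ∀ h → B.blob h ⊆ C
    B⊆C h q = case B⊆ h q of λ { (inj₁ c) → C₁⊆ c ; (inj₂ (inj₁ l)) → R⊆ l ; (inj₂ (inj₂ m)) → M⊆ m }
    inC : ∀ i → bl (inj₂ i) ⊆ C
    inC (inj₁ _) = ∪-elim (A⊆C (inj₁ true)) (B⊆C (inj₁ true))
    inC (inj₂ (inj₁ i)) = A⊆C (inj₂ i)
    inC (inj₂ (inj₂ i)) = B⊆C (inj₂ i)
    grow₁ : ∀ h → A.blob h ⊆ bl (ι₁ h)
    grow₁ (inj₁ false) = ∪ˡ
    grow₁ (inj₁ true) = ∪ˡ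
    grow₁ (inj₂ i) = id
    grow₂ : ∀ h → B.blob h ⊆ bl (ι₂ h)
    grow₂ (inj₁ false) = ∪ˡ
    grow₂ (inj₁ true) = ∪ʳ
    grow₂ (inj₂ i) = id
    data Source (x : Fin n) : NV (suc k) → Set where
      fromA : ∀ h → x ∈ A.blob h → Source x (ι₁ h)
      fromB : ∀ h → x ∈ B.blob h → Source x (ι₂ h)
      isO : x ∈ O → Source x (inj₁ false)
      isW : x ∈ W → Source x (inj₁ true)
    source : ∀ h {x} → x ∈ bl h → Source x h
    source (inj₁ false) q = Sum.[ fromA (inj₁ false) , isO ] (∪⁻ q)
    source (inj₁ true) q = Sum.[ fromB (inj₁ false) , isW ] (∪⁻ q)
    source (inj₂ (inj₁ _)) q = Sum.[ fromA (inj₁ true) , fromB (inj₁ true) ] (∪⁻ q)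
    source (inj₂ (inj₂ (inj₁ i))) q = fromA (inj₂ i) q
    source (inj₂ (inj₂ (inj₂ i))) q = fromB (inj₂ i) q
    -- The two webs can only share vertices of `M`, and `M` lies in the same root blob of each,
    -- exactly where the two copies are glued.
    meet : ∀ h h' {x} → x ∈ A.blob h → x ∈ B.blob h' → h ≡ inj₁ true × h' ≡ inj₁ true
    meet h h' p q with A⊆ h p | B⊆ h' q
    ... | inj₁ c | inj₁ c' = ⊥-elim (C₀∩C₁ c c')
    ... | inj₁ c | inj₂ (inj₁ r) = ⊥-elim (R∩C₀ r c)
    ... | inj₁ c | inj₂ (inj₂ m) = ⊥-elim (S₀.W∩C m c)
    ... | inj₂ (inj₁ l) | inj₁ c = ⊥-elim (L∩C₁ l c)
    ... | inj₂ (inj₁ l) | inj₂ (inj₁ r) = ⊥-elim (L∩R l r)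
    ... | inj₂ (inj₁ l) | inj₂ (inj₂ m) = ⊥-elim (L∩M l m)
    ... | inj₂ (inj₂ m) | inj₁ c = ⊥-elim (S₁.W∩C m c)
    ... | inj₂ (inj₂ m) | inj₂ (inj₁ r) = ⊥-elim (R∩M r m)
    ... | inj₂ (inj₂ m) | inj₂ (inj₂ m') = A.disj p (A.W⊆ m) , B.disj q (B.W⊆ m')
    agree : ∀ {x h h'} → Source x h → Source x h' → h ≡ h'
    agree (fromA h p) (fromA h' q) = cong ι₁ (A.disj p q)
    agree (fromB h p) (fromB h' q) = cong ι₂ (B.disj p q)
    agree (fromA h p) (fromB h' q) with meet h h' p q
    ... | refl , refl = refl
    agree (fromB h' q) (fromA h p) with meet h h' p q
    ... | refl , refl = refl
    agree (fromA h p) (isO o) = ⊥-elim (O∩C o (A⊆C h p))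
    agree (fromA h p) (isW w) = ⊥-elim (W∩C w (A⊆C h p))
    agree (fromB h p) (isO o) = ⊥-elim (O∩C o (B⊆C h p))
    agree (fromB h p) (isW w) = ⊥-elim (W∩C w (B⊆C h p))
    agree (isO o) (fromA h p) = ⊥-elim (O∩C o (A⊆C h p))
    agree (isO o) (fromB h p) = ⊥-elim (O∩C o (B⊆C h p))
    agree (isO _) (isO _) = refl
    agree (isO o) (isW w) = ⊥-elim (O∩W o w)
    agree (isW w) (fromA h p) = ⊥-elim (W∩C w (A⊆C h p))
    agree (isW w) (fromB h p) = ⊥-elim (W∩C w (B⊆C h p))
    agree (isW w) (isO o) = ⊥-elim (O∩W o w)
    agree (isW _) (isW _) = refl
    cn : ∀ h → Conn E (bl h)
    cn (inj₁ false) = conn-∪ (A.conn _) cO (touch-mono A.O⊆ id tL)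
    cn (inj₁ true) = conn-∪ (B.conn _) cW (touch-mono B.O⊆ id tR)
    cn (inj₂ (inj₁ _)) = let m = proj₁ (proj₂ (proj₂ S₀.tWC)) in conn-share (A.conn _) (B.conn _) (A.W⊆ m) (B.W⊆ m)
    cn (inj₂ (inj₂ (inj₁ i))) = A.conn _
    cn (inj₂ (inj₂ (inj₂ i))) = B.conn _
    ih : ∀ h → ∃[ x ] x ∈ bl h
    ih (inj₁ false) = _ , ∪ˡ (proj₂ (A.inhab (inj₁ false)))
    ih (inj₁ true) = _ , ∪ˡ (proj₂ (B.inhab (inj₁ false)))
    ih (inj₂ (inj₁ _)) = _ , ∪ˡ (proj₂ (A.inhab (inj₁ true)))
    ih (inj₂ (inj₂ (inj₁ i))) = A.inhab (inj₂ i)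
    ih (inj₂ (inj₂ (inj₂ i))) = B.inhab (inj₂ i)
    tch : ∀ {h h'} → NablaE (suc k) h h' → Touch E (bl h) (bl h')
    tch root = touch-mono ∪ʳ ∪ʳ tOW
    tch sideA = touch-mono ∪ˡ ∪ˡ (A.touch root)
    tch sideB = touch-mono ∪ˡ ∪ʳ (B.touch root)
    tch (left {x = x} {y} e) = touch-mono (grow₁ x) (grow₁ y) (A.touch e)
    tch (right {x = x} {y} e) = touch-mono (grow₂ x) (grow₂ y) (B.touch e)

  -- The root blob runs through `L` to `O`, while the apex runs from `M` through the other core and
  -- `R` to `W`.
  fan-near : ∀ {l C O W C₀ C₁} → State E C O W → C₀ ⊆ C → C₁ ⊆ C → Disjoint C₀ C₁ → Conn E C₁ → (s : SeriesStep E C O W C₀ C₁) →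
    Fan E l C₀ (SeriesStep.L s) (SeriesStep.M s) → Fan E l C O W
  fan-near {C = C} {O} {W} {C₀} {C₁} st C₀⊆ C₁⊆ C₀∩C₁ cC₁ s = fan-pass {P = L} {Q = M ∪ C₁ ∪ R ∪ W} C₀⊆ id L⊆ S₀.O∩C S₀.cO tL
    (proj₁ (proj₂ (proj₂ S₀.tWC))) (∪ˡ ∘ ∪ˡ ∘ ∪ˡ) ∪ʳ
    (λ q → case ∪⁻ q of λ { (inj₂ w) → inj₂ w ; (inj₁ q') → inj₁ (∪-elim (∪-elim M⊆ C₁⊆) R⊆ q') })
    (∪-disj (∪-disj (∪-disj S₀.W∩C (disj-sym C₀∩C₁)) R∩C₀) (λ w c → State.W∩C st w (C₀⊆ c)))
    (∪-disj (∪-disj (∪-disj (disj-sym L∩M) (disj-sym L∩C₁)) (disj-sym L∩R)) (λ w l → State.W∩C st w (L⊆ l)))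
    (conn-∪ (conn-∪ (conn-∪ cM cC₁ S₁.tWC) S₁.cO (touch-mono ∪ʳ id (touch-sym S₁.tOC))) (State.cW st) (touch-mono ∪ʳ id tR))
    where
    open SeriesStep s
    module S₀ = State st₀
    module S₁ = State st₁

  -- Now the root faces the middle, so the root blob runs through `M`, the other core and `R` to
  -- `W`, and the apex through `L` to `O`.
  fan-far : ∀ {l C O W C₀ C₁} → State E C O W → C₀ ⊆ C → C₁ ⊆ C → Disjoint C₀ C₁ → Conn E C₁ → (s : SeriesStep E C O W C₀ C₁) →
    Fan E l C₀ (SeriesStep.M s) (SeriesStep.L s) → Fan E l C W O
  fan-far {C = C} {O} {W} {C₀} {C₁} st C₀⊆ C₁⊆ C₀∩C₁ cC₁ s = fan-pass {P = M ∪ C₁ ∪ R} {Q = L ∪ O} C₀⊆ (∪ˡ ∘ ∪ˡ) (∪-elim (∪-elim M⊆ C₁⊆) R⊆)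
    (∪-disj (∪-disj S₀.W∩C (disj-sym C₀∩C₁)) R∩C₀)
    (conn-∪ (conn-∪ cM cC₁ S₁.tWC) S₁.cO (touch-mono ∪ʳ id (touch-sym S₁.tOC))) (touch-mono ∪ʳ id tR)
    (proj₁ (proj₂ (proj₂ S₀.tOC))) ∪ˡ ∪ʳ
    (λ q → case ∪⁻ q of λ { (inj₂ w) → inj₂ w ; (inj₁ l) → inj₁ (L⊆ l) })
    (∪-disj S₀.O∩C (λ o c → State.O∩C st o (C₀⊆ c)))
    (∪-disj (disj-sym (∪-disj (∪-disj (disj-sym L∩M) (disj-sym L∩C₁)) (disj-sym L∩R))) (λ o q → State.O∩C st o (∪-elim (∪-elim M⊆ C₁⊆) R⊆ q)))
    (conn-∪ S₀.cO (State.cO st) tL)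
    where
    open SeriesStep s
    module S₀ = State st₀
    module S₁ = State st₁

  series-flip : ∀ {C O W C₀ C₁} → SeriesStep E C O W C₀ C₁ → SeriesStep E C W O C₁ C₀
  series-flip s = record { L = R ; M = M ; R = L ; L⊆ = R⊆ ; M⊆ = M⊆ ; R⊆ = L⊆ ; L∩M = R∩M ; R∩M = L∩M ; L∩R = disj-sym L∩R
    ; L∩C₁ = R∩C₀ ; R∩C₀ = L∩C₁ ; cM = cM ; tL = tR ; tR = tL ; st₀ = st₁ ; st₁ = st₀ }
    where open SeriesStep s

  parallel-flip : ∀ {C O W C₀ C₁} → ParallelStep E C O W C₀ C₁ → ParallelStep E C O W C₁ C₀
  parallel-flip s = record { Z = Z ; R₀ = R₁ ; R₁ = R₀ ; Z⊆ = Z⊆ ; R₀⊆ = R₁⊆ ; R₁⊆ = R₀⊆ ; Z∩R₀ = Z∩R₁ ; Z∩R₁ = Z∩R₀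
    ; R₀∩C₁ = R₁∩C₀ ; R₁∩C₀ = R₀∩C₁ ; tZ = tZ ; tR₀ = tR₁ ; tR₁ = tR₀ ; st₀ = st₁ ; st₁ = st₀ }
    where open ParallelStep s

  fan-side : ∀ {l C O W C₀ C₁} → State E C O W → C₀ ⊆ C → (s : ParallelStep E C O W C₀ C₁) →
    Fan E l C₀ (ParallelStep.R₀ s) (ParallelStep.Z s) → Fan E l C W O
  fan-side {C = C} {O} {W} {C₀} st C₀⊆ s = fan-pass {P = R₀} {Q = Z ∪ O} C₀⊆ id R₀⊆ S₀.W∩C S₀.cW tR₀
    (proj₁ (proj₂ (proj₂ S₀.tOC))) ∪ˡ ∪ʳ (λ q → Sum.map₁ Z⊆ (∪⁻ q))
    (∪-disj S₀.O∩C (λ o c → State.O∩C st o (C₀⊆ c))) (∪-disj Z∩R₀ (λ o r → State.O∩C st o (R₀⊆ r)))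
    (conn-∪ S₀.cO (State.cO st) tZ)
    where
    open ParallelStep s
    module S₀ = State st₀

  -- The two orientations of fans have separate heights, since a tripod at `O` raises only fans with
  -- their root towards `O`.
  Outcome : ℕ → ℕ → ℕ → (C O W : VSet n) → Set
  Outcome k l r C O W = Web E k C O W ⊎ Fan E l C O W ⊎ Fan E r C W O

  -- The second core has `R`, the set next to `W`, in the place of `O`; its orientation is reversed
  -- and its two fan heights are exchanged. Fans are only prolonged, and two webs combine.
  series-outcome : ∀ {k l r C O W C₀ C₁} → State E C O W → C₀ ⊆ C → C₁ ⊆ C → Disjoint C₀ C₁ → Conn E C₀ → Conn E C₁ → (s : SeriesStep E C O W C₀ C₁) →
    Outcome k l r C₀ (SeriesStep.L s) (SeriesStep.M s) → Outcome k r l C₁ (SeriesStep.R s) (SeriesStep.M s) → Outcome (suc k) l r C O W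
  series-outcome st c₀ c₁ d cc₀ cc₁ s (inj₁ u) (inj₁ v) = inj₁ (web-join st c₀ c₁ d s u v)
  series-outcome st c₀ c₁ d cc₀ cc₁ s (inj₂ (inj₁ f)) _ = inj₂ (inj₁ (fan-near st c₀ c₁ d cc₁ s f))
  series-outcome st c₀ c₁ d cc₀ cc₁ s (inj₂ (inj₂ f)) _ = inj₂ (inj₂ (fan-far st c₀ c₁ d cc₁ s f))
  series-outcome st c₀ c₁ d cc₀ cc₁ s _ (inj₂ (inj₁ f)) = inj₂ (inj₂ (fan-near (state-swap st) c₁ c₀ (disj-sym d) cc₀ (series-flip s) f))
  series-outcome st c₀ c₁ d cc₀ cc₁ s _ (inj₂ (inj₂ f)) = inj₂ (inj₁ (fan-far (state-swap st) c₁ c₀ (disj-sym d) cc₀ (series-flip s) f))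

  parallel-outcome₁ : ∀ {k l r C O W C₀ C₁} → State E C O W → C₀ ⊆ C → C₁ ⊆ C → Disjoint C₀ C₁ → (s : ParallelStep E C O W C₀ C₁) →
    Outcome k l r C₀ (ParallelStep.Z s) (ParallelStep.R₀ s) → Outcome k l r C₁ (ParallelStep.Z s) (ParallelStep.R₁ s) → Outcome k (suc l) r C O W
  parallel-outcome₁ st c₀ c₁ d s (inj₁ w) _ = inj₁ (web-pass st c₀ Z⊆ R₀⊆ tZ tR₀ w)
    where open ParallelStep s
  parallel-outcome₁ st c₀ c₁ d s _ (inj₁ w) = inj₁ (web-pass st c₁ Z⊆ R₁⊆ tZ tR₁ w)
    where open ParallelStep s
  parallel-outcome₁ st c₀ c₁ d s (inj₂ (inj₂ f)) _ = inj₂ (inj₂ (fan-side st c₀ s f))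
  parallel-outcome₁ st c₀ c₁ d s _ (inj₂ (inj₂ f)) = inj₂ (inj₂ (fan-side st c₁ (parallel-flip s) f))
  parallel-outcome₁ st c₀ c₁ d s (inj₂ (inj₁ f)) (inj₂ (inj₁ g)) = inj₂ (inj₁ (fan-join st c₀ c₁ d s f g))

  parallel-outcome₂ : ∀ {k l r C O W C₀ C₁} → State E C O W → C₀ ⊆ C → C₁ ⊆ C → Disjoint C₀ C₁ → (s : ParallelStep E C W O C₀ C₁) →
    Outcome k l r C₀ (ParallelStep.R₀ s) (ParallelStep.Z s) → Outcome k l r C₁ (ParallelStep.R₁ s) (ParallelStep.Z s) → Outcome k l (suc r) C O W
  parallel-outcome₂ st c₀ c₁ d s (inj₁ w) _ = inj₁ (web-pass st c₀ R₀⊆ Z⊆ tR₀ tZ w)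
    where open ParallelStep s
  parallel-outcome₂ st c₀ c₁ d s _ (inj₁ w) = inj₁ (web-pass st c₁ R₁⊆ Z⊆ tR₁ tZ w)
    where open ParallelStep s
  parallel-outcome₂ st c₀ c₁ d s (inj₂ (inj₁ f)) _ = inj₂ (inj₁ (fan-side (state-swap st) c₀ s f))
  parallel-outcome₂ st c₀ c₁ d s _ (inj₂ (inj₁ f)) = inj₂ (inj₁ (fan-side (state-swap st) c₁ (parallel-flip s) f))
  parallel-outcome₂ st c₀ c₁ d s (inj₂ (inj₂ f)) (inj₂ (inj₂ g)) = inj₂ (inj₂ (fan-join (state-swap st) c₀ c₁ d s f g))

  module _ (tc : TwoConn E full) where

    -- A series step lowers `k`, a parallel step `l` or `r` according to the side of its tripod, so
    -- one level of pods pays for each unit of the sum. A budget of zero is met at once by `C`, `O`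
    -- and `W`, as a triangle or as a single leaf with its apex.
    outcome : ∀ N k l r {C O W} → k + l + r ≤ N → Core E N C → State E C O W → Outcome k l r C O W
    outcome N zero l r le core st = inj₁ (web₀ (core-conn core) st)
    outcome N (suc k) zero r le core st = inj₂ (inj₁ (fan₀ (core-conn core) st))
    outcome N (suc k) (suc l) zero le core st = inj₂ (inj₂ (fan₀ (core-conn core) (state-swap st)))
    outcome (suc N) (suc k) (suc l) (suc r) (s≤s le) (core-s {E₀ = E₀} {E₁} cC p₀ p₁ E₀⊆ E₁⊆ E₀∩E₁) st =
      go (Quotient.next-step E E-sym tc st cC p₀ p₁ E₀⊆ E₁⊆ E₀∩E₁)
      where
      module P₀ = Pod p₀
      module P₁ = Pod p₁
      c₀ : P₀.C ⊆ _
      c₀ q = E₀⊆ (P₀.C⊆ q)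
      c₁ : P₁.C ⊆ _
      c₁ q = E₁⊆ (P₁.C⊆ q)
      d : Disjoint P₀.C P₁.C
      d p q = E₀∩E₁ (P₀.C⊆ p) (P₁.C⊆ q)
      leS : k + suc r + suc l ≤ N
      leS = subst (_≤ N) (trans (ℕₚ.+-assoc k (suc l) (suc r)) (trans (cong (k +_) (ℕₚ.+-comm (suc l) (suc r))) (sym (ℕₚ.+-assoc k (suc r) (suc l))))) le
      leL : suc k + l + suc r ≤ N
      leL = subst (_≤ N) (cong (_+ suc r) (ℕₚ.+-suc k l)) le
      leR : suc k + suc l + r ≤ N
      leR = subst (_≤ N) (ℕₚ.+-suc (k + suc l) r) le
      go : Step E _ _ _ P₀.C P₁.C → Outcome (suc k) (suc l) (suc r) _ _ _
      go (series₁ s) = series-outcome st c₀ c₁ d (core-conn P₀.core) (core-conn P₁.core) s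
        (outcome N k (suc l) (suc r) le P₀.core (SeriesStep.st₀ s)) (outcome N k (suc r) (suc l) leS P₁.core (SeriesStep.st₁ s))
      go (series₂ s) = series-outcome st c₁ c₀ (disj-sym d) (core-conn P₁.core) (core-conn P₀.core) s
        (outcome N k (suc l) (suc r) le P₁.core (SeriesStep.st₀ s)) (outcome N k (suc r) (suc l) leS P₀.core (SeriesStep.st₁ s))
      go (parallel₁ s) = parallel-outcome₁ st c₀ c₁ d s
        (outcome N (suc k) l (suc r) leL P₀.core (ParallelStep.st₀ s)) (outcome N (suc k) l (suc r) leL P₁.core (ParallelStep.st₁ s))
      go (parallel₂ s) = parallel-outcome₂ st c₀ c₁ d s
        (outcome N (suc k) (suc l) r leR P₀.core (state-swap (ParallelStep.st₀ s))) (outcome N (suc k) (suc l) r leR P₁.core (state-swap (ParallelStep.st₁ s)))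

-- Extracting the minors

any-NInt? : ∀ k {P : NInt k → Set} → (∀ i → Dec (P i)) → Dec (∃ P)
any-NInt? zero P? with P? tt
... | yes p = yes (tt , p)
... | no np = no λ { (tt , p) → np p }
any-NInt? (suc k) P? with P? (inj₁ tt) | any-NInt? k (P? ∘ inj₂ ∘ inj₁) | any-NInt? k (P? ∘ inj₂ ∘ inj₂)
... | yes p | _ | _ = yes (_ , p)
... | no _ | yes (i , p) | _ = yes (_ , p)
... | no _ | no _ | yes (i , p) = yes (_ , p)
... | no a | no b | no c = no λ { (inj₁ tt , p) → a p ; (inj₂ (inj₁ i) , p) → b (i , p) ; (inj₂ (inj₂ i) , p) → c (i , p) }

any-NV? : ∀ k {P : NV k → Set} → (∀ h → Dec (P h)) → Dec (∃ P)
any-NV? k P? with P? (inj₁ false) | P? (inj₁ true) | any-NInt? k (P? ∘ inj₂)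
... | yes p | _ | _ = yes (_ , p)
... | no _ | yes p | _ = yes (_ , p)
... | no _ | no _ | yes (i , p) = yes (_ , p)
... | no a | no b | no c = no λ { (inj₁ false , p) → a p ; (inj₁ true , p) → b p ; (inj₂ i , p) → c (i , p) }

module _ (G : Graph) where
  open Sym (adj G) (adj-symm G)

  web⇒nabla : ∀ {k C O W} (h : 1 ≤ suc k) → Web (adj G) k C O W → IsMinorOf (Nabla (suc k) h) G
  web⇒nabla {k} h web = blobs⇒minor {H = Nabla (suc k) h} record
    { blob = blob ; disj = disj ; conn = conn ; inhab = inhab
    ; touch = λ { (inj₁ e) → touch e ; (inj₂ e) → touch-sym (touch e) }
    ; locate = λ x → any-NV? k (λ h → x ∈? blob h) }
    where open Web web

  fan⇒gamma : ∀ {l C O W} → Fan (adj G) l C O W → IsMinorOf (GammaPlus l) G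
  fan⇒gamma f = tree⇒gamma G tree cK K∩D
    where open Fan f

-- Both fan heights are `suc k`, whereas ∇ costs only `k` steps because its first triangle is free.
-- The additional level of `treeHeight` is spent on a complement for the outermost pod.
coreSize treeHeight treeSize : ℕ → ℕ
coreSize k = k + suc k + suc k
treeHeight k = suc (podHeight (suc k) (coreSize k))
treeSize k = heapSize (treeHeight k)

module _ (G : Graph) (two : TwoConnected G) (k : ℕ) where

  private
    twoConn : TwoConn (adj G) full
    twoConn = record { supp = λ _ → full⁺ ; link = λ v {x} {y} _ _ x≢ y≢ → fromWalkIn id (proj₂ (proj₂ two) v x y x≢ y≢) }

    connected : Conn (adj G) full
    connected {x} {y} _ _ = fromWalkIn (λ _ → full⁺) (proj₁ (proj₂ two) x y)

  open Sym (adj G) (adj-symm G)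
  open Pods (adj G) (adj-symm G) twoConn
  open Gadgets (adj G) (adj-symm G)

  Target : Set
  Target = IsMinorOf (GammaPlus (suc k)) G ⊎ IsMinorOf (Nabla (suc k) (s≤s z≤n)) G

  -- The rails of the outermost pod serve as the initial `O` and `W`.
  from-pod : ∀ {D} → Pod (adj G) (coreSize k) D → Target
  from-pod pod with outcome twoConn (coreSize k) k (suc k) (suc k) ℕₚ.≤-refl core st
    where
    open Pod pod
    st : State (adj G) C X Y
    st = record { O∩C = X∩C ; W∩C = Y∩C ; O∩W = X∩Y ; cO = cX ; cW = cY ; tOW = tXY ; tOC = tXC ; tWC = tYC
                ; closed = λ c e → case closed c e of λ { (inj₁ x) → inj₂ (inj₁ x) ; (inj₂ (inj₁ y)) → inj₂ (inj₂ y) ; (inj₂ (inj₂ z)) → inj₁ z } }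
  ... | inj₁ web = inj₂ (web⇒nabla G (s≤s z≤n) web)
  ... | inj₂ (inj₁ fan) = inj₁ (fan⇒gamma G fan)
  ... | inj₂ (inj₂ fan) = inj₁ (fan⇒gamma G fan)

  -- The pod is sought in one child subtree; the root blob and the other child subtree form its
  -- complement, which is connected and touches the root of the first.
  from-bush : ∀ {D B} → (∀ {x} → x ∈ D) → Bush (adj G) (treeHeight k) D B → Target
  from-bush all (bnode {B = B} {D₀} {B₀} {D₁} {B₁} cB _ _ _ _ d₀ _ d₀₁ cov t₀ t₁ s t) =
    Sum.[ (λ { (K , _ , _ , tr , cK , K∩D) → inj₁ (tree⇒gamma G tr cK K∩D) }) , from-pod ]
      (buildPod (suc k) (coreSize k) s
        (conn-ext (∪-elim (λ b → ∁⁺ (d₀ b)) (λ d → ∁⁺ (λ c → d₀₁ c d)))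
          (λ q → case cov all of λ { (inj₁ b) → ∪ˡ b ; (inj₂ (inj₁ c)) → ⊥-elim (∁⁻ q c) ; (inj₂ (inj₂ d)) → ∪ʳ d })
          (conn-∪ cB (bush-conn t) (touch-mono id (bush-root t) t₁)))
        (touch-mono id (λ b → ∁⁺ (d₀ b)) (touch-sym t₀)))

  minors : PathwidthAtLeast G (suc (treeSize k)) → Target
  minors pw = from-bush FL.everything (FL.bush (treeHeight k) [] refl)
    where
    module Gr = Growth (adj G) (adj-symm G) ⌊_/2⌋ (ℕₚ.⌊n/2⌋≤n) (treeSize k)
                  -- A good whole graph would have a decomposition of width `treeSize k`, one less
                  -- than the assumed path-width.
                  (λ g → ℕₚ.<-irrefl refl (pw (treeSize k) (good⇒decomposition G g)))
    module FL = FromLabelling (adj G) (adj-symm G) connected (treeHeight k) (proj₂ Gr.tree-labelling)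

theorem1p3 : (ℓ : ℕ) → (hℓ : 1 ≤ ℓ) → ∃[ p ] ((G : Graph) → TwoConnected G → PathwidthAtLeast G p → IsMinorOf (GammaPlus ℓ) G ⊎ IsMinorOf (Nabla ℓ hℓ) G)
theorem1p3 (suc k) (s≤s z≤n) = suc (treeSize k) , λ G two pw → minors G two k pw
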